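{- Let $\mathbb{F}$ be a field, let $\beta^{m,n}_d=\dim_{\mathbb{F}}\tilde{H}_d(\mathsf{M}_{m,n};\mathbb{F})$, and define $\hat\beta^{a,b}_k=\beta^{m,n}_d$ where $m=k+a+3b-1$, $n=k+2a+3b-1$, $d=k+a+2b-2$. For each integer $k\ge0$ there is a polynomial $f_k(a,b)$ of degree $3k$ such that $\hat\beta^{a,b}_k\le f_k(a,b)$ whenever $a\ge0$ and $b\ge k+2$, and such that \[ f_k(a,b)=\frac{1}{3^k k!}\bigl((a+3b)^3-9b^3\bigr)^k+\epsilon_k(a,b) \] for some polynomial $\epsilon_k(a,b)$ of degree at most $3k-1$. Equivalently, $\beta^{m,n}_d\le f_{3d-m-n+4}(n-m,m-d-1)$ whenever $m\le n\le 2m-5$ and $\frac{m+n-4}{3}\le d\le\frac{2m+n-7}{4}$.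
   Context: $\mathsf{M}_{m,n}$ denotes the chessboard complex: the simplicial complex whose faces are the matchings (sets of pairwise vertex-disjoint edges) in the complete bipartite graph $K_{m,n}$. $\tilde H$ denotes reduced simplicial homology. -}

module Defs where

open import Level using (Level; _⊔_)
open import Algebra.Bundles using (CommutativeRing)
open import Data.Nat as ℕ using (ℕ; zero; suc; _!)
open import Data.Nat.Properties using (_<?_; m*n≢0; m^n≢0; _!≢0)
open import Data.Fin using (Fin; zero; suc; toℕ)
import Data.Fin.Properties as FinP
open import Data.Vec using (Vec; []; _∷_; removeAt; lookup)
import Data.Vec.Properties as VecP
open import Data.Product using (Σ; _×_; _,_; ∃; ∃-syntax; proj₁; proj₂)
import Data.Product.Properties as ProdP
open import Data.List as List using (List; []; _∷_; length; filter; concatMap; map; allFin)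
open import Data.List.Relation.Unary.All using (All)
open import Data.Bool using (Bool; true; false; if_then_else_)
open import Relation.Nullary using (¬_; Dec; yes; no)
open import Relation.Nullary.Decidable using (_×-dec_; ⌊_⌋)
open import Relation.Binary.PropositionalEquality using (_≡_)
open import Data.Integer as ℤ using (ℤ; +_)
open import Data.Rational as ℚ using (ℚ)

record Field (c ℓ : Level) : Set (Level.suc (c ⊔ ℓ)) where
  field
    commutativeRing : CommutativeRing c ℓ
  open CommutativeRing commutativeRing public
  field
    0≉1     : ¬ (0# ≈ 1#)
    inverse : ∀ x → ¬ (x ≈ 0#) → ∃[ y ] (x * y ≈ 1#)

-- Faces of the chessboard complex M_{m,n}.
-- A face with p vertices (dimension p-1) is a matching of size p in
-- K_{m,n}, i.e. p edges (i , j) ∈ Fin m × Fin n with distinct rows and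
-- distinct columns.  Each face is represented exactly once, by listing
-- its edges in strictly increasing order of their row index; this is
-- also the vertex order used for the simplicial boundary signs.
-- p = 0 gives the single empty face (used for reduced homology).

Edge : ℕ → ℕ → Set
Edge m n = Fin m × Fin n

allEdges : (m n : ℕ) → List (Edge m n)
allEdges m n = concatMap (λ i → map (λ j → (i , j)) (allFin n)) (allFin m)

allVecs : {A : Set} → List A → (p : ℕ) → List (Vec A p)
allVecs xs zero    = [] ∷ []
allVecs xs (suc p) = concatMap (λ x → map (x ∷_) (allVecs xs p)) xs

headOK : ∀ {m n p} → Edge m n → Vec (Edge m n) p → Bool
headOK e [] = true
headOK (i , j) ((i' , j') ∷ es) =
  if ⌊ toℕ i <? toℕ i' ⌋
  then (if ⌊ j FinP.≟ j' ⌋ then false else headOK (i , j) es)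
  else false

isFace : ∀ {m n p} → Vec (Edge m n) p → Bool
isFace [] = true
isFace (e ∷ es) = if headOK e es then isFace es else false

faces : (m n p : ℕ) → List (Vec (Edge m n) p)
faces m n p = filter (λ v → isFace v Data.Bool.≟ true) (allVecs (allEdges m n) p)

#faces : (m n p : ℕ) → ℕ
#faces m n p = length (faces m n p)

face : ∀ m n p → Fin (#faces m n p) → Vec (Edge m n) p
face m n p = List.lookup (faces m n p)

module LinAlg {c ℓ} (F : Field c ℓ) where
  open Field F using (Carrier; _≈_; _+_; _*_; -_; 0#; 1#)

  ∑ : ∀ {k} → (Fin k → Carrier) → Carrier
  ∑ {zero}  f = 0#
  ∑ {suc k} f = f zero + ∑ (λ i → f (suc i))

  Independent : ∀ {R C r} → (Fin R → Fin C → Carrier) → (Fin r → Fin C) → Set (c ⊔ ℓ)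
  Independent {R} {C} {r} M ι =
    (a : Fin r → Carrier) →
    (∀ i → ∑ (λ j → a j * M i (ι j)) ≈ 0#) → ∀ j → a j ≈ 0#

  IsRank : ∀ {R C} → (Fin R → Fin C → Carrier) → ℕ → Set (c ⊔ ℓ)
  IsRank {R} {C} M r =
    (∃[ ι ] Independent {r = r} M ι) ×
    (∀ (ι : Fin (suc r) → Fin C) → ¬ Independent M ι)

  sign : ℕ → Carrier
  sign zero          = 1#
  sign (suc zero)    = - 1#
  sign (suc (suc t)) = sign t

  -- the simplicial boundary matrix ∂ : C_p → C_{p-1}, where C_p has
  -- basis the faces with (p+1) vertices: the entry at (τ , σ) is
  -- Σ_t (-1)^t [τ = σ with its t-th vertex removed].
  ∂ : ∀ m n p → Fin (#faces m n p) → Fin (#faces m n (suc p)) → Carrier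
  ∂ m n p τ σ =
    ∑ (λ (t : Fin (suc p)) →
         if ⌊ VecP.≡-dec (ProdP.≡-dec FinP._≟_ FinP._≟_)
                (removeAt (face m n (suc p) σ) t) (face m n p τ) ⌋
         then sign (toℕ t) else 0#)

  -- β = dim H̃_d(M_{m,n}; F) = dim C_d − rank ∂_d − rank ∂_{d+1},
  -- where C_d has basis the faces with d+1 vertices and ∂_d : C_d → C_{d-1}
  -- (C_{-1} spanned by the empty face: reduced homology).
  IsReducedBetti : (m n d β : ℕ) → Set (c ⊔ ℓ)
  IsReducedBetti m n d β =
    ∃[ r₁ ] ∃[ r₂ ]
      IsRank (∂ m n d) r₁ × IsRank (∂ m n (suc d)) r₂ ×
      (β ℕ.+ r₁ ℕ.+ r₂ ≡ #faces m n (suc d))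

Poly2 : Set
Poly2 = List (ℚ × ℕ × ℕ)

_^ℚ_ : ℚ → ℕ → ℚ
x ^ℚ zero  = ℚ.1ℚ
x ^ℚ suc k = x ℚ.* (x ^ℚ k)

evalMono : ℚ × ℕ × ℕ → ℚ → ℚ → ℚ
evalMono (q , i , j) a b = q ℚ.* (a ^ℚ i) ℚ.* (b ^ℚ j)

eval : Poly2 → ℚ → ℚ → ℚ
eval P a b = List.foldr (λ mono acc → evalMono mono a b ℚ.+ acc) ℚ.0ℚ P

-- degree ≤ D - 1, i.e. every monomial has total degree < D
-- (for D = 0 this forces the zero polynomial)
DegreeBelow : ℕ → Poly2 → Set
DegreeBelow D P = All (λ { (q , i , j) → i ℕ.+ j ℕ.< D }) P

toℚ : ℕ → ℚ
toℚ k = (+ k) ℚ./ 1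

denom : ℕ → ℕ
denom k = 3 ℕ.^ k ℕ.* k !

denom≢0 : ∀ k → ℕ.NonZero (denom k)
denom≢0 k = m*n≢0 (3 ℕ.^ k) (k !) {{m^n≢0 3 k}} {{k !≢0}}

leading : ℕ → ℚ → ℚ → ℚ
leading k a b =
  (ℚ._/_ (+ 1) (denom k) {{denom≢0 k}}) ℚ.*
  ((((a ℚ.+ toℚ 3 ℚ.* b) ^ℚ 3) ℚ.- (toℚ 9 ℚ.* (b ^ℚ 3))) ^ℚ k)

fPoly : ℕ → Poly2 → ℚ → ℚ → ℚ
fPoly k ε a b = leading k a b ℚ.+ eval ε a b

{-# OPTIONS --safe #-}
module Submission where

-- A chain with p vertices on the board R × S is an alternating function f on words of p edges; then
-- (∂ f)(w) = Σ_e f(e w) and ∂ (e ∧ y) = y - e ∧ ∂ y.  Fix a row r and columns s, s′.  A cycle z whose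
-- coefficients z(r u) all bound is homologous to a cycle x avoiding r.  If the coefficients x((t s)(u s′)) bound
-- as well, then up to boundaries x = P + P′ with P avoiding s′ and P′ avoiding s, and coning P with e_{r s′} and P′
-- with e_{r s} shows that x is homologous to (e_{r s′} - e_{r s}) ∧ ∂ P.  Writing h_p(m,n) for the dimension of the
-- homology of M_{m,n} spanned by cycles with p vertices, this gives
--   h_p(m,n) ≤ n h_{p-1}(m-1,n-1) + (m-1)(m-2) h_{p-2}(m-3,n-2) + h_{p-1}(m-1,n-2),
-- that is, β̂_k^{a,b} ≤ n β̂_{k-1}^{a,b} + (m-1)(m-2) β̂_{k-1}^{a+1,b-1} + β̂_k^{a-1,b}, where (-1 , b) means (1 , b-1) by
-- transposition.  The terms with k < 0 vanish, and β̂_0^{0,2} ≤ 1 is a computation with explicit cycles in M_{5,5}.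
-- Both recursions lower a + 2b by one, so Bernoulli's inequality yields by induction on k a constant K with
--   3^k k! β̂_k^{a,b} ≤ ((a+3b)³ - 9b³ + 3K(a+2b)²)^k.
-- Equality in the field need not be decidable; dimensions are therefore bounded up to double negation, which is
-- harmless because the final inequality between rationals is decidable.

open import Defs
open import Level using (Level; _⊔_)
open import Algebra.Bundles using (RawRing)
import Algebra.Properties.Ring as RingProperties
import Algebra.Properties.Semiring.Mult as Mult
import Algebra.Solver.Ring as RingSolver
import Algebra.Solver.Ring.AlmostCommutativeRing as ACR
open import Data.Bool using (Bool; true; false; if_then_else_)
import Data.Bool.Properties as Boolₚ
open import Data.Empty using (⊥; ⊥-elim)
open import Data.Fin using (Fin; zero; suc; toℕ; punchIn)
import Data.Fin.Properties as Finₚ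
open import Data.Integer as ℤ using (+_)
import Data.Integer.Properties as ℤₚ
open import Data.List as List using (List; []; _∷_; length; concatMap; map; allFin; filter; lookup; tabulate)
import Data.List.Properties as Listₚ
open import Data.List.Membership.Propositional using (_∈_; lose)
open import Data.List.Membership.Propositional.Properties using (∈-concatMap⁺; ∈-map⁺; ∈-map⁻; ∈-allFin; ∈-filter⁺; ∈-filter⁻; ∈-lookup)
open import Data.List.Relation.Binary.Disjoint.Propositional using (Disjoint)
open import Data.List.Relation.Unary.All as All using (All; []; _∷_)
import Data.List.Relation.Unary.All.Properties as Allₚ
open import Data.List.Relation.Unary.AllPairs as AllPairs using ([]; _∷_)
import Data.List.Relation.Unary.AllPairs.Properties as AllPairsₚ
open import Data.List.Relation.Unary.Any as Any using (here)
open import Data.List.Relation.Unary.Any.Properties using (lookup-index)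
open import Data.List.Relation.Unary.Unique.Propositional using (Unique)
import Data.List.Relation.Unary.Unique.Propositional.Properties as Uniqueₚ
open import Data.Maybe using (Maybe; just; nothing)
open import Data.Nat as ℕ using (ℕ; zero; suc; s≤s; z≤n; _!)
import Data.Nat.Properties as ℕₚ
open import Data.Nat.Tactic.RingSolver using (solve-∀)
open import Data.Product using (Σ; _×_; _,_; ∃-syntax; proj₁; proj₂; swap)
import Data.Product.Properties as Prodₚ
open import Data.Rational as ℚ using (ℚ)
import Data.Rational.Properties as ℚₚ
open import Data.Rational.Solver using (module +-*-Solver)
import Data.Rational.Unnormalised as ℚᵘ
import Data.Rational.Unnormalised.Properties as ℚᵘₚ
open import Data.Sum using (_⊎_; inj₁; inj₂)
open import Data.Unit using () renaming (⊤ to Unit)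
open import Data.Unit.Polymorphic using (⊤; tt)
open import Data.Vec as Vec using (Vec; []; _∷_; removeAt; insertAt)
import Data.Vec.Properties as Vecₚ
open import Data.Vec.Relation.Unary.All as Allᵥ using ([]; _∷_) renaming (All to AllV)
open import Relation.Binary using (tri<; tri≈; tri>)
import Relation.Binary.Reasoning.Setoid as SetoidReasoning
open import Relation.Binary.PropositionalEquality as ≡ using (_≡_; _≢_)
open import Relation.Nullary using (¬_; Dec; yes; no; does)
open import Relation.Nullary.Decidable using (_×-dec_; ⌊_⌋; decidable-stable)

-- The cubic is forced by the recursion. Multiplying by 3^k k! turns the two terms of index k - 1
-- into k · 3(n + (m-1)(m-2)) · g^(k-1), the first-order term of (g + 3m²)^k to leading order. As m
-- = a + 3b up to terms depending on k, a polynomial g fit for the induction must gain 3(a+3b)² from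
-- (a-1 , b) to (a , b), which fixes (a+3b)³ up to a function of b. Along a = 0 the step comes from
-- (1 , b-1) and must gain 27b², while 27b³ alone would gain 54b²; the correction has slope -27b²
-- and is therefore -9b³. The remaining discrepancies have lower degree. They come from the summand
-- k in m and from evaluating the terms of index k - 1 at a shifted point. The quadratic 3K(a+2b)²
-- absorbs them: it increases by about 6K(a+2b) at every step, and b ≥ k + 2 bounds k by b. K may
-- grow with k, since it only enters below degree 3k.

-- Arithmetic of the bounding polynomial

module Growth where

  open import Data.Nat using (_+_; _*_; _^_; _≤_)

  -- (a + 3b)³ - 9b³ + 3K (a + 2b)²; both recursions lower a + 2b by exactly one.
  growth : ℕ → ℕ → ℕ → ℕ
  growth K a b = a * a * a + 9 * (a * a * b) + 27 * (a * b * b) + 18 * (b * b * b) + 3 * K * ((a + 2 * b) * (a + 2 * b))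

  ≤-by : ∀ {x y d} → x + d ≡ y → x ≤ y
  ≤-by {x} {d = d} ≡.refl = ℕₚ.m≤m+n x d

  -- The comparison point has s = a + 2b smaller by one, so the constant must pay for it: (s+1)² ≤
  -- 4s² gives the factor 4, and the cubic grows by at most 9s², which gives the 3. `E` is slack for
  -- the other requirements on the new constant.
  growth-a₁ : ∀ a x K E → growth K (suc a) (3 + x) ≤ growth (4 * K + 3 + E) a (3 + x)
  growth-a₁ a x K E = ≤-by (id a x K E)
    where
    id : ∀ a x K E → ((1 + a) * (1 + a) * (1 + a) + 9 * ((1 + a) * (1 + a) * (3 + x)) + 27 * ((1 + a) * (3 + x) * (3 + x)) + 18 * ((3 + x) * (3 + x) * (3 + x)) + 3 * K * (((1 + a) + 2 * (3 + x)) * ((1 + a) + 2 * (3 + x)))) + (53 + 108 * E + 36 * E * a + 3 * E * a * a + 12 * E * a * x + 72 * E * x + 12 * E * x * x + 285 * K + 102 * K * a + 9 * K * a * a + 36 * K * a * x + 204 * K * x + 36 * K * x * x + 51 * a + 6 * a * a + 18 * a * x + 45 * x + 9 * x * x) ≡ (a * a * a + 9 * (a * a * (3 + x)) + 27 * (a * (3 + x) * (3 + x)) + 18 * ((3 + x) * (3 + x) * (3 + x)) + 3 * (4 * K + 3 + E) * ((a + 2 * (3 + x)) * (a + 2 * (3 + x))))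
    id = solve-∀

  growth-a₂ : ∀ a x K E → growth K (2 + a) (2 + x) ≤ growth (4 * K + 3 + E) a (3 + x)
  growth-a₂ a x K E = ≤-by (id a x K E)
    where
    id : ∀ a x K E → ((2 + a) * (2 + a) * (2 + a) + 9 * ((2 + a) * (2 + a) * (2 + x)) + 27 * ((2 + a) * (2 + x) * (2 + x)) + 18 * ((2 + x) * (2 + x) * (2 + x)) + 3 * K * (((2 + a) + 2 * (2 + x)) * ((2 + a) + 2 * (2 + x)))) + (370 + 108 * E + 36 * E * a + 3 * E * a * a + 12 * E * a * x + 72 * E * x + 12 * E * x * x + 324 * K + 108 * K * a + 9 * K * a * a + 36 * K * a * x + 216 * K * x + 36 * K * x * x + 159 * a + 12 * a * a + 54 * a * x + 234 * x + 36 * x * x) ≡ (a * a * a + 9 * (a * a * (3 + x)) + 27 * (a * (3 + x) * (3 + x)) + 18 * ((3 + x) * (3 + x) * (3 + x)) + 3 * (4 * K + 3 + E) * ((a + 2 * (3 + x)) * (a + 2 * (3 + x))))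
    id = solve-∀

  growth-b₁ : ∀ x K E → growth K 0 (3 + x) ≤ growth (4 * K + 3 + E) 1 (2 + x)
  growth-b₁ x K E = ≤-by (id x K E)
    where
    id : ∀ x K E → (0 * 0 * 0 + 9 * (0 * 0 * (3 + x)) + 27 * (0 * (3 + x) * (3 + x)) + 18 * ((3 + x) * (3 + x) * (3 + x)) + 3 * K * ((0 + 2 * (3 + x)) * (0 + 2 * (3 + x)))) + (10 + 75 * E + 60 * E * x + 12 * E * x * x + 192 * K + 168 * K * x + 36 * K * x * x + 27 * x + 9 * x * x) ≡ (1 * 1 * 1 + 9 * (1 * 1 * (2 + x)) + 27 * (1 * (2 + x) * (2 + x)) + 18 * ((2 + x) * (2 + x) * (2 + x)) + 3 * (4 * K + 3 + E) * ((1 + 2 * (2 + x)) * (1 + 2 * (2 + x))))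
    id = solve-∀

  growth-b₂ : ∀ x K E → growth K 1 (2 + x) ≤ growth (4 * K + 3 + E) 1 (2 + x)
  growth-b₂ x K E = ≤-by (id x K E)
    where
    id : ∀ x K E → (1 * 1 * 1 + 9 * (1 * 1 * (2 + x)) + 27 * (1 * (2 + x) * (2 + x)) + 18 * ((2 + x) * (2 + x) * (2 + x)) + 3 * K * ((1 + 2 * (2 + x)) * (1 + 2 * (2 + x)))) + (225 + 75 * E + 60 * E * x + 12 * E * x * x + 225 * K + 180 * K * x + 36 * K * x * x + 180 * x + 36 * x * x) ≡ (1 * 1 * 1 + 9 * (1 * 1 * (2 + x)) + 27 * (1 * (2 + x) * (2 + x)) + 18 * ((2 + x) * (2 + x) * (2 + x)) + 3 * (4 * K + 3 + E) * ((1 + 2 * (2 + x)) * (1 + 2 * (2 + x))))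
    id = solve-∀

  -- The quadratic part of 3(n + m₁m₂) is 3(a+3b)², the derivative of the cubic in a. What m₁ and m₂
  -- contribute through k is covered by the increment of 3K(a+2b)²; K ≥ 3 + 3k suffices because b =
  -- 3 + k + j exceeds k.
  growth-a₃ : ∀ a k j L → growth (3 + 3 * k + L) a (3 + (k + j)) + 3 * ((2 + (k + 2 * a + 9 + 3 * (k + j))) + (2 + (k + a + 7 + 3 * (k + j))) * (1 + (k + a + 7 + 3 * (k + j)))) ≤ growth (3 + 3 * k + L) (suc a) (3 + (k + j))
  growth-a₃ a k j L = ≤-by (id a k j L)
    where
    id : ∀ a k j L → (a * a * a + 9 * (a * a * (3 + (k + j))) + 27 * (a * (3 + (k + j)) * (3 + (k + j))) + 18 * ((3 + (k + j)) * (3 + (k + j)) * (3 + (k + j))) + 3 * (3 + 3 * k + L) * ((a + 2 * (3 + (k + j))) * (a + 2 * (3 + (k + j))))) + 3 * ((2 + (k + 2 * a + 9 + 3 * (k + j))) + (2 + (k + a + 7 + 3 * (k + j))) * (1 + (k + a + 7 + 3 * (k + j)))) + (139 + 39 * L + 6 * L * a + 12 * L * j + 12 * L * k + 18 * a + 12 * a * k + 45 * j + 18 * j * k + 108 * k + 15 * k * k) ≡ ((1 + a) * (1 + a) * (1 + a) + 9 * ((1 + a) * (1 + a) * (3 + (k + j))) + 27 * ((1 + a) * (3 + (k + j)) * (3 + (k + j))) + 18 * ((3 + (k + j)) * (3 + (k + j)) * (3 + (k + j))) + 3 * (3 + 3 * k + L) * (((1 + a) + 2 * (3 + (k + j)))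 * ((1 + a) + 2 * (3 + (k + j)))))
    id = solve-∀

  -- The same balance on the edge a = 0: from (1 , b-1) to (0 , b) the cubic gains 27b² to leading
  -- order, which is 3m² there.
  growth-b₃ : ∀ k j L → growth (3 + 3 * k + L) 1 (2 + (k + j)) + 3 * ((2 + (k + 7 + 3 * (k + j))) + (2 + (k + 6 + 3 * (k + j))) * (1 + (k + 6 + 3 * (k + j)))) ≤ growth (3 + 3 * k + L) 0 (3 + (k + j))
  growth-b₃ k j L = ≤-by (id k j L)
    where
    id : ∀ k j L → (1 * 1 * 1 + 9 * (1 * 1 * (2 + (k + j))) + 27 * (1 * (2 + (k + j)) * (2 + (k + j))) + 18 * ((2 + (k + j)) * (2 + (k + j)) * (2 + (k + j))) + 3 * (3 + 3 * k + L) * ((1 + 2 * (2 + (k + j))) * (1 + 2 * (2 + (k + j))))) + 3 * ((2 + (k + 7 + 3 * (k + j))) + (2 + (k + 6 + 3 * (k + j))) * (1 + (k + 6 + 3 * (k + j)))) + (119 + 33 * L + 12 * L * j + 12 * L * k + 45 * j + 18 * j * k + 96 * k + 15 * k * k) ≡ (0 * 0 * 0 + 9 * (0 * 0 * (3 + (k + j))) + 27 * (0 * (3 + (k + j)) * (3 + (k + j))) + 18 * ((3 + (k + j)) * (3 + (k + j)) * (3 + (k + j))) + 3 * (3 + 3 * k + L) * ((0 + 2 * (3 + (k + j))) * (0 + 2 * (3 + (k + j)))))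
    id = solve-∀

  bernoulli : ∀ k {x y z} → x + y ≤ z → x ^ suc k + suc k * (y * x ^ k) ≤ z ^ suc k
  bernoulli zero {x} {y} {z} h = ≡.subst₂ _≤_ (id x y) (≡.sym (ℕₚ.*-identityʳ z)) h
    where
    id : ∀ x y → x + y ≡ x * 1 + 1 * (y * 1)
    id = solve-∀
  bernoulli (suc k) {x} {y} {z} h = ℕₚ.≤-trans (≤-by (id k x y (x ^ k))) (ℕₚ.*-mono-≤ h (bernoulli k {x} {y} h))
    where
    id : ∀ k x y u → (x * (x * u) + (2 + k) * (y * (x * u))) + (1 + k) * (y * y * u)
         ≡ (x + y) * (x * u + (1 + k) * (y * u))
    id = solve-∀

  -- The factor `3 * suc k` is the ratio of consecutive denominators `denom`. It makes the terms N₁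
  -- and N₂ the first-order part of the Bernoulli inequality, while N₃ supplies the power of g
  -- itself.
  combine : ∀ k d n m₁ m₂ {N₁ N₂ N₃ g h} → N₁ * d ≤ g ^ k → N₂ * d ≤ g ^ k → N₃ * (3 * suc k * d) ≤ g ^ suc k →
    g + 3 * (n + m₁ * m₂) ≤ h →
    (n * N₁ + (m₁ * (m₂ * N₂) + N₃)) * (3 * suc k * d) ≤ h ^ suc k
  combine k d n m₁ m₂ {N₁} {N₂} {N₃} {g} {h} h₁ h₂ h₃ hg = begin
    (n * N₁ + (m₁ * (m₂ * N₂) + N₃)) * (3 * suc k * d)
      ≡⟨ id₁ k d n m₁ m₂ N₁ N₂ N₃ ⟩
    N₃ * (3 * suc k * d) + suc k * (3 * (n * (N₁ * d) + m₁ * m₂ * (N₂ * d)))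
      ≤⟨ ℕₚ.+-mono-≤ h₃ (ℕₚ.*-monoʳ-≤ (suc k) (ℕₚ.*-monoʳ-≤ 3 (ℕₚ.+-mono-≤ (ℕₚ.*-monoʳ-≤ n h₁) (ℕₚ.*-monoʳ-≤ (m₁ * m₂) h₂)))) ⟩
    g ^ suc k + suc k * (3 * (n * g ^ k + m₁ * m₂ * g ^ k))
      ≡⟨ ≡.cong (λ z → g ^ suc k + suc k * z) (id₂ n (m₁ * m₂) (g ^ k)) ⟩
    g ^ suc k + suc k * (3 * (n + m₁ * m₂) * g ^ k)
      ≤⟨ bernoulli k {g} {3 * (n + m₁ * m₂)} hg ⟩
    h ^ suc k ∎
    where
    open ℕₚ.≤-Reasoning
    id₁ : ∀ k d n m₁ m₂ N₁ N₂ N₃ → (n * N₁ + (m₁ * (m₂ * N₂) + N₃)) * (3 * (1 + k) * d) ≡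
      N₃ * (3 * (1 + k) * d) + (1 + k) * (3 * (n * (N₁ * d) + m₁ * m₂ * (N₂ * d)))
    id₁ = solve-∀
    id₂ : ∀ n m g → 3 * (n * g + m * g) ≡ 3 * (n + m) * g
    id₂ = solve-∀

-- Polynomials over the rationals and their degrees

module Polynomials where

  open Growth using (growth; ≤-by)

  toℚᵘ-toℚ : ∀ n → ℚ.toℚᵘ (toℚ n) ℚᵘ.≃ ℚᵘ.mkℚᵘ (+ n) 0
  toℚᵘ-toℚ n = ℚₚ.toℚᵘ-fromℚᵘ (ℚᵘ.mkℚᵘ (+ n) 0)

  toℚ-+ : ∀ {m n x y} → toℚ m ≡ x → toℚ n ≡ y → toℚ (m ℕ.+ n) ≡ x ℚ.+ y
  toℚ-+ {m} {n} ≡.refl ≡.refl = ℚₚ.toℚᵘ-injective (begin-equality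
    ℚ.toℚᵘ (toℚ (m ℕ.+ n)) ≃⟨ toℚᵘ-toℚ (m ℕ.+ n) ⟩
    ℚᵘ.mkℚᵘ (+ (m ℕ.+ n)) 0 ≃⟨ ℚᵘ.*≡* (≡.cong (ℤ._* ℤ.1ℤ) (≡.cong₂ ℤ._+_ (≡.sym (ℤₚ.*-identityʳ (+ m))) (≡.sym (ℤₚ.*-identityʳ (+ n))))) ⟩
    ℚᵘ.mkℚᵘ (+ m) 0 ℚᵘ.+ ℚᵘ.mkℚᵘ (+ n) 0 ≃⟨ ℚᵘₚ.+-cong (ℚᵘₚ.≃-sym (toℚᵘ-toℚ m)) (ℚᵘₚ.≃-sym (toℚᵘ-toℚ n)) ⟩
    ℚ.toℚᵘ (toℚ m) ℚᵘ.+ ℚ.toℚᵘ (toℚ n) ≃⟨ ℚᵘₚ.≃-sym (ℚₚ.toℚᵘ-homo-+ (toℚ m) (toℚ n)) ⟩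
    ℚ.toℚᵘ (toℚ m ℚ.+ toℚ n) ∎)
    where open ℚᵘₚ.≤-Reasoning

  toℚ-* : ∀ {m n x y} → toℚ m ≡ x → toℚ n ≡ y → toℚ (m ℕ.* n) ≡ x ℚ.* y
  toℚ-* {m} {n} ≡.refl ≡.refl = ℚₚ.toℚᵘ-injective (begin-equality
    ℚ.toℚᵘ (toℚ (m ℕ.* n)) ≃⟨ toℚᵘ-toℚ (m ℕ.* n) ⟩
    ℚᵘ.mkℚᵘ (+ (m ℕ.* n)) 0 ≃⟨ ℚᵘ.*≡* (≡.cong (ℤ._* ℤ.1ℤ) (ℤₚ.pos-* m n)) ⟩
    ℚᵘ.mkℚᵘ (+ m) 0 ℚᵘ.* ℚᵘ.mkℚᵘ (+ n) 0 ≃⟨ ℚᵘₚ.*-cong (ℚᵘₚ.≃-sym (toℚᵘ-toℚ m)) (ℚᵘₚ.≃-sym (toℚᵘ-toℚ n)) ⟩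
    ℚ.toℚᵘ (toℚ m) ℚᵘ.* ℚ.toℚᵘ (toℚ n) ≃⟨ ℚᵘₚ.≃-sym (ℚₚ.toℚᵘ-homo-* (toℚ m) (toℚ n)) ⟩
    ℚ.toℚᵘ (toℚ m ℚ.* toℚ n) ∎)
    where open ℚᵘₚ.≤-Reasoning

  toℚ-^ : ∀ m k → toℚ (m ℕ.^ k) ≡ toℚ m ^ℚ k
  toℚ-^ m zero = ≡.refl
  toℚ-^ m (suc k) = toℚ-* {m} {m ℕ.^ k} ≡.refl (toℚ-^ m k)

  toℚ-mono : ∀ {m n} → m ℕ.≤ n → toℚ m ℚ.≤ toℚ n
  toℚ-mono {m} {n} h = ℚₚ.toℚᵘ-cancel-≤ (begin
    ℚ.toℚᵘ (toℚ m) ≃⟨ toℚᵘ-toℚ m ⟩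
    ℚᵘ.mkℚᵘ (+ m) 0 ≤⟨ ℚᵘ.*≤* (ℤₚ.*-monoʳ-≤-nonNeg ℤ.1ℤ (ℤ.+≤+ h)) ⟩
    ℚᵘ.mkℚᵘ (+ n) 0 ≃⟨ ℚᵘₚ.≃-sym (toℚᵘ-toℚ n) ⟩
    ℚ.toℚᵘ (toℚ n) ∎)
    where open ℚᵘₚ.≤-Reasoning

  reciprocal : (n : ℕ) .{{_ : ℕ.NonZero n}} → ℚ
  reciprocal n = + 1 ℚ./ n

  reciprocal-nonNeg : ∀ n .{{_ : ℕ.NonZero n}} → ℚ.NonNegative (reciprocal n)
  reciprocal-nonNeg n = ℚₚ.normalize-nonNeg 1 n

  reciprocal-inverse : ∀ n .{{_ : ℕ.NonZero n}} → toℚ n ℚ.* reciprocal n ≡ ℚ.1ℚ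
  reciprocal-inverse (suc n) = ℚₚ.toℚᵘ-injective (begin-equality
    ℚ.toℚᵘ (toℚ (suc n) ℚ.* reciprocal (suc n)) ≃⟨ ℚₚ.toℚᵘ-homo-* (toℚ (suc n)) (reciprocal (suc n)) ⟩
    ℚ.toℚᵘ (toℚ (suc n)) ℚᵘ.* ℚ.toℚᵘ (reciprocal (suc n)) ≃⟨ ℚᵘₚ.*-cong (toℚᵘ-toℚ (suc n)) (ℚₚ.toℚᵘ-fromℚᵘ (ℚᵘ.mkℚᵘ (+ 1) n)) ⟩
    ℚᵘ.mkℚᵘ (+ suc n) 0 ℚᵘ.* ℚᵘ.mkℚᵘ (+ 1) n ≃⟨ ℚᵘ.*≡* (≡.cong (λ z → + suc z) (id n)) ⟩
    ℚᵘ.1ℚᵘ ∎)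
    where
    open ℚᵘₚ.≤-Reasoning
    id : ∀ n → n ℕ.* 1 ℕ.* 1 ≡ n ℕ.+ 0 ℕ.* (1 ℕ.+ n) ℕ.+ 0 ℕ.* (1 ℕ.+ (n ℕ.+ 0 ℕ.* (1 ℕ.+ n)))
    id = solve-∀

  private
    _⊗₁_ : ℚ × ℕ × ℕ → ℚ × ℕ × ℕ → ℚ × ℕ × ℕ
    (q , i , j) ⊗₁ (q' , i' , j') = q ℚ.* q' , i ℕ.+ i' , j ℕ.+ j'

  infixr 7 _⊗_
  infixr 6 _⊞_
  _⊞_ _⊗_ : Poly2 → Poly2 → Poly2
  P ⊞ Q = P List.++ Q
  [] ⊗ Q = []
  (x ∷ P) ⊗ Q = List.map (x ⊗₁_) Q ⊞ P ⊗ Q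

  ^ℚ-+ : ∀ x i j → x ^ℚ (i ℕ.+ j) ≡ (x ^ℚ i) ℚ.* (x ^ℚ j)
  ^ℚ-+ x zero j = ≡.sym (ℚₚ.*-identityˡ _)
  ^ℚ-+ x (suc i) j = ≡.trans (≡.cong (x ℚ.*_) (^ℚ-+ x i j)) (≡.sym (ℚₚ.*-assoc x (x ^ℚ i) (x ^ℚ j)))

  module _ (a b : ℚ) where
    open +-*-Solver

    eval-⊞ : ∀ P Q → eval (P ⊞ Q) a b ≡ eval P a b ℚ.+ eval Q a b
    eval-⊞ [] Q = ≡.sym (ℚₚ.+-identityˡ _)
    eval-⊞ (x ∷ P) Q = ≡.trans (≡.cong (evalMono x a b ℚ.+_) (eval-⊞ P Q)) (≡.sym (ℚₚ.+-assoc (evalMono x a b) (eval P a b) (eval Q a b)))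

    eval-⊗₁ : ∀ x Q → eval (List.map (x ⊗₁_) Q) a b ≡ evalMono x a b ℚ.* eval Q a b
    eval-⊗₁ x [] = ≡.sym (ℚₚ.*-zeroʳ (evalMono x a b))
    eval-⊗₁ x@(q , i , j) ((q' , i' , j') ∷ Q) rewrite eval-⊗₁ x Q | ^ℚ-+ a i i' | ^ℚ-+ b j j' =
      solve 7 (λ q q' u u' v v' z → (q :* q') :* (u :* u') :* (v :* v') :+ (q :* u :* v) :* z := (q :* u :* v) :* (q' :* u' :* v' :+ z)) ≡.refl
        q q' (a ^ℚ i) (a ^ℚ i') (b ^ℚ j) (b ^ℚ j') (eval Q a b)

    eval-⊗ : ∀ P Q → eval (P ⊗ Q) a b ≡ eval P a b ℚ.* eval Q a b
    eval-⊗ [] Q = ≡.sym (ℚₚ.*-zeroˡ (eval Q a b))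
    eval-⊗ (x ∷ P) Q = ≡.trans (eval-⊞ (List.map (x ⊗₁_) Q) (P ⊗ Q))
      (≡.trans (≡.cong₂ ℚ._+_ (eval-⊗₁ x Q) (eval-⊗ P Q)) (≡.sym (ℚₚ.*-distribʳ-+ (eval Q a b) (evalMono x a b) (eval P a b))))

  degree-mono : ∀ {D D'} P → D ℕ.≤ D' → DegreeBelow D P → DegreeBelow D' P
  degree-mono [] h [] = []
  degree-mono (x ∷ P) h (p ∷ ps) = ℕₚ.<-≤-trans p h ∷ degree-mono P h ps

  degree-⊗₁ : ∀ {D D' q i j} Q → i ℕ.+ j ℕ.< suc D → DegreeBelow D' Q → DegreeBelow (D ℕ.+ D') (List.map ((q , i , j) ⊗₁_) Q)
  degree-⊗₁ [] h [] = []
  degree-⊗₁ {D} {D'} {q} {i} {j} ((q' , i' , j') ∷ Q) h (p ∷ ps) =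
    ℕₚ.≤-trans (ℕₚ.≤-reflexive (id i j i' j')) (ℕₚ.+-mono-≤ (ℕₚ.≤-pred h) p) ∷ degree-⊗₁ {q = q} Q h ps
    where
    id : ∀ i j i' j' → 1 ℕ.+ ((i ℕ.+ i') ℕ.+ (j ℕ.+ j')) ≡ (i ℕ.+ j) ℕ.+ (1 ℕ.+ (i' ℕ.+ j'))
    id = solve-∀

  -- Both bounds are strict, so writing one of them as `suc D` gives the sharp bound for the
  -- product. It also covers D' = 0, where Q is empty, as for the zeroth `excess`.
  degree-⊗ : ∀ {D D'} P Q → DegreeBelow (suc D) P → DegreeBelow D' Q → DegreeBelow (D ℕ.+ D') (P ⊗ Q)
  degree-⊗ [] Q [] hQ = []
  degree-⊗ ((q , i , j) ∷ P) Q (h ∷ hP) hQ = Allₚ.++⁺ (degree-⊗₁ {q = q} {i} {j} Q h hQ) (degree-⊗ P Q hP hQ)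

  constant : ℚ → Poly2
  constant q = (q , 0 , 0) ∷ []

  main : Poly2
  main = (toℚ 1 , 3 , 0) ∷ (toℚ 9 , 2 , 1) ∷ (toℚ 27 , 1 , 2) ∷ (toℚ 18 , 0 , 3) ∷ []

  -- 3K (a + 2b)²
  lower : ℕ → Poly2
  lower K = (toℚ 3 ℚ.* toℚ K , 2 , 0) ∷ (toℚ 12 ℚ.* toℚ K , 1 , 1) ∷ (toℚ 12 ℚ.* toℚ K , 0 , 2) ∷ []

  power : Poly2 → ℕ → Poly2
  power P zero = constant ℚ.1ℚ
  power P (suc k) = P ⊗ power P k

  -- (P + E)ᵏ - Pᵏ
  excess : Poly2 → Poly2 → ℕ → Poly2
  excess P E zero = []
  excess P E (suc k) = P ⊗ excess P E k ⊞ E ⊗ power P k ⊞ E ⊗ excess P E k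

  eval-constant : ∀ q a b → eval (constant q) a b ≡ q
  eval-constant q a b = ≡.trans (ℚₚ.+-identityʳ _) (≡.trans (ℚₚ.*-identityʳ _) (ℚₚ.*-identityʳ q))

  eval-power : ∀ P a b k → eval (power P k) a b ≡ eval P a b ^ℚ k
  eval-power P a b zero = eval-constant ℚ.1ℚ a b
  eval-power P a b (suc k) = ≡.trans (eval-⊗ a b P (power P k)) (≡.cong (eval P a b ℚ.*_) (eval-power P a b k))

  eval-excess : ∀ P E a b k → (eval P a b ℚ.+ eval E a b) ^ℚ k ≡ eval P a b ^ℚ k ℚ.+ eval (excess P E k) a b
  eval-excess P E a b zero = ≡.sym (ℚₚ.+-identityʳ _)
  eval-excess P E a b (suc k) = begin
    (p ℚ.+ e) ℚ.* (p ℚ.+ e) ^ℚ k ≡⟨ ≡.cong ((p ℚ.+ e) ℚ.*_) (eval-excess P E a b k) ⟩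
    (p ℚ.+ e) ℚ.* (p ^ℚ k ℚ.+ x)
      ≡⟨ solve 4 (λ p e pk x → (p :+ e) :* (pk :+ x) := p :* pk :+ (p :* x :+ (e :* pk :+ e :* x))) ≡.refl p e (p ^ℚ k) x ⟩
    p ℚ.* p ^ℚ k ℚ.+ (p ℚ.* x ℚ.+ (e ℚ.* p ^ℚ k ℚ.+ e ℚ.* x)) ≡⟨ ≡.cong (p ℚ.* p ^ℚ k ℚ.+_) (≡.sym expand) ⟩
    p ^ℚ suc k ℚ.+ eval (excess P E (suc k)) a b ∎
    where
    open ≡.≡-Reasoning
    open +-*-Solver
    p = eval P a b
    e = eval E a b
    x = eval (excess P E k) a b
    expand : eval (excess P E (suc k)) a b ≡ p ℚ.* x ℚ.+ (e ℚ.* p ^ℚ k ℚ.+ e ℚ.* x)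
    expand = ≡.trans (eval-⊞ a b (P ⊗ excess P E k) (E ⊗ power P k ⊞ E ⊗ excess P E k))
      (≡.cong₂ ℚ._+_ (eval-⊗ a b P (excess P E k))
        (≡.trans (eval-⊞ a b (E ⊗ power P k) (E ⊗ excess P E k))
          (≡.cong₂ ℚ._+_ (≡.trans (eval-⊗ a b E (power P k)) (≡.cong (e ℚ.*_) (eval-power P a b k)))
                         (eval-⊗ a b E (excess P E k)))))

  degree-power : ∀ k → DegreeBelow (suc (3 ℕ.* k)) (power main k)
  degree-power zero = s≤s z≤n ∷ []
  degree-power (suc k) = degree-mono (main ⊗ power main k) (ℕₚ.≤-reflexive (id k))
    (degree-⊗ {3} main (power main k) main-degree (degree-power k))
    where
    id : ∀ k → 3 ℕ.+ (1 ℕ.+ 3 ℕ.* k) ≡ 1 ℕ.+ 3 ℕ.* (1 ℕ.+ k)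
    id = solve-∀
    main-degree : DegreeBelow 4 main
    main-degree = ℕₚ.≤-refl ∷ ℕₚ.≤-refl ∷ ℕₚ.≤-refl ∷ ℕₚ.≤-refl ∷ []

  -- Every term of the expansion outside the pure power of `main` contains a quadratic factor in
  -- place of a cubic one, so at least one degree is lost.
  degree-excess : ∀ K k → DegreeBelow (3 ℕ.* k) (excess main (lower K) k)
  degree-excess K zero = []
  degree-excess K (suc k) = Allₚ.++⁺
    (degree-mono (main ⊗ x) (ℕₚ.≤-reflexive (id₁ k)) (degree-⊗ {3} main x main-degree (degree-excess K k)))
    (Allₚ.++⁺ (degree-mono (lower K ⊗ power main k) (ℕₚ.≤-reflexive (id₂ k)) (degree-⊗ {2} (lower K) (power main k) lower-degree (degree-power k)))
              (degree-mono (lower K ⊗ x) (≤-by {d = 1} (id₃ k)) (degree-⊗ {2} (lower K) x lower-degree (degree-excess K k))))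
    where
    x = excess main (lower K) k
    id₁ : ∀ k → 3 ℕ.+ 3 ℕ.* k ≡ 3 ℕ.* (1 ℕ.+ k)
    id₁ = solve-∀
    id₂ : ∀ k → 2 ℕ.+ (1 ℕ.+ 3 ℕ.* k) ≡ 3 ℕ.* (1 ℕ.+ k)
    id₂ = solve-∀
    id₃ : ∀ k → 2 ℕ.+ 3 ℕ.* k ℕ.+ 1 ≡ 3 ℕ.* (1 ℕ.+ k)
    id₃ = solve-∀
    main-degree : DegreeBelow 4 main
    main-degree = ℕₚ.≤-refl ∷ ℕₚ.≤-refl ∷ ℕₚ.≤-refl ∷ ℕₚ.≤-refl ∷ []
    lower-degree : DegreeBelow 3 (lower K)
    lower-degree = ℕₚ.≤-refl ∷ ℕₚ.≤-refl ∷ ℕₚ.≤-refl ∷ []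

  eval-main : ∀ a b → eval main a b ≡ ((a ℚ.+ toℚ 3 ℚ.* b) ^ℚ 3) ℚ.- (toℚ 9 ℚ.* (b ^ℚ 3))
  eval-main a b = solve 2 (λ a b →
      con (toℚ 1) :* (a :* (a :* (a :* con ℚ.1ℚ))) :* con ℚ.1ℚ
        :+ (con (toℚ 9) :* (a :* (a :* con ℚ.1ℚ)) :* (b :* con ℚ.1ℚ)
        :+ (con (toℚ 27) :* (a :* con ℚ.1ℚ) :* (b :* (b :* con ℚ.1ℚ))
        :+ (con (toℚ 18) :* con ℚ.1ℚ :* (b :* (b :* (b :* con ℚ.1ℚ))) :+ con ℚ.0ℚ)))
      := ((a :+ con (toℚ 3) :* b) :* ((a :+ con (toℚ 3) :* b) :* ((a :+ con (toℚ 3) :* b) :* con ℚ.1ℚ)))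
         :- con (toℚ 9) :* (b :* (b :* (b :* con ℚ.1ℚ)))) ≡.refl a b
    where open +-*-Solver

  eval-growth : ∀ K a b → toℚ (growth K a b) ≡ eval main (toℚ a) (toℚ b) ℚ.+ eval (lower K) (toℚ a) (toℚ b)
  eval-growth K a b = ≡.trans
    (_+h_ {a ℕ.* a ℕ.* a ℕ.+ 9 ℕ.* (a ℕ.* a ℕ.* b) ℕ.+ 27 ℕ.* (a ℕ.* b ℕ.* b) ℕ.+ 18 ℕ.* (b ℕ.* b ℕ.* b)}
      (_+h_ {a ℕ.* a ℕ.* a ℕ.+ 9 ℕ.* (a ℕ.* a ℕ.* b) ℕ.+ 27 ℕ.* (a ℕ.* b ℕ.* b)}
        (_+h_ {a ℕ.* a ℕ.* a ℕ.+ 9 ℕ.* (a ℕ.* a ℕ.* b)}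
          (_+h_ {a ℕ.* a ℕ.* a} (cubic a a a) (scaled 9 a a b)) (scaled 27 a b b)) (scaled 18 b b b))
      (toℚ-* {3 ℕ.* K} (toℚ-* {3} {K} ≡.refl ≡.refl) (toℚ-* {a ℕ.+ 2 ℕ.* b} linear linear)))
    (solve 3 (λ a b K →
        a :* a :* a :+ con (toℚ 9) :* (a :* a :* b) :+ con (toℚ 27) :* (a :* b :* b) :+ con (toℚ 18) :* (b :* b :* b)
          :+ con (toℚ 3) :* K :* ((a :+ con (toℚ 2) :* b) :* (a :+ con (toℚ 2) :* b))
        := (con (toℚ 1) :* (a :* (a :* (a :* con ℚ.1ℚ))) :* con ℚ.1ℚ
            :+ (con (toℚ 9) :* (a :* (a :* con ℚ.1ℚ)) :* (b :* con ℚ.1ℚ)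
            :+ (con (toℚ 27) :* (a :* con ℚ.1ℚ) :* (b :* (b :* con ℚ.1ℚ))
            :+ (con (toℚ 18) :* con ℚ.1ℚ :* (b :* (b :* (b :* con ℚ.1ℚ))) :+ con ℚ.0ℚ))))
          :+ (con (toℚ 3) :* K :* (a :* (a :* con ℚ.1ℚ)) :* con ℚ.1ℚ
            :+ (con (toℚ 12) :* K :* (a :* con ℚ.1ℚ) :* (b :* con ℚ.1ℚ)
            :+ (con (toℚ 12) :* K :* con ℚ.1ℚ :* (b :* (b :* con ℚ.1ℚ)) :+ con ℚ.0ℚ)))) ≡.refl (toℚ a) (toℚ b) (toℚ K))
    where
    open +-*-Solver
    _+h_ : ∀ {m n x y} → toℚ m ≡ x → toℚ n ≡ y → toℚ (m ℕ.+ n) ≡ x ℚ.+ y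
    _+h_ {m} {n} = toℚ-+ {m} {n}
    cubic : ∀ x y z → toℚ (x ℕ.* y ℕ.* z) ≡ toℚ x ℚ.* toℚ y ℚ.* toℚ z
    cubic x y z = toℚ-* {x ℕ.* y} {z} (toℚ-* {x} {y} ≡.refl ≡.refl) ≡.refl
    scaled : ∀ n x y z → toℚ (n ℕ.* (x ℕ.* y ℕ.* z)) ≡ toℚ n ℚ.* (toℚ x ℚ.* toℚ y ℚ.* toℚ z)
    scaled n x y z = toℚ-* {n} ≡.refl (cubic x y z)
    linear : toℚ (a ℕ.+ 2 ℕ.* b) ≡ toℚ a ℚ.+ toℚ 2 ℚ.* toℚ b
    linear = toℚ-+ {a} {2 ℕ.* b} ≡.refl (toℚ-* {2} {b} ≡.refl ≡.refl)

  errorTerm : ℕ → ℕ → Poly2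
  errorTerm k K = constant (reciprocal (denom k) {{denom≢0 k}}) ⊗ excess main (lower K) k

  degree-errorTerm : ∀ k K → DegreeBelow (3 ℕ.* k) (errorTerm k K)
  degree-errorTerm k K = degree-⊗ {0} (constant (reciprocal (denom k) {{denom≢0 k}})) (excess main (lower K) k) (s≤s z≤n ∷ []) (degree-excess K k)

  bound-fPoly : ∀ k K a b β → β ℕ.* denom k ℕ.≤ growth K a b ℕ.^ k → toℚ β ℚ.≤ fPoly k (errorTerm k K) (toℚ a) (toℚ b)
  bound-fPoly k K a b β h = begin
    toℚ β ≡⟨ ≡.sym (ℚₚ.*-identityʳ (toℚ β)) ⟩
    toℚ β ℚ.* ℚ.1ℚ ≡⟨ ≡.cong (toℚ β ℚ.*_) (≡.sym (reciprocal-inverse c)) ⟩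
    toℚ β ℚ.* (toℚ c ℚ.* r) ≡⟨ ≡.sym (ℚₚ.*-assoc (toℚ β) (toℚ c) r) ⟩
    (toℚ β ℚ.* toℚ c) ℚ.* r ≡⟨ ≡.cong (ℚ._* r) (≡.sym (toℚ-* {β} {c} ≡.refl ≡.refl)) ⟩
    toℚ (β ℕ.* c) ℚ.* r ≤⟨ ℚₚ.*-monoʳ-≤-nonNeg r {{reciprocal-nonNeg c}} (toℚ-mono h) ⟩
    toℚ (growth K a b ℕ.^ k) ℚ.* r ≡⟨ ≡.cong (ℚ._* r) (≡.trans (toℚ-^ (growth K a b) k) (≡.cong (_^ℚ k) (eval-growth K a b))) ⟩
    (eval main A B ℚ.+ eval (lower K) A B) ^ℚ k ℚ.* r ≡⟨ ≡.cong (ℚ._* r) (eval-excess main (lower K) A B k) ⟩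
    (eval main A B ^ℚ k ℚ.+ x) ℚ.* r ≡⟨ solve 3 (λ p x r → (p :+ x) :* r := r :* p :+ r :* x) ≡.refl (eval main A B ^ℚ k) x r ⟩
    r ℚ.* (eval main A B ^ℚ k) ℚ.+ r ℚ.* x
      ≡⟨ ≡.cong₂ ℚ._+_ (≡.cong (λ p → r ℚ.* (p ^ℚ k)) (eval-main A B))
           (≡.sym (≡.trans (eval-⊗ A B (constant r) (excess main (lower K) k)) (≡.cong (ℚ._* x) (eval-constant r A B)))) ⟩
    fPoly k (errorTerm k K) A B ∎
    where
    open ℚₚ.≤-Reasoning
    open +-*-Solver using (solve; _:=_; _:+_; _:*_)
    A = toℚ a
    B = toℚ b
    c = denom k
    instance
      c≢0 : ℕ.NonZero c
      c≢0 = denom≢0 k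
    r = reciprocal c
    x = eval (excess main (lower K) k) A B

-- Ring identities and finite sums over the field

module Homology {c ℓ} (F : Field c ℓ) where

  open Growth using (≤-by; growth; combine; growth-a₁; growth-a₂; growth-a₃; growth-b₁; growth-b₂; growth-b₃)
  open Field F public hiding (zero; _-_)
  open LinAlg F public using (∑; Independent; IsReducedBetti; sign)
  private
    module Rₚ = RingProperties ring
    module Multₚ = Mult semiring
  module ≈-R = SetoidReasoning setoid

  -- A coefficient (a , b) of the solver stands for a - b.
  private
    coeff : RawRing _ _
    coeff = record
      { Carrier = ℕ × ℕ ; _≈_ = _≡_
      ; _+_ = λ { (a , b) (c , d) → a ℕ.+ c , b ℕ.+ d }
      ; _*_ = λ { (a , b) (c , d) → a ℕ.* c ℕ.+ b ℕ.* d , a ℕ.* d ℕ.+ b ℕ.* c }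
      ; -_ = λ { (a , b) → b , a } ; 0# = 0 , 0 ; 1# = 1 , 0 }

    nat : ℕ → Carrier
    nat n = Multₚ._×_ n 1#

    ⟦_⟧ : ℕ × ℕ → Carrier
    ⟦ a , b ⟧ = nat a + - nat b

    nat-+ : ∀ m n → nat (m ℕ.+ n) ≈ nat m + nat n
    nat-+ m n = Multₚ.×-homo-+ 1# m n
    nat-* : ∀ m n → nat (m ℕ.* n) ≈ nat m * nat n
    nat-* m n = Multₚ.×1-homo-* m n

    neg-+ : ∀ x y → - (x + y) ≈ - x + - y
    neg-+ x y = sym (Rₚ.-‿+-comm x y)

    swap-mid : ∀ a b c d → (a + b) + (c + d) ≈ (a + c) + (b + d)
    swap-mid a b c d = begin
      (a + b) + (c + d) ≈⟨ +-assoc a b (c + d) ⟩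
      a + (b + (c + d)) ≈⟨ +-congˡ (sym (+-assoc b c d)) ⟩
      a + ((b + c) + d) ≈⟨ +-congˡ (+-congʳ (+-comm b c)) ⟩
      a + ((c + b) + d) ≈⟨ +-congˡ (+-assoc c b d) ⟩
      a + (c + (b + d)) ≈⟨ sym (+-assoc a c (b + d)) ⟩
      (a + c) + (b + d) ∎ where open ≈-R

    neg-neg-* : ∀ x y → - x * - y ≈ x * y
    neg-neg-* x y = trans (sym (Rₚ.-‿distribˡ-* x (- y)))
                   (trans (-‿cong (sym (Rₚ.-‿distribʳ-* x y))) (Rₚ.-‿involutive (x * y)))

    mul-diff : ∀ a b c d → (a + - b) * (c + - d) ≈ (a * c + b * d) + - (a * d + b * c)
    mul-diff a b c d = begin
      (a + - b) * (c + - d) ≈⟨ distribʳ (c + - d) a (- b) ⟩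
      a * (c + - d) + - b * (c + - d) ≈⟨ +-cong (distribˡ a c (- d)) (distribˡ (- b) c (- d)) ⟩
      (a * c + a * - d) + (- b * c + - b * - d)
        ≈⟨ +-congˡ (+-comm _ _) ⟩
      (a * c + a * - d) + (- b * - d + - b * c)
        ≈⟨ swap-mid _ _ _ _ ⟩
      (a * c + - b * - d) + (a * - d + - b * c)
        ≈⟨ +-cong (+-congˡ (neg-neg-* b d))
             (+-cong (sym (Rₚ.-‿distribʳ-* a d)) (sym (Rₚ.-‿distribˡ-* b c))) ⟩
      (a * c + b * d) + (- (a * d) + - (b * c)) ≈⟨ +-congˡ (sym (neg-+ _ _)) ⟩
      (a * c + b * d) + - (a * d + b * c) ∎ where open ≈-R

    morphism : coeff ACR.-Raw-AlmostCommutative⟶ ACR.fromCommutativeRing commutativeRing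
    morphism = record
      { ⟦_⟧ = ⟦_⟧
      ; +-homo = λ { (a , b) (c , d) → trans (+-cong (nat-+ a c) (-‿cong (nat-+ b d)))
          (trans (+-congˡ (neg-+ _ _)) (swap-mid _ _ _ _)) }
      ; *-homo = λ { (a , b) (c , d) → trans
          (+-cong (trans (nat-+ (a ℕ.* c) (b ℕ.* d)) (+-cong (nat-* a c) (nat-* b d)))
            (-‿cong (trans (nat-+ (a ℕ.* d) (b ℕ.* c)) (+-cong (nat-* a d) (nat-* b c)))))
          (sym (mul-diff _ _ _ _)) }
      ; -‿homo = λ { (a , b) → trans (+-comm _ _)
          (trans (+-congˡ (sym (Rₚ.-‿involutive _))) (sym (neg-+ _ _))) }
      ; 0-homo = -‿inverseʳ 0#
      ; 1-homo = trans (+-cong (+-identityʳ 1#) Rₚ.-0#≈0#) (+-identityʳ 1#)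
      }

    -- Equality in the field cannot be decided. Comparing a + d with c + b as naturals is a sound
    -- partial test, and it recognises every identity between integers.
    weak≟ : ∀ x y → Maybe (⟦ x ⟧ ≈ ⟦ y ⟧)
    weak≟ (a , b) (c , d) with a ℕ.+ d ℕₚ.≟ c ℕ.+ b
    ... | no _ = nothing
    ... | yes e = just (begin
      nat a + - nat b ≈⟨ sym (+-identityʳ _) ⟩
      (nat a + - nat b) + 0# ≈⟨ +-congˡ (sym (-‿inverseʳ (nat d))) ⟩
      (nat a + - nat b) + (nat d + - nat d) ≈⟨ swap-mid _ _ _ _ ⟩
      (nat a + nat d) + (- nat b + - nat d)
        ≈⟨ +-congʳ (trans (sym (nat-+ a d)) (trans (reflexive (≡.cong nat e)) (nat-+ c b))) ⟩
      (nat c + nat b) + (- nat b + - nat d) ≈⟨ +-congˡ (+-comm _ _) ⟩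
      (nat c + nat b) + (- nat d + - nat b) ≈⟨ swap-mid _ _ _ _ ⟩
      (nat c + - nat d) + (nat b + - nat b) ≈⟨ +-congˡ (-‿inverseʳ _) ⟩
      (nat c + - nat d) + 0# ≈⟨ +-identityʳ _ ⟩
      nat c + - nat d ∎) where open ≈-R

  module Solver = RingSolver coeff (ACR.fromCommutativeRing commutativeRing) morphism weak≟
  open Solver public using (solve; _:=_; _:+_; _:*_; :-_; _:-_; con)

  ∑-cong : ∀ {k} {f g : Fin k → Carrier} → (∀ i → f i ≈ g i) → ∑ f ≈ ∑ g
  ∑-cong {zero} _ = refl
  ∑-cong {suc k} e = +-cong (e zero) (∑-cong (λ i → e (suc i)))

  ∑-0 : ∀ {k} {f : Fin k → Carrier} → (∀ i → f i ≈ 0#) → ∑ f ≈ 0#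
  ∑-0 {zero} _ = refl
  ∑-0 {suc k} e = trans (+-cong (e zero) (∑-0 (λ i → e (suc i)))) (+-identityˡ 0#)

  ∑-+ : ∀ {k} (f g : Fin k → Carrier) → ∑ (λ i → f i + g i) ≈ ∑ f + ∑ g
  ∑-+ {zero} f g = sym (+-identityˡ 0#)
  ∑-+ {suc k} f g = trans (+-congˡ (∑-+ (λ i → f (suc i)) (λ i → g (suc i)))) (swap-mid _ _ _ _)

  ∑-* : ∀ {k} a (f : Fin k → Carrier) → ∑ (λ i → a * f i) ≈ a * ∑ f
  ∑-* {zero} a f = sym (zeroʳ a)
  ∑-* {suc k} a f = trans (+-congˡ (∑-* a (λ i → f (suc i)))) (sym (distribˡ a _ _))

  ∑-swap : ∀ {k l} (f : Fin k → Fin l → Carrier) →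
           ∑ (λ i → ∑ (λ j → f i j)) ≈ ∑ (λ j → ∑ (λ i → f i j))
  ∑-swap {zero} {l} f = sym (∑-0 {l} {λ _ → 0#} (λ _ → refl))
  ∑-swap {suc k} f = trans (+-congˡ (∑-swap (λ i → f (suc i))))
                           (sym (∑-+ (f zero) (λ j → ∑ (λ i → f (suc i) j))))

  ∑-single : ∀ {k} (f : Fin k → Carrier) (i : Fin k) → (∀ j → j ≢ i → f j ≈ 0#) → ∑ f ≈ f i
  ∑-single f zero e = trans (+-congˡ (∑-0 (λ j → e (suc j) (λ ())))) (+-identityʳ _)
  ∑-single f (suc i) e =
    trans (+-cong (e zero (λ ()))
                  (∑-single (λ j → f (suc j)) i (λ j ne → e (suc j) (λ eq → ne (Finₚ.suc-injective eq)))))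
          (+-identityˡ _)

  neg-0 : ∀ {x} → x ≈ 0# → - x ≈ 0#
  neg-0 e = trans (-‿cong e) Rₚ.-0#≈0#

  ∑-neg : ∀ {k} (f : Fin k → Carrier) → ∑ (λ i → - f i) ≈ - ∑ f
  ∑-neg {zero} f = sym Rₚ.-0#≈0#
  ∑-neg {suc k} f = trans (+-congˡ (∑-neg (λ i → f (suc i)))) (sym (neg-+ _ _))

  -- The diagonal needs its own hypothesis because of characteristic 2.
  ∑∑-antisym : ∀ {k} (f : Fin k → Fin k → Carrier) → (∀ i j → f i j ≈ - f j i) → (∀ i → f i i ≈ 0#) →
               ∑ (λ i → ∑ (λ j → f i j)) ≈ 0#
  ∑∑-antisym {zero} f anti diag = refl
  ∑∑-antisym {suc k} f anti diag = begin
    (f zero zero + ∑ (λ j → f zero (suc j))) + ∑ (λ i → f (suc i) zero + ∑ (λ j → f (suc i) (suc j)))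
      ≈⟨ +-cong (trans (+-congʳ (diag zero)) (+-identityˡ _))
                (∑-+ (λ i → f (suc i) zero) (λ i → ∑ (λ j → f (suc i) (suc j)))) ⟩
    ∑ (λ j → f zero (suc j)) + (∑ (λ i → f (suc i) zero) + ∑ (λ i → ∑ (λ j → f (suc i) (suc j))))
      ≈⟨ +-cong (trans (∑-cong (λ j → anti zero (suc j))) (∑-neg (λ j → f (suc j) zero)))
                (+-congˡ (∑∑-antisym (λ i j → f (suc i) (suc j)) (λ i j → anti (suc i) (suc j)) (λ i → diag (suc i)))) ⟩
    - x + (x + 0#) ≈⟨ trans (+-congˡ (+-identityʳ x)) (-‿inverseˡ x) ⟩
    0# ∎
    where
    open ≈-R
    x = ∑ (λ i → f (suc i) zero)

  -- Linear algebra up to double negation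

  infix 4 _≐_

  _≐_ : ∀ {x} {X : Set x} → (X → Carrier) → (X → Carrier) → Set (x ⊔ ℓ)
  f ≐ g = ∀ w → f w ≈ g w

  module _ {x} {X : Set x} where
    infixl 6 _⊕_ _⊖_
    infixr 7 _⊙_

    _⊕_ _⊖_ : (X → Carrier) → (X → Carrier) → X → Carrier
    (f ⊕ g) w = f w + g w
    (f ⊖ g) w = f w + - g w

    _⊙_ : Carrier → (X → Carrier) → X → Carrier
    (a ⊙ f) w = a * f w

    neg : (X → Carrier) → X → Carrier
    neg f w = - f w

    𝟘 : X → Carrier
    𝟘 _ = 0#

    ⨁ : ∀ {k} → (Fin k → X → Carrier) → X → Carrier
    ⨁ f w = ∑ (λ i → f i w)

    ≐-refl : {f : X → Carrier} → f ≐ f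
    ≐-refl _ = refl
    ≐-sym : {f g : X → Carrier} → f ≐ g → g ≐ f
    ≐-sym e w = sym (e w)
    ≐-trans : {f g h : X → Carrier} → f ≐ g → g ≐ h → f ≐ h
    ≐-trans e e' w = trans (e w) (e' w)

  record Subspace {x z} {X : Set x} (Z : (X → Carrier) → Set z) : Set (c ⊔ ℓ ⊔ x ⊔ z) where
    field
      resp : ∀ {f g} → f ≐ g → Z f → Z g
      null : Z 𝟘
      add  : ∀ {f g} → Z f → Z g → Z (f ⊕ g)
      scl  : ∀ a {f} → Z f → Z (a ⊙ f)

    negate : ∀ {f} → Z f → Z (neg f)
    negate {f} zf = resp (λ w → Rₚ.-1*x≈-x (f w)) (scl (- 1#) zf)

    sub : ∀ {f g} → Z f → Z g → Z (f ⊖ g)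
    sub zf zg = add zf (negate zg)

    sum : ∀ {k} (f : Fin k → X → Carrier) → (∀ i → Z (f i)) → Z (⨁ f)
    sum {zero} f zf = null
    sum {suc k} f zf = add (zf zero) (sum (λ i → f (suc i)) (λ i → zf (suc i)))

  record Linear {x y} {X : Set x} {Y : Set y} (φ : (X → Carrier) → Y → Carrier) : Set (c ⊔ ℓ ⊔ x ⊔ y) where
    field
      cong : ∀ {f g} → f ≐ g → φ f ≐ φ g
      hom+ : ∀ f g → φ (f ⊕ g) ≐ φ f ⊕ φ g
      hom* : ∀ a f → φ (a ⊙ f) ≐ a ⊙ φ f

    hom0 : φ 𝟘 ≐ 𝟘
    hom0 w = trans (cong {𝟘} {0# ⊙ 𝟘} (λ _ → sym (zeroˡ 0#)) w) (trans (hom* 0# 𝟘 w) (zeroˡ _))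

    to0 : ∀ {f} → f ≐ 𝟘 → φ f ≐ 𝟘
    to0 e = ≐-trans (cong e) hom0

    hom-neg : ∀ f → φ (neg f) ≐ neg (φ f)
    hom-neg f w = trans (cong (λ w → sym (Rₚ.-1*x≈-x (f w))) w)
                        (trans (hom* (- 1#) f w) (Rₚ.-1*x≈-x (φ f w)))

    hom- : ∀ f g → φ (f ⊖ g) ≐ φ f ⊖ φ g
    hom- f g w = trans (hom+ f (neg g) w) (+-congˡ (hom-neg g w))

    homΣ : ∀ {k} (f : Fin k → X → Carrier) → φ (⨁ f) ≐ ⨁ (λ i → φ (f i))
    homΣ {zero} f = hom0
    homΣ {suc k} f w = trans (hom+ (f zero) (⨁ (λ i → f (suc i))) w) (+-congˡ (homΣ (λ i → f (suc i)) w))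

  open Linear public

  infixr 1 _>>=_
  _>>=_ : ∀ {a b} {A : Set a} {B : Set b} → ¬ ¬ A → (A → ¬ ¬ B) → ¬ ¬ B
  (m >>= f) k = m (λ a → f a k)

  η : ∀ {a} {A : Set a} → A → ¬ ¬ A
  η a k = k a

  lem : ∀ {a} (A : Set a) → ¬ ¬ (A ⊎ ¬ A)
  lem A k = k (inj₂ (λ a → k (inj₁ a)))

  -- z lies in the span of L modulo P.
  In : ∀ {x p} {X : Set x} → ((X → Carrier) → Set p) → List (X → Carrier) → (X → Carrier) → Set (c ⊔ p)
  In {p = p} P [] z = Level.Lift c (P z)
  In P (l ∷ L) z = ∃[ a ] In P L (z ⊖ a ⊙ l)

  module _ {x p} {X : Set x} {P : (X → Carrier) → Set p} (subP : Subspace P) where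
    private module S = Subspace subP

    In-resp : ∀ L {f g} → f ≐ g → In P L f → In P L g
    In-resp [] e (Level.lift h) = Level.lift (S.resp e h)
    In-resp (l ∷ L) e (a , h) = a , In-resp L (λ w → +-congʳ (e w)) h

    In-null : ∀ L → In P L 𝟘
    In-null [] = Level.lift S.null
    In-null (l ∷ L) = 0# , In-resp L (λ w → sym (trans (+-congˡ (neg-0 (zeroˡ _))) (+-identityʳ _))) (In-null L)

    In-add : ∀ L {f g} → In P L f → In P L g → In P L (f ⊕ g)
    In-add [] (Level.lift h) (Level.lift k) = Level.lift (S.add h k)
    In-add (l ∷ L) {f} {g} (a , h) (b , k) = a + b ,
      In-resp L (λ w → solve 5 (λ f g a b l → (f :- a :* l) :+ (g :- b :* l) := (f :+ g) :- (a :+ b) :* l)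
                         refl (f w) (g w) a b (l w))
        (In-add L h k)

    In-scl : ∀ L b {f} → In P L f → In P L (b ⊙ f)
    In-scl [] b (Level.lift h) = Level.lift (S.scl b h)
    In-scl (l ∷ L) b {f} (a , h) = b * a ,
      In-resp L (λ w → solve 4 (λ f a b l → b :* (f :- a :* l) := b :* f :- (b :* a) :* l) refl (f w) a b (l w))
        (In-scl L b h)

    In-sub : ∀ L → Subspace (In P L)
    In-sub L = record { resp = In-resp L ; null = In-null L ; add = In-add L ; scl = In-scl L }

    In-weaken : ∀ L {f} → P f → In P L f
    In-weaken [] h = Level.lift h
    In-weaken (l ∷ L) {f} h = 0# , In-weaken L
      (S.resp (λ w → sym (trans (+-congˡ (neg-0 (zeroˡ _))) (+-identityʳ _))) h)

  In-mono : ∀ {x p q} {X : Set x} {P : (X → Carrier) → Set p} {Q : (X → Carrier) → Set q} →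
            (∀ {f} → P f → Q f) → ∀ L {f} → In P L f → In Q L f
  In-mono P⊆Q [] (Level.lift h) = Level.lift (P⊆Q h)
  In-mono P⊆Q (l ∷ L) (a , h) = a , In-mono P⊆Q L h

  In-map : ∀ {x y p q} {X : Set x} {Y : Set y} {φ : (X → Carrier) → Y → Carrier} → Linear φ →
           {P : (X → Carrier) → Set p} {Q : (Y → Carrier) → Set q} → Subspace Q →
           (∀ {f} → P f → Q (φ f)) → ∀ L {f} → In P L f → In Q (List.map φ L) (φ f)
  In-map lin sQ PQ [] (Level.lift h) = Level.lift (PQ h)
  In-map {φ = φ} lin sQ PQ (l ∷ L) {f} (a , h) = a ,
    In-resp sQ (List.map φ L)
      (λ w → trans (hom- lin f (a ⊙ l) w) (+-congˡ (-‿cong (hom* lin a l w))))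
      (In-map lin sQ PQ L h)

  -- "dim Z / (Z ∩ P) ≤ N", up to double negation.
  Spanned : ∀ {x z p} {X : Set x} → ℕ → ((X → Carrier) → Set z) → ((X → Carrier) → Set p) → Set (c ⊔ x ⊔ z ⊔ p)
  Spanned N Z P = ¬ ¬ (∃[ L ] (length L ≡ N × (∀ f → Z f → ¬ ¬ In P L f)))

  Spanned-⊆ : ∀ {x z v p} {X : Set x} {Z : (X → Carrier) → Set z} {V : (X → Carrier) → Set v}
              {P : (X → Carrier) → Set p} {N} → (∀ {f} → Z f → V f) → Spanned N V P → Spanned N Z P
  Spanned-⊆ Z⊆V hV = hV >>= λ (L , eq , h) → η (L , eq , λ f zf → h f (Z⊆V zf))

  -- Induction on a spanning list l ∷ LW of the image: either some f₀ in Z has a nonzero coefficient at l, and then f₀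
  -- together with the elements of Z mapped into the span of LW spans Z, or l is superfluous.
  module _ {x y b p : Level} {X : Set x} {Y : Set y} {φ : (X → Carrier) → Y → Carrier} (lin : Linear φ)
           {B : (Y → Carrier) → Set b} (sB : Subspace B)
           {P : (X → Carrier) → Set p} (sP : Subspace P) where

    private
      extend′ : ∀ {z M} (Z : (X → Carrier) → Set z) → Subspace Z → (LW : List (Y → Carrier)) →
               (∀ f → Z f → ¬ ¬ In B LW (φ f)) →
               Spanned M (λ f → Z f × ¬ ¬ B (φ f)) P →
               Spanned (length LW ℕ.+ M) Z P
      extend′ Z sZ [] hW hM = Spanned-⊆ (λ {f} h → h , (hW f h >>= λ { (Level.lift b) → η b })) hM
      extend′ {M = M} Z sZ (l ∷ LW) hW hM =
          lem (∃[ f ] ∃[ a ] (Z f × ¬ (a ≈ 0#) × In B LW (φ f ⊖ a ⊙ l)))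
        >>= λ { (inj₂ none) →
                 extend′ Z sZ LW (λ f zf → hW f zf >>= λ { (a , h) → lem (a ≈ 0#) >>= λ
                   { (inj₁ a0) → η (In-resp sB LW (λ w → trans (+-congˡ (neg-0 (trans (*-congʳ a0) (zeroˡ _)))) (+-identityʳ _)) h)
                   ; (inj₂ an) → ⊥-elim (none (f , a , zf , an , h)) } })
                   hM
                 >>= λ { (L , eq , h) → η (𝟘 ∷ L , ≡.cong suc eq , λ f zf → h f zf >>= λ k → η
                   (0# , In-resp sP L (λ w → sym (trans (+-congˡ (neg-0 (zeroˡ _))) (+-identityʳ _))) k)) }
              ; (inj₁ (f₀ , a₀ , zf₀ , an , h₀)) → let (i₀ , inv) = inverse a₀ an in
                 extend′ Z' sZ' LW (λ f → proj₂)
                   (Spanned-⊆ (λ ((h , _) , hB) → h , hB) hM)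
                 >>= λ { (L , eq , h) → η (f₀ ∷ L , ≡.cong suc eq , λ f zf →
                   hW f zf >>= λ { (a , k) →
                   -- Subtracting (a / a₀) f₀ cancels the coefficient at l and brings the image into
                   -- the span of `LW`.
                   h (f ⊖ (a * i₀) ⊙ f₀)
                     ( Subspace.sub sZ zf (Subspace.scl sZ _ zf₀)
                     , η (In-resp sB LW (λ w → reduce f f₀ a a₀ i₀ inv w)
                            (In-add sB LW k (In-scl sB LW (- (a * i₀)) h₀))))
                   >>= λ k' → η (a * i₀ , k') }) } }
        where
        Z' : (X → Carrier) → Set _
        Z' f = Z f × ¬ ¬ In B LW (φ f)
        sZ' : Subspace Z'
        sZ' = record
          { resp = λ e (h , k) → Subspace.resp sZ e h , (k >>= λ k → η (In-resp sB LW (cong lin e) k))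
          ; null = Subspace.null sZ , η (In-resp sB LW (≐-sym (hom0 lin)) (In-null sB LW))
          ; add = λ {f} {g} (h , k) (h' , k') → Subspace.add sZ h h' , (k >>= λ k → k' >>= λ k' →
                    η (In-resp sB LW (≐-sym (hom+ lin f g)) (In-add sB LW k k')))
          ; scl = λ a {f} (h , k) → Subspace.scl sZ a h , (k >>= λ k →
                    η (In-resp sB LW (≐-sym (hom* lin a f)) (In-scl sB LW a k))) }
        reduce : ∀ f f₀ a a₀ i₀ → a₀ * i₀ ≈ 1# →
          (φ f ⊖ a ⊙ l) ⊕ - (a * i₀) ⊙ (φ f₀ ⊖ a₀ ⊙ l) ≐ φ (f ⊖ (a * i₀) ⊙ f₀)
        reduce f f₀ a a₀ i₀ inv w = begin
          (φ f w + - (a * l w)) + - (a * i₀) * (φ f₀ w + - (a₀ * l w))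
            ≈⟨ solve 6 (λ u a l i v b → (u :- a :* l) :+ (:- (a :* i)) :* (v :- b :* l)
                   := (u :- (a :* i) :* v) :+ (:- (a :* l) :+ (a :* l) :* (b :* i))) refl (φ f w) a (l w) i₀ (φ f₀ w) a₀ ⟩
          (φ f w + - (a * i₀ * φ f₀ w)) + (- (a * l w) + a * l w * (a₀ * i₀))
            ≈⟨ +-congˡ (+-congˡ (trans (*-congˡ inv) (*-identityʳ _))) ⟩
          (φ f w + - (a * i₀ * φ f₀ w)) + (- (a * l w) + a * l w)
            ≈⟨ trans (+-congˡ (-‿inverseˡ _)) (+-identityʳ _) ⟩
          φ f w + - (a * i₀ * φ f₀ w)
            ≈⟨ sym (trans (hom- lin f ((a * i₀) ⊙ f₀) w) (+-congˡ (-‿cong (hom* lin (a * i₀) f₀ w)))) ⟩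
          φ (f ⊖ (a * i₀) ⊙ f₀) w ∎ where open ≈-R

    -- Rank-nullity as an inequality: N generators account for the image of Z modulo B, and M for
    -- the part of Z that φ sends into B.
    extend : ∀ {z v N M} {Z : (X → Carrier) → Set z} → Subspace Z → {W : (Y → Carrier) → Set v} → (∀ {f} → Z f → W (φ f)) →
             Spanned N W B →
             Spanned M (λ f → Z f × ¬ ¬ B (φ f)) P →
             Spanned (N ℕ.+ M) Z P
    extend {Z = Z} sZ ZW hW hM = hW >>= λ { (L , ≡.refl , h) → extend′ Z sZ L (λ f zf → h (φ f) (ZW zf)) hM }

  spanned-image : ∀ {x y z v b p N} {X : Set x} {Y : Set y} {ψ : (Y → Carrier) → X → Carrier} → Linear ψ →
    {P : (X → Carrier) → Set p} → Subspace P →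
    {Z : (X → Carrier) → Set z} {V : (Y → Carrier) → Set v} {B : (Y → Carrier) → Set b} →
    (∀ {f} → B f → P (ψ f)) →
    (∀ f → Z f → ¬ ¬ (∃[ g ] (V g × P (f ⊖ ψ g)))) →
    Spanned N V B → Spanned N Z P
  spanned-image {ψ = ψ} lin {P} sP BP cover hV = hV >>= λ { (L , eq , h) →
    η (List.map ψ L , ≡.trans (Listₚ.length-map ψ L) eq , λ f zf → cover f zf >>= λ { (g , vg , pf) →
      h g vg >>= λ k → η (In-resp sP (List.map ψ L) (λ w → solve 2 (λ x y → (x :- y) :+ y := x) refl (f w) (ψ g w))
        (In-add sP (List.map ψ L) (In-weaken sP (List.map ψ L) pf) (In-map lin sP BP L k))) }) }

  -- Chains of chessboard complexes

  Sub : ℕ → Set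
  Sub M = Fin M → Bool

  infixl 6 _∖_
  opaque
    _∖_ : ∀ {M} → Sub M → Fin M → Sub M
    (R ∖ r) i = if does (i Finₚ.≟ r) then false else R i

  infix 4 _⊆_
  _⊆_ : ∀ {M} → Sub M → Sub M → Set
  R ⊆ R' = ∀ i → R i ≡ true → R' i ≡ true

  ⊆-refl : ∀ {M} {R : Sub M} → R ⊆ R
  ⊆-refl i h = h

  opaque
    unfolding _∖_

    ∖-in : ∀ {M} (R : Sub M) {r i} → (R ∖ r) i ≡ true → i ≢ r × R i ≡ true
    ∖-in R {r} {i} h with i Finₚ.≟ r
    ∖-in R () | yes _
    ... | no ne = ne , h

    in-∖ : ∀ {M} (R : Sub M) {r i} → i ≢ r → R i ≡ true → (R ∖ r) i ≡ true
    in-∖ R {r} {i} ne h with i Finₚ.≟ r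
    ... | yes e = ⊥-elim (ne e)
    ... | no _ = h

  ∖-⊆ : ∀ {M} (R : Sub M) r → R ∖ r ⊆ R
  ∖-⊆ R r i h = proj₂ (∖-in R h)

  ∖-mono : ∀ {M} {R R' : Sub M} r → R ⊆ R' → R ∖ r ⊆ R' ∖ r
  ∖-mono {R = R} {R'} r sub i h = let (ne , k) = ∖-in R h in in-∖ R' ne (sub i k)

  ∖-swap : ∀ {M} (R : Sub M) r s → R ∖ r ∖ s ⊆ R ∖ s ∖ r
  ∖-swap R r s i h = let (ne , k) = ∖-in (R ∖ r) h ; (ne' , k') = ∖-in R k in
    in-∖ (R ∖ s) ne' (in-∖ R ne k')

  card : ∀ {M} → Sub M → ℕ
  card {zero} R = 0
  card {suc M} R = (if R zero then 1 else 0) ℕ.+ card (λ i → R (suc i))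

  opaque
    unfolding _∖_

    card-∖ : ∀ {M} (R : Sub M) r → R r ≡ true → card R ≡ suc (card (R ∖ r))
    card-∖ {suc M} R zero h rewrite h = ≡.refl
    card-∖ {suc M} R (suc r) h =
      ≡.trans (≡.cong ((if R zero then 1 else 0) ℕ.+_) (card-∖ (λ i → R (suc i)) r h)) (ℕₚ.+-suc (if R zero then 1 else 0) _)

  card-∖′ : ∀ {M m} (R : Sub M) {r} → R r ≡ true → card R ≡ suc m → card (R ∖ r) ≡ m
  card-∖′ R h e = ℕₚ.suc-injective (≡.trans (≡.sym (card-∖ R _ h)) e)

  choose : ∀ {M m} (R : Sub M) → card R ≡ suc m → ∃[ r ] (R r ≡ true)
  choose {suc M} R e with R zero in eq
  ... | true = zero , eq
  ... | false = let (r , h) = choose (λ i → R (suc i)) e in suc r , h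

  card0 : ∀ {M} (R : Sub M) → card R ≡ 0 → ∀ {r} → R r ≡ true → ⊥
  card0 R e {r} h with ≡.trans (≡.sym (card-∖ R r h)) e
  ... | ()

  _≟E_ : ∀ {M N} (e e' : Edge M N) → Dec (e ≡ e')
  _≟E_ = Prodₚ.≡-dec Finₚ._≟_ Finₚ._≟_

  opaque
    δ : ∀ {M N} → Edge M N → Edge M N → Carrier
    δ e e' = if does (e ≟E e') then 1# else 0#

    δ-refl : ∀ {M N} (e : Edge M N) → δ e e ≡ 1#
    δ-refl e with e ≟E e
    ... | yes _ = ≡.refl
    ... | no ne = ⊥-elim (ne ≡.refl)

    δ-≢ : ∀ {M N} {e e' : Edge M N} → e ≢ e' → δ e e' ≡ 0#
    δ-≢ {e = e} {e'} ne with e ≟E e'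
    ... | yes eq = ⊥-elim (ne eq)
    ... | no _ = ≡.refl

  δ*-refl : ∀ {M N} (e : Edge M N) x → δ e e * x ≈ x
  δ*-refl e x = trans (*-congʳ (reflexive (δ-refl e))) (*-identityˡ x)

  δ*-≢ : ∀ {M N} {e e' : Edge M N} → e ≢ e' → ∀ x → δ e e' * x ≈ 0#
  δ*-≢ ne x = trans (*-congʳ (reflexive (δ-≢ ne))) (zeroˡ x)

  -- A chain of degree p is given by its coefficients on all words of p edges, as an alternating function.
  Ch : ℕ → ℕ → ℕ → Set c
  Ch M N p = Vec (Edge M N) p → Carrier

  -- Contraction by e: the coefficient of e, a chain on the link of that vertex.
  ι : ∀ {M N p} → Edge M N → Ch M N (suc p) → Ch M N p
  ι e f w = f (e ∷ w)

  ∂ : ∀ {M N p} → Ch M N (suc p) → Ch M N p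
  ∂ f w = ∑ λ r → ∑ λ s → f ((r , s) ∷ w)

  -- Left exterior multiplication, defined through the rule that contractions are antiderivations.
  -- It involves no ordering of the edges and no division by factorials.
  wedge : ∀ {M N p} → Edge M N → Ch M N p → Ch M N (suc p)
  wedge {p = zero} e y (e' ∷ w) = δ e e' * y w
  wedge {p = suc p} e y (e' ∷ w) = δ e e' * y w + - wedge e (ι e' y) w

  -- e ∧ ∂ y, read as 0 in degree 0.
  wedge∂ : ∀ {M N p} → Edge M N → Ch M N p → Ch M N p
  wedge∂ {p = zero} e y = 𝟘
  wedge∂ {p = suc p} e y = wedge e (∂ y)

  ι-linear : ∀ {M N p} (e : Edge M N) → Linear (ι {p = p} e)
  ι-linear e = record { cong = λ h w → h (e ∷ w) ; hom+ = λ f g w → refl ; hom* = λ a f w → refl }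

  ∂-linear : ∀ {M N p} → Linear (∂ {M} {N} {p})
  ∂-linear = record
    { cong = λ h w → ∑-cong (λ r → ∑-cong (λ s → h ((r , s) ∷ w)))
    ; hom+ = λ f g w → trans (∑-cong (λ r → ∑-+ (λ s → f ((r , s) ∷ w)) (λ s → g ((r , s) ∷ w))))
                            (∑-+ (λ r → ∑ (λ s → f ((r , s) ∷ w))) (λ r → ∑ (λ s → g ((r , s) ∷ w))))
    ; hom* = λ a f w → trans (∑-cong (λ r → ∑-* a (λ s → f ((r , s) ∷ w)))) (∑-* a (λ r → ∑ (λ s → f ((r , s) ∷ w)))) }

  wedge-linear : ∀ {M N p} (e : Edge M N) → Linear (wedge {p = p} e)
  wedge-linear {p = zero} e = record
    { cong = λ { h (e' ∷ w) → *-congˡ (h w) }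
    ; hom+ = λ { f g (e' ∷ w) → distribˡ _ _ _ }
    ; hom* = λ { a f (e' ∷ w) → solve 3 (λ d a y → d :* (a :* y) := a :* (d :* y)) refl (δ e e') a (f w) } }
  wedge-linear {p = suc p} e = record
    { cong = λ { h (e' ∷ w) → +-cong (*-congˡ (h w)) (-‿cong (cong IH (λ w → h (e' ∷ w)) w)) }
    ; hom+ = λ { f g (e' ∷ w) → trans (+-congˡ (-‿cong (hom+ IH (ι e' f) (ι e' g) w)))
        (solve 5 (λ d x y u v → d :* (x :+ y) :- (u :+ v) := (d :* x :- u) :+ (d :* y :- v)) refl
          (δ e e') (f w) (g w) (wedge e (ι e' f) w) (wedge e (ι e' g) w)) }
    ; hom* = λ { a f (e' ∷ w) → trans (+-congˡ (-‿cong (hom* IH a (ι e' f) w)))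
        (solve 4 (λ d a x u → d :* (a :* x) :- a :* u := a :* (d :* x :- u)) refl
          (δ e e') a (f w) (wedge e (ι e' f) w)) } }
    where IH = wedge-linear {p = p} e

  ∑∑-δ : ∀ {M N} (e : Edge M N) (f : Edge M N → Carrier) → ∑ (λ r → ∑ (λ s → δ e (r , s) * f (r , s))) ≈ f e
  ∑∑-δ (r₀ , s₀) f = trans
    (∑-single (λ r → ∑ (λ s → δ (r₀ , s₀) (r , s) * f (r , s))) r₀
      (λ r ne → ∑-0 (λ s → δ*-≢ {e = r₀ , s₀} {r , s} (λ eq → ne (≡.sym (≡.cong proj₁ eq))) _)))
    (trans (∑-single (λ s → δ (r₀ , s₀) (r₀ , s) * f (r₀ , s)) s₀
      (λ s ne → δ*-≢ {e = r₀ , s₀} {r₀ , s} (λ eq → ne (≡.sym (≡.cong proj₂ eq))) _)) (δ*-refl (r₀ , s₀) _))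

  -- The defining rule of `wedge` is summed over all edges: the delta terms give y exactly once, and
  -- linearity collects the remaining terms into e ∧ ∂y.
  ∂-wedge : ∀ {M N p} (e : Edge M N) (y : Ch M N p) → ∂ (wedge e y) ≐ y ⊖ wedge∂ e y
  ∂-wedge {p = zero} e y w = trans (∑∑-δ e (λ _ → y w)) (sym (trans (+-congˡ (neg-0 refl)) (+-identityʳ _)))
  ∂-wedge {M} {N} {p = suc p} e y w = begin
    ∑ (λ r → ∑ (λ s → δ e (r , s) * y w + - u r s))
      ≈⟨ ∑-cong (λ r → trans (∑-+ (λ s → δ e (r , s) * y w) (λ s → - u r s)) (+-congˡ (∑-neg (u r)))) ⟩
    ∑ (λ r → ∑ (λ s → δ e (r , s) * y w) + - ∑ (u r))
      ≈⟨ trans (∑-+ (λ r → ∑ (λ s → δ e (r , s) * y w)) (λ r → - ∑ (u r))) (+-cong (∑∑-δ e (λ _ → y w)) (∑-neg (λ r → ∑ (u r)))) ⟩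
    y w + - ∑ (λ r → ∑ (u r))
      ≈⟨ +-congˡ (-‿cong (sym (trans (homΣ (wedge-linear e) (λ r → ⨁ (λ s → ι (r , s) y)) w)
                                     (∑-cong (λ r → homΣ (wedge-linear e) (λ s → ι (r , s) y) w))))) ⟩
    y w + - wedge e (∂ y) w ∎
    where
    open ≈-R
    u : Fin M → Fin N → Carrier
    u r s = wedge e (ι (r , s) y) w

  Inside : ∀ {M N} → Sub M → Sub N → Edge M N → Set
  Inside R S (r , s) = R r ≡ true × S s ≡ true

  inside? : ∀ {M N} (R : Sub M) (S : Sub N) e → Dec (Inside R S e)
  inside? R S (r , s) = (R r Boolₚ.≟ true) ×-dec (S s Boolₚ.≟ true)

  -- Only the two leading letters are exchanged. `Good` asks the same of all iterated contractions,
  -- which yields the other adjacent transpositions.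
  Alt : ∀ {M N p} → Ch M N (suc p) → Set ℓ
  Alt {p = zero} f = ⊤
  Alt {p = suc p} f = ∀ e e' w → f (e ∷ e' ∷ w) ≈ - f (e' ∷ e ∷ w)

  -- f is alternating and supported on the matchings of the board R × S.
  data Good {M N} (R : Sub M) (S : Sub N) : ∀ {p} → Ch M N p → Set (c ⊔ ℓ) where
    g0 : {f : Ch M N 0} → Good R S f
    gs : ∀ {p} {f : Ch M N (suc p)} →
         (∀ e → ¬ Inside R S e → ι e f ≐ 𝟘) →
         (∀ e → Good (R ∖ proj₁ e) (S ∖ proj₂ e) (ι e f)) →
         Alt f → Good R S f

  good-out : ∀ {M N R S p} {f : Ch M N (suc p)} → Good R S f → ∀ e → ¬ Inside R S e → ι e f ≐ 𝟘
  good-out (gs o s a) = o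

  good-ι : ∀ {M N R S p} {f : Ch M N (suc p)} → Good R S f → ∀ e → Good (R ∖ proj₁ e) (S ∖ proj₂ e) (ι e f)
  good-ι (gs o s a) = s

  good-alt : ∀ {M N R S p} {f : Ch M N (suc p)} → Good R S f → Alt f
  good-alt (gs o s a) = a

  good-alt₂ : ∀ {M N R S p} {f : Ch M N (suc (suc p))} → Good R S f → ∀ e e' w → f (e ∷ e' ∷ w) ≈ - f (e' ∷ e ∷ w)
  good-alt₂ (gs o s a) = a

  private
    alt-resp : ∀ {M N} p {f g : Ch M N (suc p)} → f ≐ g → Alt f → Alt g
    alt-resp zero e a = tt
    alt-resp (suc p) e a x y w = trans (sym (e _)) (trans (a x y w) (-‿cong (e _)))

    good-resp : ∀ {M N R S p} {f g : Ch M N p} → f ≐ g → Good R S f → Good R S g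
    good-resp e g0 = g0
    good-resp {p = suc p} e (gs o s a) = gs (λ x ni w → trans (sym (e _)) (o x ni w))
      (λ x → good-resp (λ w → e (x ∷ w)) (s x)) (alt-resp p e a)

    good-null : ∀ {M N R S p} → Good {M} {N} R S {p} 𝟘
    good-null {p = zero} = g0
    good-null {p = suc zero} = gs (λ _ _ _ → refl) (λ _ → good-null) tt
    good-null {p = suc (suc p)} = gs (λ _ _ _ → refl) (λ _ → good-null) (λ _ _ _ → sym (neg-0 refl))

    alt-add : ∀ {M N} p {f g : Ch M N (suc p)} → Alt f → Alt g → Alt (f ⊕ g)
    alt-add zero a b = tt
    alt-add (suc p) a b x y w = trans (+-cong (a x y w) (b x y w)) (solve 2 (λ x y → :- x :+ :- y := :- (x :+ y)) refl _ _)

    alt-scl : ∀ {M N} p k {f : Ch M N (suc p)} → Alt f → Alt (k ⊙ f)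
    alt-scl zero k a = tt
    alt-scl (suc p) k a x y w = trans (*-congˡ (a x y w)) (solve 2 (λ x y → x :* :- y := :- (x :* y)) refl _ _)

    good-add : ∀ {M N R S p} {f g : Ch M N p} → Good R S f → Good R S g → Good R S (f ⊕ g)
    good-add g0 g0 = g0
    good-add {p = suc p} (gs o s a) (gs o' s' a') =
      gs (λ x ni w → trans (+-cong (o x ni w) (o' x ni w)) (+-identityˡ _))
         (λ x → good-add (s x) (s' x)) (alt-add p a a')

    good-scl : ∀ {M N R S p} k {f : Ch M N p} → Good R S f → Good R S (k ⊙ f)
    good-scl k g0 = g0
    good-scl {p = suc p} k (gs o s a) =
      gs (λ x ni w → trans (*-congˡ (o x ni w)) (zeroʳ _))
         (λ x → good-scl k (s x)) (alt-scl p k a)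

  good-subspace : ∀ {M N} R S {p} → Subspace (Good {M} {N} R S {p})
  good-subspace R S = record { resp = good-resp ; null = good-null ; add = good-add ; scl = good-scl }

  module GoodS {M N} {R : Sub M} {S : Sub N} {p} = Subspace (good-subspace R S {p})

  good-mono : ∀ {M N} {R R' : Sub M} {S S' : Sub N} → R ⊆ R' → S ⊆ S' → ∀ {p} {f : Ch M N p} → Good R S f → Good R' S' f
  good-mono rs ss g0 = g0
  good-mono rs ss (gs o s a) = gs (λ { (r , t) ni → o (r , t) (λ { (h , k) → ni (rs r h , ss t k) }) })
    (λ e → good-mono (∖-mono _ rs) (∖-mono _ ss) (s e)) a

  good-≐0 : ∀ {M N R S p} {f : Ch M N p} → f ≐ 𝟘 → Good R S f
  good-≐0 e = GoodS.resp (≐-sym e) GoodS.null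

  private
    self-out : ∀ {M N} (R : Sub M) (S : Sub N) r s s' → ¬ Inside (R ∖ r) (S ∖ s') (r , s)
    self-out R S r s s' (h , _) = proj₁ (∖-in R h) ≡.refl

    self-out′ : ∀ {M N} (R : Sub M) (S : Sub N) r r' s → ¬ Inside (R ∖ r') (S ∖ s) (r , s)
    self-out′ R S r r' s (_ , h) = proj₁ (∖-in S h) ≡.refl

  wedge-to0 : ∀ {M N p} (e : Edge M N) {y : Ch M N p} → y ≐ 𝟘 → wedge e y ≐ 𝟘
  wedge-to0 e = to0 (wedge-linear e)

  wedge-good : ∀ {M N} {R : Sub M} {S : Sub N} {p} (e : Edge M N) {y : Ch M N p} → Inside R S e →
               Good (R ∖ proj₁ e) (S ∖ proj₂ e) y → Good R S (wedge e y)
  wedge-good {p = zero} e ins gy = gs (λ { e' ni w → δ*-≢ (λ { ≡.refl → ni ins }) _ }) (λ _ → g0) tt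
  wedge-good {R = R} {S} {suc p} (r , s) {y} ins gy = gs out sub (alt y (good-alt gy))
    where
    e = (r , s)
    out : ∀ e' → ¬ Inside R S e' → ι e' (wedge e y) ≐ 𝟘
    out e' ni w = trans (+-cong (δ*-≢ (λ { ≡.refl → ni ins }) _)
      (neg-0 (wedge-to0 e (good-out gy e' (λ { (h , k) → ni (∖-⊆ R r _ h , ∖-⊆ S s _ k) })) w))) (+-identityʳ _)
    sub : ∀ e' → Good (R ∖ proj₁ e') (S ∖ proj₂ e') (ι e' (wedge e y))
    sub e'@(r' , s') with e ≟E e'
    ... | yes ≡.refl = GoodS.sub (GoodS.scl _ gy) (good-≐0 (wedge-to0 e (good-out gy e (self-out R S r s s))))
    ... | no ne = GoodS.sub (GoodS.resp (λ w → sym (δ*-≢ ne (y w))) GoodS.null) rest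
      where
      rest : Good (R ∖ r') (S ∖ s') (wedge e (ι e' y))
      rest with r Finₚ.≟ r' | s Finₚ.≟ s'
      ... | yes ≡.refl | _ = good-≐0 (wedge-to0 e (good-out gy e' (self-out R S r s' s)))
      ... | no _ | yes ≡.refl = good-≐0 (wedge-to0 e (good-out gy e' (self-out′ R S r' r s)))
      ... | no nr | no ns = wedge-good e (in-∖ R nr (proj₁ ins) , in-∖ S ns (proj₂ ins))
              (good-mono (∖-swap R r r') (∖-swap S s s') (good-ι gy e'))
    alt : ∀ {p} (y : Ch _ _ (suc p)) → Alt y → Alt (wedge e y)
    alt {zero} y a e' e'' (w) =
      solve 4 (λ d x d' x' → d :* x :- d' :* x' := :- (d' :* x' :- d :* x)) refl (δ e e') (y (e'' ∷ w)) (δ e e'') (y (e' ∷ w))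
    alt {suc p} y a e' e'' w = begin
      δ e e' * y (e'' ∷ w) + - (δ e e'' * y (e' ∷ w) + - wedge e (ι e'' (ι e' y)) w)
        ≈⟨ +-congˡ (-‿cong (+-congˡ (-‿cong (trans (cong (wedge-linear e) (λ w → a e' e'' w) w)
             (hom-neg (wedge-linear e) (ι e' (ι e'' y)) w))))) ⟩
      δ e e' * y (e'' ∷ w) + - (δ e e'' * y (e' ∷ w) + - - wedge e (ι e' (ι e'' y)) w)
        ≈⟨ solve 3 (λ x y z → x :- (y :- (:- z)) := :- (y :- (x :- z))) refl _ _ _ ⟩
      - (δ e e'' * y (e' ∷ w) + - (δ e e' * y (e'' ∷ w) + - wedge e (ι e' (ι e'' y)) w)) ∎
      where open ≈-R

  wedge-ι-good : ∀ {M N} {R : Sub M} {S : Sub N} {p} {f : Ch M N (suc p)} → Good R S f → ∀ e → Good R S (wedge e (ι e f))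
  wedge-ι-good {R = R} {S} gf e with inside? R S e
  ... | yes ins = wedge-good e ins (good-ι gf e)
  ... | no ni = good-≐0 (wedge-to0 e (good-out gf e ni))

  same-row : ∀ {M N} {R : Sub M} {S : Sub N} {p} {f : Ch M N (suc (suc p))} → Good R S f → ∀ r s s' w → f ((r , s) ∷ (r , s') ∷ w) ≈ 0#
  same-row {R = R} {S} gf r s s' w = good-out (good-ι gf (r , s)) (r , s') (self-out R S r s' s) w

  -- ∂ is a sum of contractions, and contractions anticommute on alternating functions.
  anti-∂ι : ∀ {M N} {R : Sub M} {S : Sub N} {p} {f : Ch M N (suc (suc p))} → Good R S f → ∀ e → ι e (∂ f) ≐ neg (∂ (ι e f))
  anti-∂ι {f = f} gf e w = trans (∑-cong (λ r → trans (∑-cong (λ s → good-alt₂ gf (r , s) e w)) (∑-neg (λ s → f (e ∷ (r , s) ∷ w)))))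
                         (∑-neg (λ r → ∑ (λ s → f (e ∷ (r , s) ∷ w))))

  ∂-good : ∀ {M N} {R : Sub M} {S : Sub N} {p} {f : Ch M N (suc p)} → Good R S f → Good R S (∂ f)
  ∂-good {p = zero} gf = g0
  ∂-good {p = suc p} {f} gf = gs
    (λ e ni w → trans (anti-∂ι gf e w) (neg-0 (to0 ∂-linear (good-out gf e ni) w)))
    (λ e → GoodS.resp (≐-sym (anti-∂ι gf e)) (GoodS.negate (∂-good (good-ι gf e))))
    (alt p f gf)
    where
    alt : ∀ p (f : Ch _ _ (suc (suc p))) → Good _ _ f → Alt (∂ f)
    alt zero f gf = tt
    alt (suc p) f gf x y w = trans
      (∑-cong (λ r → trans (∑-cong (λ s → good-alt₂ (good-ι gf (r , s)) x y w)) (∑-neg (λ s → f ((r , s) ∷ y ∷ x ∷ w)))))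
      (∑-neg (λ r → ∑ (λ s → f ((r , s) ∷ y ∷ x ∷ w))))

  -- The double sum is grouped by the pair of rows. It is antisymmetric in that pair, and its
  -- diagonal vanishes in every characteristic because a matching has at most one edge in a row.
  ∂∂ : ∀ {M N} {R : Sub M} {S : Sub N} {p} {f : Ch M N (suc (suc p))} → Good R S f → ∂ (∂ f) ≐ 𝟘
  ∂∂ {M} {N} {f = f} gf w = trans (∑-cong (λ r → ∑-swap (λ s r' → ∑ (λ s' → f ((r' , s') ∷ (r , s) ∷ w)))))
    (∑∑-antisym h anti diag)
    where
    h : Fin M → Fin M → Carrier
    h r r' = ∑ (λ s → ∑ (λ s' → f ((r' , s') ∷ (r , s) ∷ w)))
    anti : ∀ r r' → h r r' ≈ - h r' r
    anti r r' = trans (∑-swap (λ s s' → f ((r' , s') ∷ (r , s) ∷ w)))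
      (trans (∑-cong (λ s' → trans (∑-cong (λ s → good-alt₂ gf (r' , s') (r , s) w)) (∑-neg (λ s → f ((r , s) ∷ (r' , s') ∷ w)))))
             (∑-neg (λ s' → ∑ (λ s → f ((r , s) ∷ (r' , s') ∷ w)))))
    diag : ∀ r → h r r ≈ 0#
    diag r = ∑-0 (λ s → ∑-0 (λ s' → same-row gf r s' s w))

  -- Degree 0 belongs to the empty face, below which there is nothing. Making all its chains cycles
  -- gives reduced homology.
  Cyc : ∀ {M N p} → Ch M N p → Set ℓ
  Cyc {p = zero} f = ⊤
  Cyc {p = suc p} f = ∂ f ≐ 𝟘

  record Cycle {M N} (R : Sub M) (S : Sub N) {p} (f : Ch M N p) : Set (c ⊔ ℓ) where
    constructor cycle
    field
      good : Good R S f
      cyc  : Cyc f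
  open Cycle public

  record Bd {M N} (R : Sub M) (S : Sub N) {p} (f : Ch M N p) : Set (c ⊔ ℓ) where
    constructor bd
    field
      filling : Ch M N (suc p)
      fgood   : Good R S filling
      feq     : f ≐ ∂ filling
  open Bd public

  private
    cyc-resp : ∀ {M N} p {f g : Ch M N p} → f ≐ g → Cyc f → Cyc g
    cyc-resp zero e h = tt
    cyc-resp (suc p) e h = ≐-trans (cong ∂-linear (≐-sym e)) h

    cyc-null : ∀ {M N} p → Cyc {M} {N} {p} 𝟘
    cyc-null zero = tt
    cyc-null (suc p) = hom0 ∂-linear

    cyc-add : ∀ {M N} p {f g : Ch M N p} → Cyc f → Cyc g → Cyc (f ⊕ g)
    cyc-add zero h k = tt
    cyc-add (suc p) {f} {g} h k w = trans (hom+ ∂-linear f g w) (trans (+-cong (h w) (k w)) (+-identityʳ _))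

    cyc-scl : ∀ {M N} p a {f : Ch M N p} → Cyc f → Cyc (a ⊙ f)
    cyc-scl zero a h = tt
    cyc-scl (suc p) a {f} h w = trans (hom* ∂-linear a f w) (trans (*-congˡ (h w)) (zeroʳ _))

  cycle-subspace : ∀ {M N} R S {p} → Subspace (Cycle {M} {N} R S {p})
  cycle-subspace R S {p} = record
    { resp = λ e (cycle g h) → cycle (GoodS.resp e g) (cyc-resp p e h)
    ; null = cycle GoodS.null (cyc-null p)
    ; add = λ (cycle g h) (cycle g' h') → cycle (GoodS.add g g') (cyc-add p h h')
    ; scl = λ a (cycle g h) → cycle (GoodS.scl a g) (cyc-scl p a h) }

  module CycleS {M N} {R : Sub M} {S : Sub N} {p} = Subspace (cycle-subspace R S {p})

  bd-subspace : ∀ {M N} R S {p} → Subspace (Bd {M} {N} R S {p})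
  bd-subspace R S {p} = record
    { resp = λ e (bd h g q) → bd h g (≐-trans (≐-sym e) q)
    ; null = bd 𝟘 GoodS.null (≐-sym (hom0 ∂-linear))
    ; add = λ (bd h g q) (bd h' g' q') → bd (h ⊕ h') (GoodS.add g g')
          (λ w → trans (+-cong (q w) (q' w)) (sym (hom+ ∂-linear h h' w)))
    ; scl = λ a (bd h g q) → bd (a ⊙ h) (GoodS.scl a g) (λ w → trans (*-congˡ (q w)) (sym (hom* ∂-linear a h w))) }

  module BdS {M N} {R : Sub M} {S : Sub N} {p} = Subspace (bd-subspace R S {p})

  ∂-bd : ∀ {M N} {R : Sub M} {S : Sub N} {p} {h : Ch M N (suc p)} → Good R S h → Bd R S (∂ h)
  ∂-bd gh = bd _ gh ≐-refl

  bd-mono : ∀ {M N} {R R' : Sub M} {S S' : Sub N} → R ⊆ R' → S ⊆ S' → ∀ {p} {f : Ch M N p} → Bd R S f → Bd R' S' f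
  bd-mono rs ss (bd h g q) = bd h (good-mono rs ss g) q

  cycle-mono : ∀ {M N} {R R' : Sub M} {S S' : Sub N} → R ⊆ R' → S ⊆ S' → ∀ {p} {f : Ch M N p} → Cycle R S f → Cycle R' S' f
  cycle-mono rs ss (cycle g h) = cycle (good-mono rs ss g) h

  bd-cycle : ∀ {M N} {R : Sub M} {S : Sub N} {p} {f : Ch M N p} → Bd R S f → Cycle R S f
  bd-cycle {p = zero} (bd h g q) = cycle g0 tt
  bd-cycle {p = suc p} (bd h g q) = cycle (GoodS.resp (≐-sym q) (∂-good g)) (≐-trans (cong ∂-linear q) (∂∂ g))

  ι-cycle : ∀ {M N} {R : Sub M} {S : Sub N} {p} {f : Ch M N (suc p)} → Cycle R S f → ∀ e →
            Cycle (R ∖ proj₁ e) (S ∖ proj₂ e) (ι e f)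
  ι-cycle {p = zero} (cycle g h) e = cycle g0 tt
  ι-cycle {p = suc p} {f} (cycle g h) e = cycle (good-ι g e)
    (λ w → trans (solve 1 (λ x → x := :- (:- x)) refl _) (neg-0 (trans (sym (anti-∂ι g e w)) (h (e ∷ w)))))

  wedge∂-cyc : ∀ {M N p} (e : Edge M N) {y : Ch M N p} → Cyc y → wedge∂ e y ≐ 𝟘
  wedge∂-cyc {p = zero} e h = ≐-refl
  wedge∂-cyc {p = suc p} e h = wedge-to0 e h

  ∂-wedge-cyc : ∀ {M N p} (e : Edge M N) {y : Ch M N p} → Cyc y → ∂ (wedge e y) ≐ y
  ∂-wedge-cyc e {y} h w = trans (∂-wedge e y w) (trans (+-congˡ (neg-0 (wedge∂-cyc e h w))) (+-identityʳ _))

  avoid-row : ∀ {M N} {R : Sub M} {S : Sub N} {p} {f : Ch M N (suc p)} r → Good R S f →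
              (∀ s → ι (r , s) f ≐ 𝟘) → Good (R ∖ r) S f
  avoid-row {R = R} {S} {p = zero} {f} r (gs o s a) z =
    gs (λ { (r' , t) ni w → out r' t ni w }) (λ _ → g0) a
    where
    out : ∀ r' t → ¬ Inside (R ∖ r) S (r' , t) → ∀ w → f ((r' , t) ∷ w) ≈ 0#
    out r' t ni w = go (r' Finₚ.≟ r)
      where
      go : Dec (r' ≡ r) → f ((r' , t) ∷ w) ≈ 0#
      go (yes ≡.refl) = z t w
      go (no ne) = o (r' , t) (λ { (h , k) → ni (in-∖ R ne h , k) }) w
  avoid-row {R = R} {S} {p = suc p} {f} r (gs o s a) z =
    gs (λ { (r' , t) ni w → out r' t ni w }) sub a
    where
    out : ∀ r' t → ¬ Inside (R ∖ r) S (r' , t) → ∀ w → f ((r' , t) ∷ w) ≈ 0#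
    out r' t ni w = go (r' Finₚ.≟ r)
      where
      go : Dec (r' ≡ r) → f ((r' , t) ∷ w) ≈ 0#
      go (yes ≡.refl) = z t w
      go (no ne) = o (r' , t) (λ { (h , k) → ni (in-∖ R ne h , k) }) w
    sub : ∀ e → Good (R ∖ r ∖ proj₁ e) (S ∖ proj₂ e) (ι e f)
    sub e = good-mono (∖-swap R (proj₁ e) r) ⊆-refl
      (avoid-row r (s e) (λ t w → trans (a e (r , t) w) (neg-0 (z t (e ∷ w)))))

  rowPart : ∀ {M N p} → Fin M → Ch M N (suc p) → Ch M N (suc p)
  rowPart r f = ⨁ (λ s → wedge (r , s) (ι (r , s) f))

  -- A matching has at most one edge in row r, so subtracting the terms e_{rs} ∧ f_{rs} for all s
  -- removes that row completely.
  row-split : ∀ {M N} {R : Sub M} {S : Sub N} {p} {f : Ch M N (suc p)} → Good R S f → ∀ r →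
              Good (R ∖ r) S (f ⊖ rowPart r f)
  row-split {M} {N} {R} {S} {p} {f} gf r = avoid-row r (GoodS.sub gf (GoodS.sum _ (λ s → wedge-ι-good gf (r , s))))
    (λ s w → trans (+-congˡ (-‿cong (trans (∑-cong (λ t → single p f gf t s w))
         (trans (∑-single (λ t → δ (r , t) (r , s) * f ((r , t) ∷ w)) s
           (λ t ne → δ*-≢ {e = r , t} {r , s} (λ eq → ne (≡.cong proj₂ eq)) _)) (δ*-refl (r , s) _))))) (-‿inverseʳ _))
    where
    single : ∀ p (f : Ch M N (suc p)) → Good R S f → ∀ t s w → wedge (r , t) (ι (r , t) f) ((r , s) ∷ w) ≈ δ (r , t) (r , s) * f ((r , t) ∷ w)
    single zero f gf t s w = refl
    single (suc p) f gf t s w = trans (+-congˡ (neg-0 (wedge-to0 (r , t) (λ w → same-row gf r t s w) w))) (+-identityʳ _)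

  tr : ∀ {M N p} → Ch M N p → Ch N M p
  tr f w = f (Vec.map swap w)

  tr-linear : ∀ {M N p} → Linear (tr {M} {N} {p})
  tr-linear = record { cong = λ h w → h _ ; hom+ = λ f g w → refl ; hom* = λ a f w → refl }

  tr-tr : ∀ {M N p} (f : Ch M N p) → tr (tr f) ≐ f
  tr-tr f w = reflexive (≡.cong f (go w))
    where
    go : ∀ {M N p} (w : Vec (Edge M N) p) → Vec.map swap (Vec.map swap w) ≡ w
    go [] = ≡.refl
    go (e ∷ w) = ≡.cong (e ∷_) (go w)

  tr-∂ : ∀ {M N p} (f : Ch M N (suc p)) → ∂ (tr f) ≐ tr (∂ f)
  tr-∂ f w = ∑-swap (λ s r → f ((r , s) ∷ Vec.map swap w))

  δ-swap : ∀ {M N} (e : Edge M N) (e' : Edge N M) → δ e (swap e') ≡ δ (swap e) e'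
  δ-swap e e' with swap e ≟E e'
  ... | yes ≡.refl = ≡.trans (δ-refl e) (≡.sym (δ-refl (swap e)))
  ... | no ne = ≡.trans (δ-≢ (λ eq → ne (≡.cong swap eq))) (≡.sym (δ-≢ ne))

  tr-wedge : ∀ {M N p} (e : Edge M N) (y : Ch M N p) → tr (wedge e y) ≐ wedge (swap e) (tr y)
  tr-wedge {p = zero} e y (e' ∷ w) = *-congʳ (reflexive (δ-swap e e'))
  tr-wedge {p = suc p} e y (e' ∷ w) =
    +-cong (*-congʳ (reflexive (δ-swap e e'))) (-‿cong (tr-wedge e (ι (swap e') y) w))

  tr-good : ∀ {M N} {R : Sub M} {S : Sub N} {p} {f : Ch M N p} → Good R S f → Good S R (tr f)
  tr-good g0 = g0
  tr-good {p = suc p} (gs o s a) = gs (λ e ni w → o (swap e) (λ { (h , k) → ni (k , h) }) _)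
    (λ e → tr-good (s (swap e))) (alt p _ a)
    where
    alt : ∀ p (f : Ch _ _ (suc p)) → Alt f → Alt (tr f)
    alt zero f a = tt
    alt (suc p) f a e e' w = a (swap e) (swap e') _

  tr-cycle : ∀ {M N} {R : Sub M} {S : Sub N} {p} {f : Ch M N p} → Cycle R S f → Cycle S R (tr f)
  tr-cycle {p = zero} (cycle g h) = cycle g0 tt
  tr-cycle {p = suc p} {f} (cycle g h) = cycle (tr-good g) (λ w → trans (tr-∂ f w) (h _))

  tr-bd : ∀ {M N} {R : Sub M} {S : Sub N} {p} {f : Ch M N p} → Bd R S f → Bd S R (tr f)
  tr-bd (bd h g q) = bd (tr h) (tr-good g) (λ w → trans (q _) (sym (tr-∂ h w)))

  colPart : ∀ {M N p} → Fin N → Ch M N (suc p) → Ch M N (suc p)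
  colPart s f = ⨁ (λ r → wedge (r , s) (ι (r , s) f))

  col-split : ∀ {M N} {R : Sub M} {S : Sub N} {p} {f : Ch M N (suc p)} → Good R S f → ∀ s →
              Good R (S ∖ s) (f ⊖ colPart s f)
  col-split {f = f} gf s = GoodS.resp
    (λ w → +-cong (tr-tr f w) (-‿cong (∑-cong (λ r →
       trans (tr-wedge (s , r) (tr (ι (r , s) f)) w) (cong (wedge-linear (r , s)) (tr-tr (ι (r , s) f)) w)))))
    (tr-good (row-split (tr-good gf) s))

  wedge-anti : ∀ {M N p} (e e' : Edge M N) (y : Ch M N p) → wedge e (wedge e' y) ≐ neg (wedge e' (wedge e y))
  wedge-anti {p = zero} e e' y (x ∷ x' ∷ w) =
    solve 5 (λ a b c d y → a :* (b :* y) :- c :* (d :* y) := :- (d :* (c :* y) :- b :* (a :* y))) refl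
      (δ e x) (δ e' x') (δ e x') (δ e' x) (y w)
  wedge-anti {p = suc p} e e' y (x ∷ w) = begin
    δ e x * wedge e' y w + - wedge e (δ e' x ⊙ y ⊖ wedge e' (ι x y)) w
      ≈⟨ +-congˡ (-‿cong (expand e e')) ⟩
    δ e x * wedge e' y w + - (δ e' x * wedge e y w + - wedge e (wedge e' (ι x y)) w)
      ≈⟨ +-congˡ (-‿cong (+-congˡ (-‿cong (wedge-anti e e' (ι x y) w)))) ⟩
    δ e x * wedge e' y w + - (δ e' x * wedge e y w + - - wedge e' (wedge e (ι x y)) w)
      ≈⟨ solve 3 (λ a b c → a :- (b :- (:- c)) := :- (b :- (a :- c))) refl _ _ _ ⟩
    - (δ e' x * wedge e y w + - (δ e x * wedge e' y w + - wedge e' (wedge e (ι x y)) w))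
      ≈⟨ -‿cong (+-congˡ (-‿cong (sym (expand e' e)))) ⟩
    - (δ e' x * wedge e y w + - wedge e' (δ e x ⊙ y ⊖ wedge e (ι x y)) w) ∎
    where
    open ≈-R
    expand : ∀ e e' → wedge e (δ e' x ⊙ y ⊖ wedge e' (ι x y)) w ≈ δ e' x * wedge e y w + - wedge e (wedge e' (ι x y)) w
    expand e e' = trans (hom- (wedge-linear e) (δ e' x ⊙ y) (wedge e' (ι x y)) w)
                        (+-congʳ (hom* (wedge-linear e) (δ e' x) y w))

  -- Vanishing of the low homology

  reduce-≤ : ∀ k l {a b x y} → x ≡ a ℕ.+ (k ℕ.+ l) → y ≡ b ℕ.+ k → x ℕ.≤ y → a ℕ.≤ b
  reduce-≤ k l {a} {b} ≡.refl ≡.refl h =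
    ℕₚ.+-cancelʳ-≤ k a b (ℕₚ.≤-trans (ℕₚ.+-monoʳ-≤ a (ℕₚ.m≤m+n k l)) h)

  infixr 5 _⊞_
  _⊞_ : ∀ {x p q} {X : Set x} → ((X → Carrier) → Set p) → ((X → Carrier) → Set q) → (X → Carrier) → Set (c ⊔ x ⊔ p ⊔ q)
  (P ⊞ Q) f = ∃[ y ] (P y × Q (f ⊖ y))

  module _ {x p q} {X : Set x} {P : (X → Carrier) → Set p} {Q : (X → Carrier) → Set q}
           (sP : Subspace P) (sQ : Subspace Q) where
    private
      module P = Subspace sP
      module Q = Subspace sQ

    ⊞-subspace : Subspace (P ⊞ Q)
    ⊞-subspace = record
      { resp = λ e (y , p , q) → y , p , Q.resp (λ w → +-congʳ (e w)) q
      ; null = 𝟘 , P.null , Q.resp (λ w → sym (-‿inverseʳ 0#)) Q.null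
      ; add = λ {f} {g} (y , p , q) (y' , p' , q') → y ⊕ y' , P.add p p' ,
          Q.resp (λ w → solve 4 (λ f y g y' → (f :- y) :+ (g :- y') := (f :+ g) :- (y :+ y')) refl (f w) (y w) (g w) (y' w)) (Q.add q q')
      ; scl = λ a {f} (y , p , q) → a ⊙ y , P.scl a p ,
          Q.resp (λ w → solve 3 (λ f y a → a :* (f :- y) := a :* f :- a :* y) refl (f w) (y w) a) (Q.scl a q) }

    ⊞-left : ∀ {f} → P f → (P ⊞ Q) f
    ⊞-left {f} h = f , h , Q.resp (λ w → sym (-‿inverseʳ (f w))) Q.null

    ⊞-right : ∀ {f} → Q f → (P ⊞ Q) f
    ⊞-right {f} h = 𝟘 , P.null , Q.resp (λ w → sym (trans (+-congˡ (neg-0 refl)) (+-identityʳ (f w)))) h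

  -- Since ∂(e ∧ g) = g - e ∧ ∂g, the product e ∧ ∂g is homologous to g, which avoids the row and
  -- the column of e.
  wedge-fill : ∀ {M N} {R : Sub M} {S : Sub N} {p} {e : Edge M N} {f : Ch M N p} → Inside R S e →
               Bd (R ∖ proj₁ e) (S ∖ proj₂ e) f → (Good (R ∖ proj₁ e) (S ∖ proj₂ e) ⊞ Bd R S) (wedge e f)
  wedge-fill {e = e} {f} ins (bd g gg q) = g , gg ,
    BdS.resp (λ w → begin
        - ∂ (wedge e g) w ≈⟨ -‿cong (∂-wedge e g w) ⟩
        - (g w + - wedge e (∂ g) w) ≈⟨ solve 2 (λ x y → :- (x :- y) := y :- x) refl _ _ ⟩
        wedge e (∂ g) w + - g w ≈⟨ +-congʳ (cong (wedge-linear e) (≐-sym q) w) ⟩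
        wedge e f w + - g w ∎)
      (BdS.negate (∂-bd (wedge-good e ins gg)))
    where open ≈-R

  cyc-complement : ∀ {M N} {R : Sub M} {S : Sub N} {p} {f g : Ch M N p} → Cycle R S f → Cycle R S (f ⊖ g) → Cyc g
  cyc-complement {f = f} {g} cf cg = cyc (CycleS.resp (λ w → solve 2 (λ f g → f :- (f :- g) := g) refl (f w) (g w)) (CycleS.sub cf cg))

  -- In the expansion of z along row r each term e_{rs} ∧ ∂g is replaced by g. The result avoids r
  -- and differs from z by a boundary, hence is again a cycle.
  push-row : ∀ {M N} {R : Sub M} {S : Sub N} {p} {z : Ch M N (suc p)} {r} → R r ≡ true → Cycle R S z →
             (∀ s → S s ≡ true → Bd (R ∖ r) (S ∖ s) (ι (r , s) z)) → (Cycle (R ∖ r) S ⊞ Bd R S) z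
  push-row {R = R} {S} {p} {z} {r} hr cz hyp = y , cycle gy (cyc-complement cz (bd-cycle by)) , by
    where
    sub⊞ = ⊞-subspace (good-subspace (R ∖ r) S) (bd-subspace R S)
    piece : ∀ s → (Good (R ∖ r) S ⊞ Bd R S) (wedge (r , s) (ι (r , s) z))
    piece s with S s Boolₚ.≟ true
    ... | yes hs = let (g , gg , b) = wedge-fill (hr , hs) (hyp s hs) in g , good-mono ⊆-refl (∖-⊆ S s) gg , b
    ... | no ns = Subspace.resp sub⊞ (≐-sym (wedge-to0 (r , s) (good-out (good cz) (r , s) (λ (_ , h) → ns h)))) (Subspace.null sub⊞)
    whole : (Good (R ∖ r) S ⊞ Bd R S) z
    whole = Subspace.resp sub⊞ (λ w → solve 2 (λ a b → (a :- b) :+ b := a) refl (z w) _)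
      (Subspace.add sub⊞ (⊞-left (good-subspace _ _) (bd-subspace R S) (row-split (good cz) r))
                         (Subspace.sum sub⊞ (λ s → wedge (r , s) (ι (r , s) z)) piece))
    y = proj₁ whole
    gy = proj₁ (proj₂ whole)
    by = proj₂ (proj₂ whole)

  -- The span of the boundaries and of the cycles that miss some column. A cycle missing column u is
  -- filled as soon as a spare row r allows coning with e_{ru}.
  data Decomposable {M N} (R : Sub M) (S : Sub N) {p} (f : Ch M N p) : Set (c ⊔ ℓ) where
    bounding : Bd R S f → Decomposable R S f
    avoiding : ∀ u → S u ≡ true → Cycle R (S ∖ u) f → Decomposable R S f
    plus     : ∀ {g h} → Decomposable R S g → Decomposable R S h → f ≐ g ⊕ h → Decomposable R S f

  private
    dec-resp : ∀ {M N} {R : Sub M} {S : Sub N} {p} {f g : Ch M N p} → f ≐ g → Decomposable R S f → Decomposable R S g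
    dec-resp e (bounding b) = bounding (BdS.resp e b)
    dec-resp e (avoiding u h k) = avoiding u h (CycleS.resp e k)
    dec-resp e (plus a b q) = plus a b (≐-trans (≐-sym e) q)

    dec-scl : ∀ {M N} {R : Sub M} {S : Sub N} {p} a {f : Ch M N p} → Decomposable R S f → Decomposable R S (a ⊙ f)
    dec-scl a (bounding b) = bounding (BdS.scl a b)
    dec-scl a (avoiding u h k) = avoiding u h (CycleS.scl a k)
    dec-scl a (plus d d' q) = plus (dec-scl a d) (dec-scl a d') (λ w → trans (*-congˡ (q w)) (distribˡ a _ _))

  dec-subspace : ∀ {M N} R S {p} → Subspace (Decomposable {M} {N} R S {p})
  dec-subspace R S = record { resp = dec-resp ; null = bounding BdS.null ; add = λ a b → plus a b ≐-refl ; scl = dec-scl }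

  dec-cycle : ∀ {M N} {R : Sub M} {S : Sub N} {p} {f : Ch M N p} → Decomposable R S f → Cycle R S f
  dec-cycle (bounding b) = bd-cycle b
  dec-cycle {S = S} (avoiding u h k) = cycle-mono ⊆-refl (∖-⊆ S u) k
  dec-cycle (plus a b q) = CycleS.resp (≐-sym q) (CycleS.add (dec-cycle a) (dec-cycle b))

  -- If every piece w avoiding u bounds some g, then e ∧ w - g is a cycle avoiding u, and g avoids the column of e.
  wedge-dec : ∀ {M N} {R : Sub M} {S : Sub N} {p} {r s} → Inside R S (r , s) →
              (∀ u {f : Ch M N p} → (S ∖ s) u ≡ true → Cycle R (S ∖ s ∖ u) f → Bd R (S ∖ s ∖ u) f) →
              ∀ {f : Ch M N p} → Decomposable (R ∖ r) (S ∖ s) f → (Good R (S ∖ s) ⊞ Decomposable R S) (wedge (r , s) f)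
  wedge-dec {R = R} {S} {r = r} {s} ins van (bounding b) =
    let (g , gg , k) = wedge-fill ins b in g , good-mono (∖-⊆ R r) ⊆-refl gg , bounding k
  wedge-dec {R = R} {S} {r = r} {s} ins van {f} (avoiding u hu k) with van u hu (cycle-mono (∖-⊆ R r) ⊆-refl k)
  ... | bd g gg q = g , good-mono ⊆-refl (∖-⊆ (S ∖ s) u) gg , avoiding u (proj₂ hu')
    (cycle (GoodS.sub (wedge-good (r , s) (proj₁ ins , in-∖ S (λ eq → proj₁ hu' (≡.sym eq)) (proj₂ ins))
                         (good-mono ⊆-refl (∖-swap S s u) (good k)))
                      (good-mono ⊆-refl (λ i h → ∖-mono u (∖-⊆ S s) i h) gg))
           (λ w → trans (hom- ∂-linear (wedge (r , s) f) g w)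
                    (trans (+-cong (trans (∂-wedge-cyc (r , s) (cyc k) w) (q w)) refl) (-‿inverseʳ _))))
    where hu' = ∖-in S hu
  wedge-dec {R = R} {S} {r = r} {s} ins van (plus {g} {h} a b q) =
    Subspace.resp sub⊞ (≐-trans (≐-sym (hom+ (wedge-linear (r , s)) g h)) (≐-sym (cong (wedge-linear (r , s)) q)))
      (Subspace.add sub⊞ (wedge-dec ins van a) (wedge-dec ins van b))
    where sub⊞ = ⊞-subspace (good-subspace R (S ∖ s)) (dec-subspace R S)

  mutual
    -- This is the classical connectivity range of the chessboard complex: no homology for p <
    -- min(m, n, ⌊(m+n+1)/3⌋), where p counts vertices. By transposition the shorter side may be
    -- taken to be the rows.
    vanishing : ∀ {M N} {R : Sub M} {S : Sub N} {m n} p {f : Ch M N p} → card R ≡ m → card S ≡ n →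
                3 ℕ.* p ℕ.+ 2 ℕ.≤ m ℕ.+ n → p ℕ.< m → p ℕ.< n → Cycle R S f → Bd R S f
    vanishing {R = R} {S} {suc m} {suc n} zero {f} cR cS h pm pn cf =
      let (r , hr) = choose R cR ; (s , hs) = choose S cS in
      bd (wedge (r , s) f) (wedge-good (r , s) (hr , hs) g0) (≐-sym (∂-wedge-cyc (r , s) {f} tt))
    vanishing {m = m} {n} (suc p) cR cS h pm pn cf with ℕₚ.≤-total m n
    ... | inj₁ m≤n = vanishing′ p m≤n cR cS h pm pn cf
    ... | inj₂ n≤m = BdS.resp (tr-tr _)
            (tr-bd (vanishing′ p n≤m cS cR (≡.subst (3 ℕ.* suc p ℕ.+ 2 ℕ.≤_) (ℕₚ.+-comm m n) h) pn pm (tr-cycle cf)))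

    -- Induction first empties row r. That row then provides the apexes e_{ru} over the summands of
    -- the remaining cycle, each of which misses a column u or bounds.
    vanishing′ : ∀ {M N} {R : Sub M} {S : Sub N} {m n} p {f : Ch M N (suc p)} → m ℕ.≤ n → card R ≡ m → card S ≡ n →
                3 ℕ.* suc p ℕ.+ 2 ℕ.≤ m ℕ.+ n → suc p ℕ.< m → suc p ℕ.< n → Cycle R S f → Bd R S f
    vanishing′ {R = R} {S} {suc m} {suc n} p {f} m≤n cR cS h (s≤s pm) (s≤s pn) cf =
      BdS.resp (λ w → solve 2 (λ f x → (f :- x) :+ x := f) refl (f w) (x w)) (BdS.add bx (bounds dec))
      where
      hr = proj₂ (choose R cR)
      r = proj₁ (choose R cR)
      pushed = push-row hr cf (λ s hs → vanishing p (card-∖′ R hr cR) (card-∖′ S hs cS)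
                 (reduce-≤ 2 1 (arith₁ p) (arith₂ m n) h) pm pn (ι-cycle cf (r , s)))
        where
        arith₁ : ∀ p → 3 ℕ.* suc p ℕ.+ 2 ≡ (3 ℕ.* p ℕ.+ 2) ℕ.+ (2 ℕ.+ 1)
        arith₁ = solve-∀
        arith₂ : ∀ m n → suc m ℕ.+ suc n ≡ (m ℕ.+ n) ℕ.+ 2
        arith₂ = solve-∀
      x = proj₁ pushed
      bx = proj₂ (proj₂ pushed)
      -- `decomposition` needs two columns beyond the degree. Otherwise both sides have length at
      -- most p + 2, and 3p + 5 ≤ 2p + 4 is absurd; this is where m ≤ n enters.
      gap : 3 ℕ.+ p ℕ.≤ suc n
      gap with 3 ℕ.+ p ℕₚ.≤? suc n
      ... | yes le = le
      ... | no nle = ⊥-elim (ℕₚ.n≮0 (reduce-≤ (2 ℕ.* p ℕ.+ 4) p {1} {0} (arith₁ p) (arith₂ p)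
              (ℕₚ.≤-trans h (ℕₚ.+-mono-≤ (ℕₚ.≤-trans m≤n n≤) n≤))))
        where
        n≤ : suc n ℕ.≤ p ℕ.+ 2
        n≤ = ≡.subst (suc n ℕ.≤_) (ℕₚ.+-comm 2 p) (ℕₚ.≤-pred (ℕₚ.≰⇒> nle))
        arith₁ : ∀ p → 3 ℕ.* suc p ℕ.+ 2 ≡ 1 ℕ.+ ((2 ℕ.* p ℕ.+ 4) ℕ.+ p)
        arith₁ = solve-∀
        arith₂ : ∀ p → (p ℕ.+ 2) ℕ.+ (p ℕ.+ 2) ≡ 0 ℕ.+ (2 ℕ.* p ℕ.+ 4)
        arith₂ = solve-∀
      dec : Decomposable (R ∖ r) S x
      dec = decomposition (suc p) (card-∖′ R hr cR) cS
        (reduce-≤ 1 0 (arith p) (≡.trans (≡.cong suc (ℕₚ.+-suc m n)) (arith' m n)) h) pm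
        (≡.subst (ℕ._≤ suc n) (ℕₚ.+-comm 2 (suc p)) gap) (proj₁ (proj₂ pushed))
        where
        arith : ∀ p → 3 ℕ.* suc p ℕ.+ 2 ≡ (3 ℕ.* suc p ℕ.+ 1) ℕ.+ (1 ℕ.+ 0)
        arith = solve-∀
        arith' : ∀ m n → suc (suc (m ℕ.+ n)) ≡ (m ℕ.+ suc n) ℕ.+ 1
        arith' = solve-∀
      bounds : ∀ {f} → Decomposable (R ∖ r) S f → Bd R S f
      bounds (bounding b) = bd-mono (∖-⊆ R r) ⊆-refl b
      bounds (avoiding u hu k) = bd (wedge (r , u) _) (wedge-good (r , u) (hr , hu) (good k)) (≐-sym (∂-wedge-cyc (r , u) (cyc k)))
      bounds (plus a b q) = BdS.resp (≐-sym q) (BdS.add (bounds a) (bounds b))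

    -- The coefficients along a column s are decomposable by induction, and `wedge-dec` trades
    -- e_{rs} ∧ each of them for a chain avoiding s plus a decomposable one. What is left of f
    -- avoids s and is a cycle, being a difference of cycles.
    decomposition : ∀ {M N} {R : Sub M} {S : Sub N} {m n} p {f : Ch M N p} → card R ≡ m → card S ≡ n →
                    3 ℕ.* p ℕ.+ 1 ℕ.≤ m ℕ.+ n → p ℕ.≤ m → p ℕ.+ 2 ℕ.≤ n → Cycle R S f → Decomposable R S f
    decomposition {S = S} {n = suc n} zero cR cS h pm pn cf =
      let (u , hu) = choose S cS in avoiding u hu (cycle g0 tt)
    decomposition {R = R} {S} {suc m} {n} (suc p) {f} cR cS h (s≤s pm) pn cf with ≡.subst (ℕ._≤ n) (ℕₚ.+-comm (suc p) 2) pn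
    decomposition {R = R} {S} {suc m} {suc (suc n)} (suc p) {f} cR cS h (s≤s pm) pn cf | s≤s (s≤s pn') =
      plus (proj₂ (proj₂ whole)) (avoiding s hs (cycle (proj₁ (proj₂ whole)) (cyc-complement cf (dec-cycle (proj₂ (proj₂ whole))))))
        (λ w → solve 2 (λ f y → f := (f :- y) :+ y) refl (f w) (proj₁ whole w))
      where
      s = proj₁ (choose S cS)
      hs = proj₂ (choose S cS)
      sub⊞ = ⊞-subspace (good-subspace R (S ∖ s)) (dec-subspace R S)
      piece : ∀ r → (Good R (S ∖ s) ⊞ Decomposable R S) (wedge (r , s) (ι (r , s) f))
      piece r with R r Boolₚ.≟ true
      ... | no nr = Subspace.resp sub⊞ (≐-sym (wedge-to0 (r , s) (good-out (good cf) (r , s) (λ (k , _) → nr k)))) (Subspace.null sub⊞)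
      ... | yes hr = wedge-dec (hr , hs)
            (λ u hu k → vanishing p cR (card-∖′ (S ∖ s) hu (card-∖′ S hs cS))
               (reduce-≤ 2 0 (arith₁ p) (arith₂ m n) h) (s≤s pm) pn' k)
            (decomposition p (card-∖′ R hr cR) (card-∖′ S hs cS)
               (reduce-≤ 2 1 (arith₃ p) (arith₄ m n) h) pm
               (≡.subst (ℕ._≤ suc n) (ℕₚ.+-comm 2 p) (s≤s pn'))
               (ι-cycle cf (r , s)))
        where
        arith₁ : ∀ p → 3 ℕ.* suc p ℕ.+ 1 ≡ (3 ℕ.* p ℕ.+ 2) ℕ.+ (2 ℕ.+ 0)
        arith₁ = solve-∀
        arith₂ : ∀ m n → suc m ℕ.+ suc (suc n) ≡ (suc m ℕ.+ n) ℕ.+ 2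
        arith₂ = solve-∀
        arith₃ : ∀ p → 3 ℕ.* suc p ℕ.+ 1 ≡ (3 ℕ.* p ℕ.+ 1) ℕ.+ (2 ℕ.+ 1)
        arith₃ = solve-∀
        arith₄ : ∀ m n → suc m ℕ.+ suc (suc n) ≡ (m ℕ.+ suc n) ℕ.+ 2
        arith₄ = solve-∀
      whole : (Good R (S ∖ s) ⊞ Decomposable R S) f
      whole = Subspace.resp sub⊞ (λ w → solve 2 (λ a b → (a :- b) :+ b := a) refl (f w) _)
        (Subspace.add sub⊞ (⊞-left (good-subspace _ _) (dec-subspace R S) (col-split (good cf) s))
                           (Subspace.sum sub⊞ (λ r → wedge (r , s) (ι (r , s) f)) piece))

  -- The recursion for Betti numbers

  ¬¬-Fin : ∀ {a k} {A : Fin k → Set a} → (∀ i → ¬ ¬ A i) → ¬ ¬ (∀ i → A i)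
  ¬¬-Fin {k = zero} h = η (λ ())
  ¬¬-Fin {k = suc k} h = h zero >>= λ a → ¬¬-Fin (λ i → h (suc i)) >>= λ as → η (λ { zero → a ; (suc i) → as i })

  ¬¬-→ : ∀ {a b} {A : Set a} {B : Set b} → Dec A → (A → ¬ ¬ B) → ¬ ¬ (A → B)
  ¬¬-→ (yes a) h = h a >>= λ b → η (λ _ → b)
  ¬¬-→ (no na) h = η (λ a → ⊥-elim (na a))

  -- Passing from a subspace of Z₀ to its intersection with Q loses at most N dimensions modulo P.
  Codim : ∀ {X : Set} → ℕ → (Z₀ Q P : (X → Carrier) → Set (c ⊔ ℓ)) → Set (Level.suc (c ⊔ ℓ))
  Codim {X} N Z₀ Q P = ∀ {K} {Z : (X → Carrier) → Set (c ⊔ ℓ)} → Subspace Z → (∀ {f} → Z f → Z₀ f) →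
    Spanned K (λ f → Z f × Q f) P → Spanned (N ℕ.+ K) Z P

  ∩-subspace : ∀ {X : Set} {Z Q : (X → Carrier) → Set (c ⊔ ℓ)} → Subspace Z → Subspace Q → Subspace (λ f → Z f × Q f)
  ∩-subspace sZ sQ = record
    { resp = λ e (z , q) → Z.resp e z , Q.resp e q
    ; null = Z.null , Q.null
    ; add = λ (z , q) (z' , q') → Z.add z z' , Q.add q q'
    ; scl = λ a (z , q) → Z.scl a z , Q.scl a q }
    where module Z = Subspace sZ
          module Q = Subspace sQ

  preimage-subspace : ∀ {X Y : Set} {φ : (X → Carrier) → Y → Carrier} → Linear φ → {B : (Y → Carrier) → Set (c ⊔ ℓ)} →
                      Subspace B → Subspace (λ f → ¬ ¬ B (φ f))
  preimage-subspace lin sB = record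
    { resp = λ e h → h >>= λ b → η (B.resp (cong lin e) b)
    ; null = η (B.resp (≐-sym (hom0 lin)) B.null)
    ; add = λ {f} {g} h k → h >>= λ b → k >>= λ b' → η (B.resp (≐-sym (hom+ lin f g)) (B.add b b'))
    ; scl = λ a {f} h → h >>= λ b → η (B.resp (≐-sym (hom* lin a f)) (B.scl a b)) }
    where module B = Subspace sB

  family-subspace : ∀ {X : Set} {k} {T : Sub k} {Q : Fin k → (X → Carrier) → Set (c ⊔ ℓ)} → (∀ i → Subspace (Q i)) →
                    Subspace (λ f → ∀ i → T i ≡ true → Q i f)
  family-subspace sQ = record
    { resp = λ e h i t → Subspace.resp (sQ i) e (h i t)
    ; null = λ i t → Subspace.null (sQ i)
    ; add = λ h k i t → Subspace.add (sQ i) (h i t) (k i t)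
    ; scl = λ a h i t → Subspace.scl (sQ i) a (h i t) }

  codim-preimage : ∀ {X Y : Set} {φ : (X → Carrier) → Y → Carrier} → Linear φ →
    {B W : (Y → Carrier) → Set (c ⊔ ℓ)} {Z₀ P : (X → Carrier) → Set (c ⊔ ℓ)} {N : ℕ} → Subspace B → Subspace P →
    (∀ {f} → Z₀ f → W (φ f)) → Spanned N W B → Codim N Z₀ (λ f → ¬ ¬ B (φ f)) P
  codim-preimage lin {W = W} sB sP ZW hW {K} {Z} sZ sub hK = extend lin sB sP {Z = Z} sZ {W = W} (λ {f} h → ZW {f} (sub {f} h)) hW hK

  -- The conditions are imposed one at a time, each on the subspace cut out by the previous ones.
  -- This is why `Codim` quantifies over all subspaces of Z₀.
  codim-family : ∀ {X : Set} {k N t} {Z₀ P : (X → Carrier) → Set (c ⊔ ℓ)} {Q : Fin k → (X → Carrier) → Set (c ⊔ ℓ)} →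
    (∀ i → Subspace (Q i)) → (T : Sub k) → card T ≡ t → (∀ i → T i ≡ true → Codim N Z₀ (Q i) P) →
    Codim (t ℕ.* N) Z₀ (λ f → ∀ i → T i ≡ true → Q i f) P
  codim-family {t = zero} sQ T cT cod sZ sub hK =
    Spanned-⊆ (λ z → z , λ i ti → ⊥-elim (card0 T cT ti)) hK
  codim-family {N = N} {suc t} {P = P} {Q} sQ T cT cod {K} {Z} sZ sub hK =
    ≡.subst (λ n → Spanned n Z P) (≡.sym (ℕₚ.+-assoc N (t ℕ.* N) K))
    (cod u hu sZ sub
      (codim-family sQ (T ∖ u) (card-∖′ T hu cT) (λ i ti → cod i (∖-⊆ T u i ti)) (∩-subspace sZ (sQ u)) (λ (z , _) → sub z)
        (Spanned-⊆ (λ ((z , qu) , qs) → z , λ i ti → pick i ti qu qs) hK)))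
    where
    u = proj₁ (choose T cT)
    hu = proj₂ (choose T cT)
    pick : ∀ i → T i ≡ true → ∀ {f} → Q u f → (∀ j → (T ∖ u) j ≡ true → Q j f) → Q i f
    pick i ti qu qs with i Finₚ.≟ u
    ... | yes ≡.refl = qu
    ... | no ne = qs i (in-∖ T ne ti)

  -- h_p(m , n) ≤ N, where h_p is the dimension of the homology in degree p - 1.
  HomLe : ℕ → ℕ → ℕ → ℕ → Set (c ⊔ ℓ)
  HomLe m n p N = ∀ {M N'} (R : Sub M) (S : Sub N') → card R ≡ m → card S ≡ n → Spanned N (Cycle R S {p}) (Bd R S {p})

  HomLe-tr : ∀ {m n p N} → HomLe m n p N → HomLe n m p N
  HomLe-tr h R S cR cS = spanned-image tr-linear (bd-subspace R S) tr-bd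
    (λ f cf → η (tr f , tr-cycle cf , BdS.resp (λ w → sym (trans (+-congˡ (-‿cong (tr-tr f w))) (-‿inverseʳ (f w)))) BdS.null))
    (h S R cS cR)

  HomLe-0 : ∀ {m n p} → (∀ {M N} {R : Sub M} {S : Sub N} {f : Ch M N p} → card R ≡ m → card S ≡ n → Cycle R S f → Bd R S f) →
            HomLe m n p 0
  HomLe-0 van R S cR cS = η ([] , ≡.refl , λ f cf → η (Level.lift (van cR cS cf)))

  idL : ∀ {X : Set} → Linear {X = X} {X} (λ f → f)
  idL = record { cong = λ e → e ; hom+ = λ _ _ _ → refl ; hom* = λ _ _ _ → refl }

  ∘-linear : ∀ {X Y W : Set} {φ : (X → Carrier) → Y → Carrier} {ψ : (Y → Carrier) → W → Carrier} →
             Linear φ → Linear ψ → Linear (λ f → ψ (φ f))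
  ∘-linear {φ = φ} lφ lψ = record
    { cong = λ e → cong lψ (cong lφ e)
    ; hom+ = λ f g → ≐-trans (cong lψ (hom+ lφ f g)) (hom+ lψ (φ f) (φ g))
    ; hom* = λ a f → ≐-trans (cong lψ (hom* lφ a f)) (hom* lψ a (φ f)) }

  -- One condition for each of the n + 1 columns, that z(r s) bounds; the cycles satisfying all of
  -- them can be pushed off row r.
  first-row : ∀ {m n p N K M N'} {R : Sub M} {S : Sub N'} → HomLe m n p N → card R ≡ suc m → card S ≡ suc n →
              ∀ r → R r ≡ true → Spanned K (Cycle (R ∖ r) S {suc p}) (Bd R S) →
              Spanned (suc n ℕ.* N ℕ.+ K) (Cycle R S {suc p}) (Bd R S)
  first-row {R = R} {S} hN cR cS r hr hK =
    codim-family (λ s → preimage-subspace (ι-linear (r , s)) (bd-subspace (R ∖ r) (S ∖ s))) S cS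
      (λ s hs → codim-preimage (ι-linear (r , s)) (bd-subspace _ _) (bd-subspace R S) (λ cf → ι-cycle cf (r , s))
         (hN (R ∖ r) (S ∖ s) (card-∖′ R hr cR) (card-∖′ S hs cS)))
      (cycle-subspace R S) (λ h → h)
      (spanned-image idL (bd-subspace R S) (λ b → b)
        (λ f (cf , hyp) → ¬¬-Fin (λ s → ¬¬-→ (S s Boolₚ.≟ true) (hyp s)) >>= λ bs → η (push-row hr cf bs)) hK)

  -- Supplies some bound at the one board for each k where the induction on Betti numbers has no
  -- predecessor. Its size only affects the constant of the error term.
  HomLe-finite : ∀ m n p → ∃[ N ] HomLe m n p N
  HomLe-finite m n zero = 1 , λ R S cR cS → η ((λ _ → 1#) ∷ [] , ≡.refl , λ f _ → η
    (f [] , Level.lift (BdS.resp (λ { [] → sym (trans (+-congˡ (-‿cong (*-identityʳ _))) (-‿inverseʳ _)) }) BdS.null)))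
  HomLe-finite zero n (suc p) = 0 , HomLe-0 (λ {_} {_} {R} cR cS cf → BdS.resp
    (λ { (e ∷ w) → sym (good-out (good cf) e (λ (h , _) → card0 R cR h) w) }) BdS.null)
  HomLe-finite (suc m) zero (suc p) = 0 , HomLe-0 (λ {_} {_} {_} {S} cR cS cf → BdS.resp
    (λ { (e ∷ w) → sym (good-out (good cf) e (λ (_ , h) → card0 S cS h) w) }) BdS.null)
  HomLe-finite (suc m) (suc n) (suc p) =
    let (N , hN) = HomLe-finite m n p ; (K , hK) = HomLe-finite m (suc n) (suc p) in
    suc n ℕ.* N ℕ.+ K , λ R S cR cS → let (r , hr) = choose R cR in
      first-row hN cR cS r hr (spanned-image idL (bd-subspace R S) (bd-mono (∖-⊆ R r) ⊆-refl)
        (λ f cf → η (f , cf , BdS.resp (λ w → sym (-‿inverseʳ (f w))) BdS.null))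
        (hK (R ∖ r) S (card-∖′ R hr cR) cS))

  avoid-col : ∀ {M N} {R : Sub M} {S : Sub N} {p} {f : Ch M N (suc p)} s → Good R S f →
              (∀ r → ι (r , s) f ≐ 𝟘) → Good R (S ∖ s) f
  avoid-col {f = f} s gf z = GoodS.resp (tr-tr f) (tr-good (avoid-row s (tr-good gf) (λ r w → z r _)))

  ediff : ∀ {M N p} → Edge M N → Edge M N → Ch M N p → Ch M N (suc p)
  ediff e e' y = wedge e y ⊖ wedge e' y

  ediff-linear : ∀ {M N p} e e' → Linear (ediff {M} {N} {p} e e')
  ediff-linear e e' = record
    { cong = λ h w → +-cong (cong L h w) (-‿cong (cong L' h w))
    ; hom+ = λ f g w → trans (+-cong (hom+ L f g w) (-‿cong (hom+ L' f g w)))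
        (solve 4 (λ a b c d → (a :+ b) :- (c :+ d) := (a :- c) :+ (b :- d)) refl _ _ _ _)
    ; hom* = λ a f w → trans (+-cong (hom* L a f w) (-‿cong (hom* L' a f w)))
        (solve 3 (λ a x y → a :* x :- a :* y := a :* (x :- y)) refl _ _ _) }
    where L = wedge-linear e
          L' = wedge-linear e'

  rdiff : ∀ {M N p} → Fin M → Fin N → Fin N → Ch M N p → Ch M N (suc p)
  rdiff r s s' = ediff (r , s) (r , s')

  rdiff-linear : ∀ {M N p} r s s' → Linear (rdiff {M} {N} {p} r s s')
  rdiff-linear r s s' = ediff-linear (r , s) (r , s')

  module _ {M N} {R : Sub M} {S : Sub N} {r s s'} (hr : R r ≡ true) (hs : S s ≡ true) (hs' : (S ∖ s) s' ≡ true) where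
    private
      hS' = proj₂ (∖-in S hs')
      s∈S∖s' : (S ∖ s') s ≡ true
      s∈S∖s' = in-∖ S (λ eq → proj₁ (∖-in S hs') (≡.sym eq)) hs

    rdiff-good : ∀ {p} {y : Ch M N p} → Good (R ∖ r) (S ∖ s ∖ s') y → Good R S (rdiff r s s' y)
    rdiff-good gy = GoodS.sub (wedge-good (r , s) (hr , hs) (good-mono ⊆-refl (∖-⊆ (S ∖ s) s') gy))
      (wedge-good (r , s') (hr , hS') (good-mono ⊆-refl (∖-mono s' (∖-⊆ S s)) gy))

    rdiff-cycle : ∀ {p} {y : Ch M N p} → Cycle (R ∖ r) (S ∖ s ∖ s') y → Cycle R S (rdiff r s s' y)
    rdiff-cycle {y = y} (cycle gy cy) = cycle (rdiff-good gy)
      (λ w → trans (hom- ∂-linear (wedge (r , s) y) (wedge (r , s') y) w)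
        (trans (+-cong (∂-wedge-cyc (r , s) cy w) (-‿cong (∂-wedge-cyc (r , s') cy w))) (-‿inverseʳ _)))

    rdiff-bd : ∀ {p} {y : Ch M N p} → Bd (R ∖ r) (S ∖ s ∖ s') y → Bd R S (rdiff r s s' y)
    rdiff-bd {y = y} (bd h gh q) = BdS.resp
      (λ w → begin
        - ∂ (rdiff r s s' h) w
          ≈⟨ -‿cong (trans (hom- ∂-linear (wedge (r , s) h) (wedge (r , s') h) w) (+-cong (∂-wedge (r , s) h w) (-‿cong (∂-wedge (r , s') h w)))) ⟩
        - ((h w + - wedge (r , s) (∂ h) w) + - (h w + - wedge (r , s') (∂ h) w))
          ≈⟨ solve 3 (λ h a b → :- ((h :- a) :- (h :- b)) := a :- b) refl _ _ _ ⟩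
        rdiff r s s' (∂ h) w
          ≈⟨ cong (rdiff-linear r s s') (≐-sym q) w ⟩
        rdiff r s s' y w ∎)
      (BdS.negate (∂-bd (rdiff-good gh)))
      where open ≈-R

    -- Chains that can be split for the two cones, up to boundaries and a correction in G. The
    -- correction is itself a boundary in the recursion, and lies in the span of two explicit
    -- classes for the 3 × 4 board.
    Joined : ∀ {p} → (Ch M N (suc p) → Set (c ⊔ ℓ)) → Ch M N (suc p) → Set (c ⊔ ℓ)
    Joined G = G ⊞ Good (R ∖ r) (S ∖ s') ⊞ Good (R ∖ r) (S ∖ s) ⊞ Bd R S

    -- If x = P + P' with P avoiding s' and P' avoiding s, coning P with e_{r s'} and P' with e_{r s}
    -- leaves (e_{r s'} - e_{r s}) ∧ ∂P, because ∂P' = - ∂P.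
    join-split : ∀ {p} {G : Ch M N (suc p) → Set (c ⊔ ℓ)} {x : Ch M N (suc p)} → Cycle R S x → (∀ {g} → G g → Cycle R S g) →
      Joined G x →
      ∃[ g ] ∃[ y ] (G g × Cycle (R ∖ r) (S ∖ s ∖ s') y × Bd R S ((x ⊖ g) ⊖ rdiff r s s' y))
    join-split {p} {G} {x} cx GC (g , gg , P , gP , P' , gP' , b) = g , y , gg , cycle gy (cy p P gP) ,
      BdS.resp pointwise
        (BdS.add b (BdS.add (∂-bd (wedge-good (r , s') (hr , hS') gP)) (∂-bd (wedge-good (r , s) (hr , hs) gP'))))
      where
      open ≈-R
      y : Ch M N p
      y = neg (∂ P)
      b' = ((x ⊖ g) ⊖ P) ⊖ P'
      -- In x - g = P + P' + b' the chains x, g and b' are cycles, so only the boundaries of P and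
      -- P' survive.
      ∂P' : ∂ P' ≐ neg (∂ P)
      ∂P' w = begin
        ∂ P' w
          ≈⟨ solve 4 (λ x g p q → q := (((x :- g) :- (((x :- g) :- p) :- q)) :- p)) refl (∂ x w) (∂ g w) (∂ P w) (∂ P' w) ⟩
        ((∂ x w + - ∂ g w) + - (((∂ x w + - ∂ g w) + - ∂ P w) + - ∂ P' w)) + - ∂ P w
          ≈⟨ +-congʳ (+-cong (trans (+-cong (cyc cx w) (neg-0 (cyc (GC gg) w))) (+-identityʳ 0#)) (neg-0 (trans (sym expand) (cyc (bd-cycle b) w)))) ⟩
        (0# + 0#) + - ∂ P w ≈⟨ trans (+-congʳ (+-identityʳ 0#)) (+-identityˡ _) ⟩
        - ∂ P w ∎
        where
        expand : ∂ b' w ≈ ((∂ x w + - ∂ g w) + - ∂ P w) + - ∂ P' w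
        expand = trans (hom- ∂-linear ((x ⊖ g) ⊖ P) P' w) (+-congʳ (trans (hom- ∂-linear (x ⊖ g) P w) (+-congʳ (hom- ∂-linear x g w))))
      -- ∂P avoids s', and as -∂P' it avoids s as well.
      gy : Good (R ∖ r) (S ∖ s ∖ s') y
      gy = inter p y (GoodS.negate (∂-good gP)) (GoodS.resp ∂P' (∂-good gP'))
        where
        inter : ∀ p (y : Ch M N p) → Good (R ∖ r) (S ∖ s') y → Good (R ∖ r) (S ∖ s) y → Good (R ∖ r) (S ∖ s ∖ s') y
        inter zero y _ _ = g0
        inter (suc p) y k k' = avoid-col s' k' (λ t → good-out k (t , s') (λ (_ , h) → proj₁ (∖-in S h) ≡.refl))
      cy : ∀ p (P : Ch M N (suc p)) → Good (R ∖ r) (S ∖ s') P → Cyc (neg (∂ P))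
      cy zero P _ = tt
      cy (suc p) P gP w = trans (hom-neg ∂-linear (∂ P) w) (neg-0 (∂∂ gP w))
      pointwise : b' ⊕ (∂ (wedge (r , s') P) ⊕ ∂ (wedge (r , s) P')) ≐ (x ⊖ g) ⊖ rdiff r s s' y
      pointwise w = begin
        b' w + (∂ (wedge (r , s') P) w + ∂ (wedge (r , s) P') w)
          ≈⟨ +-congˡ (+-cong (∂-wedge (r , s') P w) (trans (∂-wedge (r , s) P' w)
                (+-congˡ (-‿cong (cong (wedge-linear (r , s)) ∂P' w))))) ⟩
        b' w + ((P w + - wedge (r , s') (∂ P) w) + (P' w + - wedge (r , s) y w))
          ≈⟨ +-congˡ (+-congʳ (+-congˡ (-‿cong (trans
               (solve 1 (λ a → a := :- (:- a)) refl _) (-‿cong (sym (hom-neg (wedge-linear (r , s')) (∂ P) w))))))) ⟩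
        b' w + ((P w + - - wedge (r , s') y w) + (P' w + - wedge (r , s) y w))
          ≈⟨ solve 5 (λ xg p q u v → ((xg :- p) :- q) :+ ((p :- (:- u)) :+ (q :- v)) := xg :- (v :- u)) refl
               ((x ⊖ g) w) (P w) (P' w) (wedge (r , s') y w) (wedge (r , s) y w) ⟩
        (x ⊖ g) w + - (wedge (r , s) y w + - wedge (r , s') y w) ∎

    module _ {p} {G : Ch M N (suc p) → Set (c ⊔ ℓ)} (sG : Subspace G) where
      private
        s₁ = good-subspace (R ∖ r) (S ∖ s')
        s₂ = good-subspace (R ∖ r) (S ∖ s)
        s₂₃ = ⊞-subspace s₂ (bd-subspace R S {suc p})
        s₁₂₃ = ⊞-subspace s₁ s₂₃

      joined-subspace : Subspace (Joined G)
      joined-subspace = ⊞-subspace sG s₁₂₃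

      joined-G : ∀ {f} → G f → Joined G f
      joined-G h = ⊞-left sG s₁₂₃ h

      joined₁ : ∀ {f} → Good (R ∖ r) (S ∖ s') f → Joined G f
      joined₁ h = ⊞-right sG s₁₂₃ (⊞-left s₁ s₂₃ h)

      joined₂ : ∀ {f} → Good (R ∖ r) (S ∖ s) f → Joined G f
      joined₂ h = ⊞-right sG s₁₂₃ (⊞-right s₁ s₂₃ (⊞-left s₂ (bd-subspace R S) h))

      joined-bd : ∀ {f} → Bd R S f → Joined G f
      joined-bd h = ⊞-right sG s₁₂₃ (⊞-right s₁ s₂₃ (⊞-right s₂ (bd-subspace R S) h))

      split-col : ∀ {x} → Cycle (R ∖ r) S x →
        (∀ t → (R ∖ r) t ≡ true → Joined G (wedge (t , s) (ι (t , s) x))) → Joined G x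
      split-col {x} cx hyp = Subspace.resp joined-subspace (λ w → solve 2 (λ a b → (a :- b) :+ b := a) refl (x w) _)
        (Subspace.add joined-subspace (joined₂ (col-split (good cx) s))
          (Subspace.sum joined-subspace (λ t → wedge (t , s) (ι (t , s) x)) piece))
        where
        piece : ∀ t → Joined G (wedge (t , s) (ι (t , s) x))
        piece t with (R ∖ r) t Boolₚ.≟ true
        ... | yes ht = hyp t ht
        ... | no nt = Subspace.resp joined-subspace (≐-sym (wedge-to0 (t , s) (good-out (good cx) (t , s) (λ (h , _) → nt h))))
                        (Subspace.null joined-subspace)

      wedge-joined₁ : ∀ {t} {a : Ch M N p} → (R ∖ r) t ≡ true → Good (R ∖ r ∖ t) (S ∖ s ∖ s') a → Joined G (wedge (t , s) a)
      wedge-joined₁ ht ga = joined₁ (wedge-good _ (ht , s∈S∖s') (good-mono ⊆-refl (∖-swap S s s') ga))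

    module _ {p} {G : Ch M N (suc (suc p)) → Set (c ⊔ ℓ)} (sG : Subspace G) where
      -- Terms that miss s or s' are admissible as they stand; only words meeting both columns
      -- remain to be treated.
      split-cols : ∀ {x} → Cycle (R ∖ r) S x →
        (∀ t → (R ∖ r) t ≡ true → ∀ u → (R ∖ r ∖ t) u ≡ true →
           Joined G (wedge (t , s) (wedge (u , s') (ι (u , s') (ι (t , s) x))))) → Joined G x
      split-cols {x} cx hyp = split-col sG cx column
        where
        column : ∀ t → (R ∖ r) t ≡ true → Joined G (wedge (t , s) (ι (t , s) x))
        column t ht = Subspace.resp (joined-subspace sG)
          (λ w → trans (sym (trans (hom+ L (a ⊖ colPart s' a) (colPart s' a) w) (+-congˡ (homΣ L (λ u → wedge (u , s') (ι (u , s') a)) w))))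
                       (cong L (λ w → solve 2 (λ a b → (a :- b) :+ b := a) refl (a w) (colPart s' a w)) w))
          (Subspace.add (joined-subspace sG) (wedge-joined₁ sG ht (col-split (good-ι (good cx) (t , s)) s'))
            (Subspace.sum (joined-subspace sG) (λ u → wedge (t , s) (wedge (u , s') (ι (u , s') a))) piece))
          where
          L = wedge-linear (t , s)
          a = ι (t , s) x
          piece : ∀ u → Joined G (wedge (t , s) (wedge (u , s') (ι (u , s') a)))
          piece u with (R ∖ r ∖ t) u Boolₚ.≟ true
          ... | yes hu = hyp t ht u hu
          ... | no nu = Subspace.resp (joined-subspace sG)
                 (≐-sym (wedge-to0 (t , s) (wedge-to0 (u , s') (good-out (good-ι (good cx) (t , s)) (u , s') (λ (h , _) → nu h)))))
                 (Subspace.null (joined-subspace sG))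

      -- e e' ∂g = ∂(e e' g) - e' g + e g
      bd-joined : ∀ {t u} {f : Ch M N p} → (R ∖ r) t ≡ true → (R ∖ r ∖ t) u ≡ true → Bd (R ∖ r ∖ t ∖ u) (S ∖ s ∖ s') f →
                  Joined G (wedge (t , s) (wedge (u , s') f))
      bd-joined {t} {u} {f} ht hu (bd g gg q) = Subspace.resp (joined-subspace sG) pointwise
        (Subspace.add (joined-subspace sG)
          (joined-bd sG (∂-bd (wedge-good (t , s) (proj₂ (∖-in R ht) , hs) (good-mono (∖-mono t (∖-⊆ R r)) ⊆-refl eg'))))
          (Subspace.sub (joined-subspace sG)
            (wedge-joined₁ sG ht (good-mono (∖-⊆ (R ∖ r ∖ t) u) ⊆-refl gg))
            (joined₂ sG (good-mono (∖-⊆ (R ∖ r) t) ⊆-refl eg'))))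
        where
        open ≈-R
        e = (t , s)
        e' = (u , s')
        eg' : Good (R ∖ r ∖ t) (S ∖ s) (wedge e' g)
        eg' = wedge-good e' (hu , hs') gg
        pointwise : ∂ (wedge e (wedge e' g)) ⊕ (wedge e g ⊖ wedge e' g) ≐ wedge e (wedge e' f)
        pointwise w = begin
          ∂ (wedge e (wedge e' g)) w + (wedge e g w + - wedge e' g w)
            ≈⟨ +-congʳ (trans (∂-wedge e (wedge e' g) w) (+-congˡ (-‿cong (trans (cong (wedge-linear e) (∂-wedge e' g) w)
                  (hom- (wedge-linear e) g (wedge e' (∂ g)) w))))) ⟩
          (wedge e' g w + - (wedge e g w + - wedge e (wedge e' (∂ g)) w)) + (wedge e g w + - wedge e' g w)
            ≈⟨ solve 3 (λ a b c → (a :- (b :- c)) :+ (b :- a) := c) refl _ _ _ ⟩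
          wedge e (wedge e' (∂ g)) w
            ≈⟨ cong (wedge-linear e) (cong (wedge-linear e') (≐-sym q)) w ⟩
          wedge e (wedge e' f) w ∎

  module _ {M N'} {R : Sub M} {S : Sub N'} {r s s'} (hr : R r ≡ true) (hs : S s ≡ true) (hs' : (S ∖ s) s' ≡ true) {p : ℕ} where
    private
      X : Ch M N' (2 ℕ.+ p) → Set (c ⊔ ℓ)
      X = Cycle (R ∖ r) S

      Q : ∀ t u → Ch M N' (2 ℕ.+ p) → Set (c ⊔ ℓ)
      Q t u x = ¬ ¬ Bd (R ∖ r ∖ t ∖ u) (S ∖ s ∖ s') (ι (u , s') (ι (t , s) x))

      Q′ : ∀ t → Ch M N' (2 ℕ.+ p) → Set (c ⊔ ℓ)
      Q′ t x = ∀ u → (R ∖ r ∖ t) u ≡ true → Q t u x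

      φL : ∀ t u → Linear (λ (x : Ch M N' (2 ℕ.+ p)) → ι (u , s') (ι (t , s) x))
      φL t u = ∘-linear (ι-linear (t , s)) (ι-linear (u , s'))

      sQ : ∀ t u → Subspace (Q t u)
      sQ t u = preimage-subspace (φL t u) (bd-subspace (R ∖ r ∖ t ∖ u) (S ∖ s ∖ s'))

      gather : ∀ x → (∀ t → (R ∖ r) t ≡ true → Q′ t x) →
               ¬ ¬ (∀ t → (R ∖ r) t ≡ true → ∀ u → (R ∖ r ∖ t) u ≡ true → Bd (R ∖ r ∖ t ∖ u) (S ∖ s ∖ s') (ι (u , s') (ι (t , s) x)))
      gather x hyp = ¬¬-Fin {A = λ t → (R ∖ r) t ≡ true → A t} (λ t → ¬¬-→ {B = A t} ((R ∖ r) t Boolₚ.≟ true) (λ ht →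
        ¬¬-Fin {A = λ u → (R ∖ r ∖ t) u ≡ true → B t u} (λ u → ¬¬-→ {B = B t u} ((R ∖ r ∖ t) u Boolₚ.≟ true) (λ hu → hyp t ht u hu))))
        where
        B : ∀ t u → Set (c ⊔ ℓ)
        B t u = Bd (R ∖ r ∖ t ∖ u) (S ∖ s ∖ s') (ι (u , s') (ι (t , s) x))
        A : ∀ t → Set (c ⊔ ℓ)
        A t = ∀ u → (R ∖ r ∖ t) u ≡ true → B t u

      cover : ∀ x → X x × (∀ t → (R ∖ r) t ≡ true → Q′ t x) →
              ¬ ¬ (∃[ y ] (Cycle (R ∖ r) (S ∖ s ∖ s') y × Bd R S (x ⊖ rdiff r s s' y)))
      cover x (cx , hyp) = gather x hyp >>= λ bs → η (absorb
        (join-split hr hs hs' {G = Bd R S} (cycle-mono (∖-⊆ R r) ⊆-refl cx) bd-cycle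
          (split-cols hr hs hs' {G = Bd R S} (bd-subspace R S) cx
            (λ t ht u hu → bd-joined hr hs hs' {G = Bd R S} (bd-subspace R S) ht hu (bs t ht u hu)))))
        where
        absorb : ∃[ g ] ∃[ y ] (Bd R S g × Cycle (R ∖ r) (S ∖ s ∖ s') y × Bd R S ((x ⊖ g) ⊖ rdiff r s s' y)) →
                 ∃[ y ] (Cycle (R ∖ r) (S ∖ s ∖ s') y × Bd R S (x ⊖ rdiff r s s' y))
        absorb (g , y , bg , cy , b) = y , cy ,
          BdS.resp (λ w → solve 3 (λ x g d → ((x :- g) :- d) :+ g := x :- d) refl (x w) (g w) (rdiff r s s' y w)) (BdS.add b bg)

    -- There is one condition for each ordered pair of distinct rows t, u other than r: the
    -- coefficient of e_{ts} e_{us'} bounds. Under all of them `cover` leaves a class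
    -- `rdiff r s s' y`, counted by the cycles y on the board without r, s and s'.
    second-rows : ∀ {m n N₂ K} → HomLe m n p N₂ → card (R ∖ r) ≡ 2 ℕ.+ m → card (S ∖ s ∖ s') ≡ n →
      Spanned K (Cycle (R ∖ r) (S ∖ s ∖ s') {suc p}) (Bd (R ∖ r) (S ∖ s ∖ s')) →
      Spanned ((2 ℕ.+ m) ℕ.* ((1 ℕ.+ m) ℕ.* N₂) ℕ.+ K) X (Bd R S)
    second-rows {m} {n} {N₂} h₂ cR' cS' h₃ =
      codim-family {Z₀ = X} {Bd R S} {Q = Q′} (λ t → family-subspace (λ u → sQ t u)) (R ∖ r) cR' inner
        (cycle-subspace (R ∖ r) S) (λ h → h)
        (spanned-image {ψ = rdiff r s s'} (rdiff-linear r s s') (bd-subspace R S) {V = Cycle (R ∖ r) (S ∖ s ∖ s')}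
          (rdiff-bd hr hs hs') cover h₃)
      where
      inner : ∀ t → (R ∖ r) t ≡ true → Codim ((1 ℕ.+ m) ℕ.* N₂) X (Q′ t) (Bd R S)
      inner t ht = codim-family {Z₀ = X} {Bd R S} {Q = Q t} (λ u → sQ t u) (R ∖ r ∖ t) (card-∖′ (R ∖ r) ht cR')
          (λ u hu → codim-preimage (φL t u) {W = Cycle (R ∖ r ∖ t ∖ u) (S ∖ s ∖ s')} (bd-subspace _ _) (bd-subspace R S)
             (λ cf → ι-cycle (ι-cycle cf (t , s)) (u , s'))
             (h₂ (R ∖ r ∖ t ∖ u) (S ∖ s ∖ s') (card-∖′ (R ∖ r ∖ t) hu (card-∖′ (R ∖ r) ht cR')) cS'))

  HomLe-step : ∀ {m n p N₁ N₂ N₃} → HomLe (2 ℕ.+ m) (suc n) (suc p) N₁ → HomLe m n p N₂ → HomLe (2 ℕ.+ m) n (suc p) N₃ →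
    HomLe (3 ℕ.+ m) (2 ℕ.+ n) (2 ℕ.+ p) ((2 ℕ.+ n) ℕ.* N₁ ℕ.+ ((2 ℕ.+ m) ℕ.* ((1 ℕ.+ m) ℕ.* N₂) ℕ.+ N₃))
  HomLe-step h₁ h₂ h₃ R S cR cS =
    let (r , hr) = choose R cR
        (s , hs) = choose S cS
        (s' , hs') = choose (S ∖ s) (card-∖′ S hs cS)
        cR' = card-∖′ R hr cR
        cS' = card-∖′ (S ∖ s) hs' (card-∖′ S hs cS)
    in first-row h₁ cR cS r hr (second-rows hr hs hs' h₂ cR' cS' (h₃ (R ∖ r) (S ∖ s ∖ s') cR' cS'))

  -- The complex M_{5,5}

  -- A repetition-free list of elements of R, in the nested form in which the lemmas on successively
  -- smaller boards take their hypotheses.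
  Chain : ∀ {M} → Sub M → List (Fin M) → Set
  Chain R [] = Unit
  Chain R (x ∷ xs) = R x ≡ true × Chain (R ∖ x) xs

  chain-mono : ∀ {M} {R R' : Sub M} → R ⊆ R' → ∀ xs → Chain R xs → Chain R' xs
  chain-mono sub [] _ = _
  chain-mono sub (x ∷ xs) (h , hs) = sub x h , chain-mono (∖-mono x sub) xs hs

  chain-swap : ∀ {M} {R : Sub M} x y {xs} → Chain R (x ∷ y ∷ xs) → Chain R (y ∷ x ∷ xs)
  chain-swap {R = R} x y (hx , hy , hs) =
    proj₂ (∖-in R hy) , in-∖ R (λ eq → proj₁ (∖-in R hy) (≡.sym eq)) hx , chain-mono (∖-swap R x y) _ hs

  chain-cons : ∀ {M} {R : Sub M} x {xs ys} → (∀ {R'} → Chain R' xs → Chain R' ys) → Chain R (x ∷ xs) → Chain R (x ∷ ys)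
  chain-cons x f (h , hs) = h , f hs

  choose-chain : ∀ {M} {R : Sub M} n → card R ≡ n → ∃[ v ] (Chain R (Vec.toList {n = n} v))
  choose-chain zero _ = [] , _
  choose-chain {R = R} (suc n) cR =
    let (x , hx) = choose R cR ; (v , ch) = choose-chain {R = R ∖ x} n (card-∖′ R hx cR) in x ∷ v , hx , ch

  𝟙 : ∀ {M N} → Ch M N 0
  𝟙 _ = 1#

  scalar : ∀ {M N} (y : Ch M N 0) → y ≐ y [] ⊙ 𝟙
  scalar y [] = sym (*-identityʳ (y []))

  cdiff : ∀ {M N p} → Fin M → Fin M → Fin N → Ch M N p → Ch M N (suc p)
  cdiff r r' s = ediff (r , s) (r' , s)

  cdiff-linear : ∀ {M N p} r r' s → Linear (cdiff {M} {N} {p} r r' s)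
  cdiff-linear r r' s = ediff-linear (r , s) (r' , s)

  tr-rdiff : ∀ {M N p} (r : Fin M) (s s' : Fin N) (y : Ch M N p) → tr (rdiff r s s' y) ≐ cdiff s s' r (tr y)
  tr-rdiff r s s' y w = +-cong (tr-wedge (r , s) y w) (-‿cong (tr-wedge (r , s') y w))

  module _ {M N} {R : Sub M} {S : Sub N} {r r' s} (hr : R r ≡ true) (hr' : (R ∖ r) r' ≡ true) (hs : S s ≡ true) where
    cdiff-bd : ∀ {p} {y : Ch M N p} → Bd (R ∖ r ∖ r') (S ∖ s) y → Bd R S (cdiff r r' s y)
    cdiff-bd {y = y} by = BdS.resp (≐-trans (tr-rdiff s r r' (tr y)) (cong (cdiff-linear r r' s) (tr-tr y))) (tr-bd (rdiff-bd hs hr hr' (tr-bd by)))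

  -- The difference of the two sides bounds e_{r s'} ∧ e_{r' s} ∧ y.
  rdiff~cdiff : ∀ {M N} {R : Sub M} {S : Sub N} {r r' s s' p} {y : Ch M N p} →
    R r ≡ true → (R ∖ r) r' ≡ true → S s ≡ true → (S ∖ s) s' ≡ true →
    Cycle (R ∖ r ∖ r') (S ∖ s ∖ s') y → Bd R S (rdiff r s s' y ⊖ cdiff r r' s y)
  rdiff~cdiff {R = R} {S} {r} {r'} {s} {s'} {p} {y} hr hr' hs hs' cy =
    BdS.resp pointwise (∂-bd {h = wedge e (wedge e' y)} (wedge-good e (hr , proj₂ (∖-in S hs')) ge'y))
    where
    open ≈-R
    e = (r , s')
    e' = (r' , s)
    ge'y : Good (R ∖ r) (S ∖ s') (wedge e' y)
    ge'y = wedge-good e' (hr' , in-∖ S (λ eq → proj₁ (∖-in S hs') (≡.sym eq)) hs) (good-mono ⊆-refl (∖-swap S s s') (good cy))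
    pointwise : ∂ (wedge e (wedge e' y)) ≐ rdiff r s s' y ⊖ cdiff r r' s y
    pointwise w = begin
      ∂ (wedge e (wedge e' y)) w ≈⟨ ∂-wedge e (wedge e' y) w ⟩
      wedge e' y w + - wedge e (∂ (wedge e' y)) w ≈⟨ +-congˡ (-‿cong (cong (wedge-linear e) (∂-wedge-cyc e' (cyc cy)) w)) ⟩
      wedge e' y w + - wedge e y w
        ≈⟨ solve 3 (λ a b c → a :- b := (c :- b) :- (c :- a)) refl _ _ (wedge (r , s) y w) ⟩
      rdiff r s s' y w + - cdiff r r' s y w ∎

  ediff-anti : ∀ {M N p} a b c' d (y : Ch M N p) → ediff a b (ediff c' d y) ≐ neg (ediff c' d (ediff a b y))
  ediff-anti a b c' d y w = begin
    ediff a b (ediff c' d y) w ≈⟨ +-cong (expand a c' d) (-‿cong (expand b c' d)) ⟩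
    (W a c' + - W a d) + - (W b c' + - W b d)
      ≈⟨ +-cong (+-cong (wa _ _) (-‿cong (wa _ _))) (-‿cong (+-cong (wa _ _) (-‿cong (wa _ _)))) ⟩
    (- W c' a + - - W d a) + - (- W c' b + - - W d b)
      ≈⟨ solve 4 (λ p q r s → (:- p :- (:- q)) :- (:- r :- (:- s)) := :- ((p :- r) :- (q :- s))) refl _ _ _ _ ⟩
    - ((W c' a + - W c' b) + - (W d a + - W d b))
      ≈⟨ -‿cong (+-cong (sym (expand c' a b)) (-‿cong (sym (expand d a b)))) ⟩
    - ediff c' d (ediff a b y) w ∎
    where
    open ≈-R
    W = λ e e' → wedge e (wedge e' y) w
    wa : ∀ e e' → W e e' ≈ - W e' e
    wa e e' = wedge-anti e e' y w
    expand : ∀ e e' e'' → wedge e (ediff e' e'' y) w ≈ W e e' + - W e e''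
    expand e e' e'' = hom- (wedge-linear e) (wedge e' y) (wedge e'' y) w

  record State (M N : ℕ) : Set where
    constructor state
    field i j k m l : Fin M
          e a b s t : Fin N

  rows : ∀ {M N} → State M N → List (Fin M)
  rows (state i j k m l _ _ _ _ _) = i ∷ j ∷ k ∷ m ∷ l ∷ []

  cols : ∀ {M N} → State M N → List (Fin N)
  cols (state _ _ _ _ _ e a b s t) = e ∷ a ∷ b ∷ s ∷ t ∷ []

  -- The row m is not used, so that row differences may be traded for column differences.
  class : ∀ {M N} → State M N → Ch M N 3
  class (state i j k m l e a b s t) = cdiff i j e (rdiff k a b (rdiff l s t 𝟙))

  𝟙-cycle : ∀ {M N} {R : Sub M} {S : Sub N} → Cycle R S 𝟙
  𝟙-cycle = cycle g0 tt

  -- `trade` exchanges the column difference with the first row difference through the spare row,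
  -- `reorder` swaps the two row differences, `flip` swaps the two columns of the first one, and
  -- `shift` moves it to the spare row.
  data Move : Set where trade reorder flip shift : Move

  apply : ∀ {M N} → Move → State M N → State M N
  apply trade (state i j k m l e a b s t) = state k m i j l a e b s t
  apply reorder (state i j k m l e a b s t) = state i j l m k e s t a b
  apply flip (state i j k m l e a b s t) = state i j k m l e b a s t
  apply shift (state i j k m l e a b s t) = state i j m k l e a b s t

  module _ {M N} {R : Sub M} {S : Sub N} where
    private
      ≐-neg : ∀ {p} {f g : Ch M N p} → f ≐ neg g → Bd R S (f ⊕ g)
      ≐-neg e = BdS.resp (λ w → sym (trans (+-congʳ (e w)) (-‿inverseˡ _))) BdS.null

    move-rows : ∀ mv (x : State M N) → Chain R (rows x) → Chain R (rows (apply mv x))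
    move-rows trade (state i j k m l _ _ _ _ _) =
      λ ch → chain-cons k (chain-swap i m) (chain-swap i k (chain-cons i (chain-cons k (chain-swap j m)) (chain-cons i (chain-swap j k) ch)))
    move-rows reorder (state i j k m l _ _ _ _ _) = chain-cons i (chain-cons j
      (λ ch → chain-cons l (chain-swap k m) (chain-swap k l (chain-cons k (chain-swap m l) ch))))
    move-rows flip (state i j k m l _ _ _ _ _) = λ ch → ch
    move-rows shift (state i j k m l _ _ _ _ _) = chain-cons i (chain-cons j (chain-swap k m))

    move-cols : ∀ mv (x : State M N) → Chain S (cols x) → Chain S (cols (apply mv x))
    move-cols trade (state _ _ _ _ _ e a b s t) = chain-swap e a
    move-cols reorder (state _ _ _ _ _ e a b s t) = chain-cons e
      (λ ch → chain-cons s (chain-swap a t) (chain-swap a s (chain-cons a (chain-cons s (chain-swap b t)) (chain-cons a (chain-swap b s) ch))))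
    move-cols flip (state _ _ _ _ _ e a b s t) = chain-cons e (chain-swap a b)
    move-cols shift (state _ _ _ _ _ e a b s t) = λ ch → ch

    -- Every move changes the sign of the class up to a boundary. For `reorder` and `flip` this is
    -- anticommutation. `trade` applies `rdiff~cdiff` before and after exchanging two factors;
    -- `shift` applies it in rows k and m, where the two column differences are opposite.
    move-class : ∀ mv (x : State M N) → Chain R (rows x) → Chain S (cols x) → Bd R S (class x ⊕ class (apply mv x))
    move-class trade x@(state i j k m l e a b s t) cr@(hi , hj , hk , hm , hl , _) cc@(he , ha , hb , hs , ht , _)
      with move-rows trade x cr | move-cols trade x cc
    ... | hk' , hm' , hi' , hj' , hl' , _ | ha' , he' , hb' , hs' , ht' , _ =
      BdS.resp (λ w → trans
          (+-cong (hom- (cdiff-linear i j e) (rdiff k a b y) (cdiff k m a y) w) (trans (hom- (cdiff-linear k m a) (rdiff i e b y) (cdiff i j e y) w)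
             (+-congˡ (sym (ediff-anti (i , e) (j , e) (k , a) (m , a) y w)))))
          (solve 3 (λ x y z → (x :- y) :+ (z :+ y) := x :+ z) refl _ _ _))
        (BdS.add (cdiff-bd hi hj he (rdiff~cdiff hk hm ha hb cy))
                 (cdiff-bd hk' hm' ha' (rdiff~cdiff hi' hj' he' hb' cy')))
      where
      y = rdiff l s t 𝟙
      cy : Cycle (R ∖ i ∖ j ∖ k ∖ m) (S ∖ e ∖ a ∖ b) y
      cy = rdiff-cycle hl hs ht 𝟙-cycle
      cy' : Cycle (R ∖ k ∖ m ∖ i ∖ j) (S ∖ a ∖ e ∖ b) y
      cy' = rdiff-cycle hl' hs' ht' 𝟙-cycle
    move-class reorder (state i j k m l e a b s t) _ _ = ≐-neg (λ w → trans
      (cong (cdiff-linear i j e) (ediff-anti (k , a) (k , b) (l , s) (l , t) 𝟙) w) (hom-neg (cdiff-linear i j e) (rdiff l s t (rdiff k a b 𝟙)) w))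
    move-class flip (state i j k m l e a b s t) _ _ = ≐-neg (λ w → trans
      (cong (cdiff-linear i j e) {g = neg (rdiff k b a (rdiff l s t 𝟙))} (λ w → solve 2 (λ x y → x :- y := :- (y :- x)) refl _ _) w)
      (hom-neg (cdiff-linear i j e) (rdiff k b a (rdiff l s t 𝟙)) w))
    move-class shift x@(state i j k m l e a b s t) cr@(hi , hj , hk , hm , hl , _) (he , ha , hb , hs , ht , _)
      with move-rows shift x cr
    ... | _ , _ , hm' , hk' , hl' , _ =
      BdS.resp (hom+ (cdiff-linear i j e) (rdiff k a b y) (rdiff m a b y))
        (cdiff-bd hi hj he (BdS.resp
          (λ w → solve 4 (λ x y u v → (x :- (u :- v)) :+ (y :- (v :- u)) := x :+ y) refl
             (rdiff k a b y w) (rdiff m a b y w) (wedge (k , a) y w) (wedge (m , a) y w))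
          (BdS.add (rdiff~cdiff hk hm ha hb (rdiff-cycle hl hs ht 𝟙-cycle))
                   (rdiff~cdiff hm' hk' ha hb (rdiff-cycle hl' hs ht 𝟙-cycle)))))
      where y = rdiff l s t 𝟙

    moves : List Move → State M N → State M N
    moves [] x = x
    moves (mv ∷ ms) x = moves ms (apply mv x)

    moves-class : ∀ ms (x : State M N) → Chain R (rows x) → Chain S (cols x) → In (Bd R S) (class (moves ms x) ∷ []) (class x)
    moves-class [] x cr cc = 1# , Level.lift (BdS.resp (λ w → sym (trans (+-congˡ (-‿cong (*-identityˡ _))) (-‿inverseʳ _))) BdS.null)
    moves-class (mv ∷ ms) x cr cc with moves-class ms (apply mv x) (move-rows mv x cr) (move-cols mv x cc)
    ... | (a , Level.lift h) = - a , Level.lift (BdS.resp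
            (λ w → solve 4 (λ x y a z → (x :+ y) :- (y :- a :* z) := x :- (:- a) :* z) refl
               (class x w) (class (apply mv x) w) a (class (moves ms (apply mv x)) w))
            (BdS.sub (move-class mv x cr cc) h))

  In-cycle : ∀ {M N} {R : Sub M} {S : Sub N} {p} {L : List (Ch M N p)} {f : Ch M N p} → All (Cycle R S) L → In (Bd R S) L f → Cycle R S f
  In-cycle [] (Level.lift b) = bd-cycle b
  In-cycle {L = l ∷ L} {f} (cl ∷ cL) (a , h) = CycleS.resp (λ w → solve 3 (λ f a l → (f :- a :* l) :+ a :* l := f) refl (f w) a (l w))
    (CycleS.add (In-cycle cL h) (CycleS.scl a cl))

  In-head : ∀ {M N} {R : Sub M} {S : Sub N} {p} {l : Ch M N p} {L} → In (Bd R S) (l ∷ L) l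
  In-head {R = R} {S} {L = L} = 1# , In-resp (bd-subspace R S) L (λ w → sym (trans (+-congˡ (-‿cong (*-identityˡ _))) (-‿inverseʳ _)))
                                        (In-null (bd-subspace R S) L)

  In-there : ∀ {M N} {R : Sub M} {S : Sub N} {p} {l f : Ch M N p} {L} → In (Bd R S) L f → In (Bd R S) (l ∷ L) f
  In-there {R = R} {S} {L = L} h = 0# , In-resp (bd-subspace R S) L (λ w → sym (trans (+-congˡ (neg-0 (zeroˡ _))) (+-identityʳ _))) h

  In-++ʳ : ∀ {M N} {R : Sub M} {S : Sub N} {p} (L L' : List (Ch M N p)) {f} → In (Bd R S) L' f → In (Bd R S) (L List.++ L') f
  In-++ʳ [] L' h = h
  In-++ʳ (l ∷ L) L' h = In-there {l = l} (In-++ʳ L L' h)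

  In-++ˡ : ∀ {M N} {R : Sub M} {S : Sub N} {p} (L L' : List (Ch M N p)) {f} → In (Bd R S) L f → In (Bd R S) (L List.++ L') f
  In-++ˡ {R = R} {S} [] L' (Level.lift b) = In-weaken (bd-subspace R S) L' b
  In-++ˡ (l ∷ L) L' (a , h) = a , In-++ˡ L L' h

  In-trans : ∀ {M N} {R : Sub M} {S : Sub N} {p} {L L' : List (Ch M N p)} {f} →
             All (In (Bd R S) L') L → In (Bd R S) L f → In (Bd R S) L' f
  In-trans {R = R} {S} {L' = L'} [] (Level.lift b) = In-weaken (bd-subspace R S) L' b
  In-trans {R = R} {S} {L = l ∷ L} {L'} {f} (hl ∷ hL) (a , h) =
    In-resp (bd-subspace R S) L' (λ w → solve 3 (λ f a l → (f :- a :* l) :+ a :* l := f) refl (f w) a (l w))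
      (In-add (bd-subspace R S) L' (In-trans hL h) (In-scl (bd-subspace R S) L' a hl))

  module _ {M N : ℕ} where
    -- This board is two disjoint segments, and the generator is the difference of two vertices from
    -- different ones. After row k has been emptied, degree 1 words need no further treatment, as
    -- each meets only one column.
    span-2-2 : ∀ {R : Sub M} {S : Sub N} {k s t} {y : Ch M N 1} → card R ≡ 2 → card S ≡ 2 → R k ≡ true → S s ≡ true → (S ∖ s) t ≡ true → Cycle R S y →
               In (Bd R S) (rdiff k s t 𝟙 ∷ []) y
    span-2-2 {R} {S} {k} {s} {t} {y} cR cS hk hs ht cy =
      second (push-row hk cy (λ u hu → vanishing 0 (card-∖′ R hk cR) (card-∖′ S hu cS) (s≤s (s≤s z≤n)) (s≤s z≤n) (s≤s z≤n) (ι-cycle cy (k , u))))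
      where
      third : ∀ {x} → Bd R S (y ⊖ x) → ∃[ g ] ∃[ z ] (Bd R S g × Cycle (R ∖ k) (S ∖ s ∖ t) z × Bd R S ((x ⊖ g) ⊖ rdiff k s t z)) →
              In (Bd R S) (rdiff k s t 𝟙 ∷ []) y
      third {x} b (g , z , bg , _ , b') = z [] , Level.lift (BdS.resp
        (λ w → trans (solve 4 (λ y x g d → ((y :- x) :+ g) :+ ((x :- g) :- d) := y :- d) refl (y w) (x w) (g w) (rdiff k s t z w))
          (+-congˡ (-‿cong (trans (cong (rdiff-linear k s t) (scalar z) w) (hom* (rdiff-linear k s t) (z []) 𝟙 w)))))
        (BdS.add (BdS.add b bg) b'))
      second : (Cycle (R ∖ k) S ⊞ Bd R S) y → In (Bd R S) (rdiff k s t 𝟙 ∷ []) y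
      second (x , cx , b) = third b (join-split hk hs ht {G = Bd R S} (cycle-mono (∖-⊆ R k) ⊆-refl cx) bd-cycle
        (split-col hk hs ht {G = Bd R S} (bd-subspace R S) cx (λ u hu → wedge-joined₁ hk hs ht {G = Bd R S} (bd-subspace R S) hu g0)))

    -- With row m emptied, the only words meeting both a and b are e_{ka} e_{lb} and e_{la} e_{kb}.
    -- Each is exchanged for one of the first two generators, and the joining leaves `rdiff m a b`
    -- of a cycle on a 2 × 2 board, which yields the third. Independence is not claimed.
    span-3-4 : ∀ {R : Sub M} {S : Sub N} {m k l a b s t} {z : Ch M N 2} → card R ≡ 3 → card S ≡ 4 → Chain R (m ∷ k ∷ l ∷ []) → Chain S (a ∷ b ∷ s ∷ t ∷ []) →
               Cycle R S z →
               In (Bd R S) (rdiff k a s (rdiff l b t 𝟙) ∷ rdiff l a s (rdiff k b t 𝟙) ∷ rdiff m a b (rdiff k s t 𝟙) ∷ []) z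
    span-3-4 {R} {S} {m} {k} {l} {a} {b} {s} {t} {z} cR cS (hm , hk , hl , _) (ha , hb , hs , ht , _) cz =
      second (push-row hm cz (λ u hu → vanishing 1 (card-∖′ R hm cR) (card-∖′ S hu cS) (ℕₚ.≤-refl) (s≤s (s≤s z≤n)) (s≤s (s≤s z≤n)) (ι-cycle cz (m , u))))
      where
      L₁ = rdiff k a s (rdiff l b t 𝟙) ∷ rdiff l a s (rdiff k b t 𝟙) ∷ []
      L₂ = rdiff m a b (rdiff k s t 𝟙) ∷ []
      G : Ch M N 2 → Set (c ⊔ ℓ)
      G = In (Bd R S) L₁
      sG = In-sub (bd-subspace R S) L₁
      hs₁ : (S ∖ a) s ≡ true
      hs₁ = ∖-⊆ (S ∖ a) b s hs
      hb₁ : (S ∖ a ∖ s) b ≡ true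
      hb₁ = proj₁ (proj₂ (proj₂ cols'))
        where cols' = chain-cons {R = S} a (chain-swap b s {t ∷ []}) (ha , hb , hs , ht , _)
      ht₁ : (S ∖ a ∖ s ∖ b) t ≡ true
      ht₁ = proj₁ (proj₂ (proj₂ (proj₂ cols')))
        where cols' = chain-cons {R = S} a (chain-swap b s {t ∷ []}) (ha , hb , hs , ht , _)
      double-cycle : ∀ {u v} {y : Ch M N 0} → R u ≡ true → (R ∖ u) v ≡ true → Cycle R S (rdiff u a s (rdiff v b t y))
      double-cycle hu hv = rdiff-cycle hu ha hs₁ (rdiff-cycle hv hb₁ ht₁ (cycle g0 tt))
      hk' = proj₂ (∖-in R hk)
      hl₁ : (R ∖ k) l ≡ true
      hl₁ = ∖-mono k (∖-⊆ R m) l hl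
      hk₁ : (R ∖ l) k ≡ true
      hk₁ = proj₁ (proj₂ (chain-swap {R = R} k l {[]} (hk' , hl₁ , _)))
      cycles : All (Cycle R S) L₁
      cycles = double-cycle hk' hl₁ ∷ double-cycle (proj₂ (∖-in R hl₁)) hk₁ ∷ []
      third : ∀ {x} → Bd R S (z ⊖ x) → ∃[ g ] ∃[ y ] (G g × Cycle (R ∖ m) (S ∖ a ∖ b) y × Bd R S ((x ⊖ g) ⊖ rdiff m a b y)) →
              In (Bd R S) (L₁ List.++ L₂) z
      third {x} bx (g , y , hg , cy , b') = In-resp sB (L₁ List.++ L₂)
        (λ w → solve 4 (λ z x g d → ((z :- x) :+ ((x :- g) :- d)) :+ (g :+ d) := z) refl (z w) (x w) (g w) (rdiff m a b y w))
        (In-add sB (L₁ List.++ L₂) (In-weaken sB (L₁ List.++ L₂) (BdS.add bx b'))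
          (In-add sB (L₁ List.++ L₂) (In-++ˡ L₁ L₂ hg)
            (In-++ʳ L₁ L₂ (In-map (rdiff-linear m a b) sB (rdiff-bd hm ha hb) (rdiff k s t 𝟙 ∷ [])
              (span-2-2 (card-∖′ R hm cR) (card-∖′ (S ∖ a) hb (card-∖′ S ha cS)) hk hs ht cy)))))
        where
        sB = bd-subspace R S {2}
      second : (Cycle (R ∖ m) S ⊞ Bd R S) z → In (Bd R S) (L₁ List.++ L₂) z
      second (x , cx , bx) = third bx (join-split hm ha hb {G = G} (cycle-mono (∖-⊆ R m) ⊆-refl cx) (In-cycle cycles)
        (split-cols hm ha hb {G = G} sG cx piece))
        where
        sJ = joined-subspace hm ha hb {G = G} sG
        J = Joined hm ha hb {p = 1} G
        good-ud : ∀ {u v x y} {S' : Sub N} {f : Ch M N 0} → (R ∖ m) u ≡ true → (R ∖ m ∖ u) v ≡ true → S' x ≡ true → (S' ∖ x) y ≡ true →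
                  Good (R ∖ m) S' (wedge (u , x) (wedge (v , y) f))
        good-ud hu hv hx hy = wedge-good _ (hu , hx) (wedge-good _ (hv , hy) g0)
        -- e_{ua} e_{vb} differs from (e_{ua} - e_{us}) (e_{vb} - e_{vt}) by terms avoiding a or b.
        exchange : ∀ {u v} (f : Ch M N 0) → (R ∖ m) u ≡ true → (R ∖ m ∖ u) v ≡ true →
                   G (rdiff u a s (rdiff v b t 𝟙)) → J (wedge (u , a) (wedge (v , b) f))
        exchange {u} {v} f hu hv hG = Subspace.resp sJ
          (λ w → trans (+-congʳ (+-congʳ (+-congʳ
              (trans (sym (trans (cong (∘-linear (rdiff-linear v b t) (rdiff-linear u a s)) (scalar f) w)
                                 (hom* (∘-linear (rdiff-linear v b t) (rdiff-linear u a s)) (f []) 𝟙 w)))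
                     (+-cong (hom- (wedge-linear (u , a)) (wedge (v , b) f) (wedge (v , t) f) w)
                             (-‿cong (hom- (wedge-linear (u , s)) (wedge (v , b) f) (wedge (v , t) f) w)))))))
            (solve 4 (λ x y z o → ((((x :- y) :- (z :- o)) :+ y) :+ z) :- o := x) refl
              (wedge (u , a) (wedge (v , b) f) w) (wedge (u , a) (wedge (v , t) f) w)
              (wedge (u , s) (wedge (v , b) f) w) (wedge (u , s) (wedge (v , t) f) w)))
          (Subspace.sub sJ (Subspace.add sJ (Subspace.add sJ
              (joined-G hm ha hb {G = G} sG (In-scl (bd-subspace R S) L₁ (f []) hG))
              (joined₁ hm ha hb {G = G} sG (good-ud hu hv a∈S∖b t∈S∖b∖a)))
              (joined₂ hm ha hb {G = G} sG (good-ud hu hv hs₁ hb₁)))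
              (joined₂ hm ha hb {G = G} sG (good-ud hu hv hs₁ (∖-⊆ (S ∖ a ∖ s) b t ht₁))))
          where
          ch = chain-swap {R = S} a b {s ∷ t ∷ []} (ha , hb , hs , ht , _)
          a∈S∖b = proj₁ (proj₂ ch)
          t∈S∖b∖a = ∖-⊆ (S ∖ b ∖ a) s t (proj₁ (proj₂ (proj₂ (proj₂ ch))))
        only : ∀ u → (R ∖ m) u ≡ true → u ≡ k ⊎ u ≡ l
        only u hu with u Finₚ.≟ k | u Finₚ.≟ l
        ... | yes eq | _ = inj₁ eq
        ... | no _ | yes eq = inj₂ eq
        ... | no n | no n' = ⊥-elim (card0 (R ∖ m ∖ k ∖ l) (card-∖′ (R ∖ m ∖ k) hl (card-∖′ (R ∖ m) hk (card-∖′ R hm cR)))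
                (in-∖ (R ∖ m ∖ k) n' (in-∖ (R ∖ m) n hu)))
        piece : ∀ u → (R ∖ m) u ≡ true → ∀ v → (R ∖ m ∖ u) v ≡ true → J (wedge (u , a) (wedge (v , b) (ι (v , b) (ι (u , a) x))))
        piece u hu v hv with only u hu | only v (∖-⊆ (R ∖ m) u v hv)
        ... | inj₁ ≡.refl | inj₁ ≡.refl = ⊥-elim (proj₁ (∖-in (R ∖ m) hv) ≡.refl)
        ... | inj₁ ≡.refl | inj₂ ≡.refl = exchange _ hu hv (In-head {l = rdiff k a s (rdiff l b t 𝟙)})
        ... | inj₂ ≡.refl | inj₁ ≡.refl = exchange _ hu hv (In-there {l = rdiff k a s (rdiff l b t 𝟙)} (In-head {l = rdiff l a s (rdiff k b t 𝟙)} {[]}))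
        ... | inj₂ ≡.refl | inj₂ ≡.refl = ⊥-elim (proj₁ (∖-in (R ∖ m) hv) ≡.refl)

    -- No conditions have to be imposed here. The coefficients along column e live on 4 × 4 boards
    -- with p = 2, those along pairs of edges on boards with 3 rows and 2 columns with p = 1, and
    -- both satisfy 3p + 2 = m + n, the edge of the vanishing range. Hence z comes from the 3 × 4
    -- board through `cdiff i j e`.
    span-5-5 : ∀ {R : Sub M} {S : Sub N} {i j m k l e a b s t} {z : Ch M N 3} → card R ≡ 5 → card S ≡ 5 →
      Chain R (i ∷ j ∷ m ∷ k ∷ l ∷ []) → Chain S (e ∷ a ∷ b ∷ s ∷ t ∷ []) → Cycle R S z →
      In (Bd R S) (class (state i j m l k e a b s t) ∷ []) z
    span-5-5 {R} {S} {i} {j} {m} {k} {l} {e} {a} {b} {s} {t} {z} cR cS cr@(hi , hj , cr') cc@(he , cc') cz =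
      second (push-row he (tr-cycle cz) (λ u hu → vanishing 2 (card-∖′ S he cS) (card-∖′ R hu cR) ℕₚ.≤-refl
        (s≤s (s≤s (s≤s z≤n))) (s≤s (s≤s (s≤s z≤n))) (ι-cycle (tr-cycle cz) (e , u))))
      where
      X₀ = class (state i j m l k e a b s t)
      L = rdiff k a s (rdiff l b t 𝟙) ∷ rdiff l a s (rdiff k b t 𝟙) ∷ rdiff m a b (rdiff k s t 𝟙) ∷ []
      rows₁ : Chain R (i ∷ j ∷ k ∷ m ∷ l ∷ [])
      rows₁ = chain-cons i (chain-cons j (chain-swap m k)) cr
      rows₂ : Chain R (i ∷ j ∷ l ∷ m ∷ k ∷ [])
      rows₂ = chain-cons i (chain-cons j (λ ch → chain-swap m l (chain-cons m (chain-swap k l) ch))) cr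
      cols₁ : Chain S (e ∷ a ∷ s ∷ b ∷ t ∷ [])
      cols₁ = chain-cons e (chain-cons a (chain-swap b s)) cc
      -- Each list of moves carries the state of one generator to that of `X₀`; that the final
      -- states agree is checked by computation.
      single : All (In (Bd R S) (X₀ ∷ [])) (List.map (cdiff i j e) L)
      single = moves-class (trade ∷ reorder ∷ trade ∷ flip ∷ trade ∷ reorder ∷ trade ∷ flip ∷ reorder ∷ flip ∷ shift ∷ []) (state i j k m l e a s b t) rows₁ cols₁
             ∷ moves-class (reorder ∷ trade ∷ reorder ∷ trade ∷ flip ∷ trade ∷ reorder ∷ trade ∷ reorder ∷ shift ∷ []) (state i j l m k e a s b t) rows₂ cols₁
             ∷ In-head {l = X₀} {[]} ∷ []
      third : ∀ {x} → Bd S R (tr z ⊖ x) →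
        ∃[ g ] ∃[ y ] (Bd S R g × Cycle (S ∖ e) (R ∖ i ∖ j) y × Bd S R ((x ⊖ g) ⊖ rdiff e i j y)) → In (Bd R S) (X₀ ∷ []) z
      third {x} bx (g , y , bg , cy , b') = In-trans single (In-resp sB Ls
        (λ w → solve 2 (λ z d → (z :- d) :+ d := z) refl (z w) (cdiff i j e (tr y) w))
        (In-add sB Ls
          (In-weaken sB Ls (BdS.resp
            (λ w → trans (solve 4 (λ z x g d → (((z :- x) :+ g) :+ ((x :- g) :- d)) := z :- d) refl _ _ _ _)
                     (+-cong (tr-tr z w) (-‿cong (tr-rdiff e i j y w))))
            (tr-bd (BdS.add (BdS.add bx bg) b'))))
          (In-map (cdiff-linear i j e) sB (cdiff-bd hi hj he) L
            (span-3-4 (card-∖′ (R ∖ i) hj (card-∖′ R hi cR)) (card-∖′ S he cS) cr' cc' (tr-cycle cy)))))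
        where
        sB = bd-subspace R S {3}
        Ls = List.map (cdiff i j e) L
      second : (Cycle (S ∖ e) R ⊞ Bd S R) (tr z) → In (Bd R S) (X₀ ∷ []) z
      second (x , cx , bx) = third bx (join-split he hi hj {G = Bd S R} (cycle-mono (∖-⊆ S e) ⊆-refl cx) bd-cycle
        (split-cols he hi hj {G = Bd S R} (bd-subspace S R) cx (λ u hu v hv → bd-joined he hi hj {G = Bd S R} (bd-subspace S R) hu hv
          (vanishing 1 (card-∖′ (S ∖ e ∖ u) hv (card-∖′ (S ∖ e) hu (card-∖′ S he cS))) (card-∖′ (R ∖ i) hj (card-∖′ R hi cR))
            ℕₚ.≤-refl (s≤s (s≤s z≤n)) (s≤s (s≤s z≤n)) (ι-cycle (ι-cycle cx (u , i)) (v , j))))))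

  HomLe-5-5 : HomLe 5 5 3 1
  HomLe-5-5 R S cR cS = go (choose-chain {R = R} 5 cR) (choose-chain {R = S} 5 cS)
    where
    go : ∃[ v ] (Chain R (Vec.toList {n = 5} v)) → ∃[ v ] (Chain S (Vec.toList {n = 5} v)) → Spanned 1 (Cycle R S {3}) (Bd R S)
    go ((_ ∷ _ ∷ _ ∷ _ ∷ _ ∷ []) , cr) ((_ ∷ _ ∷ _ ∷ _ ∷ _ ∷ []) , cc) =
      η (_ ∷ [] , ≡.refl , λ f cf → η (span-5-5 cR cS cr cc cf))

  -- Bounds on Betti numbers

  HomLe-cast : ∀ {m m' n n' p p' N} → m ≡ m' → n ≡ n' → p ≡ p' → HomLe m n p N → HomLe m' n' p' N
  HomLe-cast ≡.refl ≡.refl ≡.refl h = h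

  -- Bounds β̂_k^{a,b} for b = 2 + x.
  BettiLe : ℕ → ℕ → ℕ → ℕ → Set (c ⊔ ℓ)
  BettiLe k a x N = HomLe (k ℕ.+ a ℕ.+ 5 ℕ.+ 3 ℕ.* x) (k ℕ.+ 2 ℕ.* a ℕ.+ 5 ℕ.+ 3 ℕ.* x) (k ℕ.+ a ℕ.+ 3 ℕ.+ 2 ℕ.* x) N

  BettiLe-a : ∀ k a x {N₁ N₂ N₃} → BettiLe k (suc a) (suc x) N₁ → BettiLe k (2 ℕ.+ a) x N₂ → BettiLe (suc k) a (suc x) N₃ →
    let m = k ℕ.+ a ℕ.+ 7 ℕ.+ 3 ℕ.* x ; n = k ℕ.+ 2 ℕ.* a ℕ.+ 9 ℕ.+ 3 ℕ.* x in
    BettiLe (suc k) (suc a) (suc x) ((2 ℕ.+ n) ℕ.* N₁ ℕ.+ ((2 ℕ.+ m) ℕ.* ((1 ℕ.+ m) ℕ.* N₂) ℕ.+ N₃))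
  BettiLe-a k a x h₁ h₂ h₃ = HomLe-cast (e₀ k a x) (e₁ k a x) (e₂ k a x)
    (HomLe-step (HomLe-cast (e₃ k a x) (e₄ k a x) (e₅ k a x) h₁) (HomLe-cast (e₆ k a x) (e₇ k a x) (e₈ k a x) h₂)
                (HomLe-cast (e₉ k a x) (e₁₀ k a x) (e₁₁ k a x) h₃))
    where
    e₀ : ∀ k a x → 3 ℕ.+ (k ℕ.+ a ℕ.+ 7 ℕ.+ 3 ℕ.* x) ≡ 1 ℕ.+ k ℕ.+ (1 ℕ.+ a) ℕ.+ 5 ℕ.+ 3 ℕ.* (1 ℕ.+ x)
    e₀ = solve-∀
    e₁ : ∀ k a x → 2 ℕ.+ (k ℕ.+ 2 ℕ.* a ℕ.+ 9 ℕ.+ 3 ℕ.* x) ≡ 1 ℕ.+ k ℕ.+ 2 ℕ.* (1 ℕ.+ a) ℕ.+ 5 ℕ.+ 3 ℕ.* (1 ℕ.+ x)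
    e₁ = solve-∀
    e₂ : ∀ k a x → 2 ℕ.+ (k ℕ.+ a ℕ.+ 5 ℕ.+ 2 ℕ.* x) ≡ 1 ℕ.+ k ℕ.+ (1 ℕ.+ a) ℕ.+ 3 ℕ.+ 2 ℕ.* (1 ℕ.+ x)
    e₂ = solve-∀
    e₃ : ∀ k a x → k ℕ.+ (1 ℕ.+ a) ℕ.+ 5 ℕ.+ 3 ℕ.* (1 ℕ.+ x) ≡ 2 ℕ.+ (k ℕ.+ a ℕ.+ 7 ℕ.+ 3 ℕ.* x)
    e₃ = solve-∀
    e₄ : ∀ k a x → k ℕ.+ 2 ℕ.* (1 ℕ.+ a) ℕ.+ 5 ℕ.+ 3 ℕ.* (1 ℕ.+ x) ≡ 1 ℕ.+ (k ℕ.+ 2 ℕ.* a ℕ.+ 9 ℕ.+ 3 ℕ.* x)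
    e₄ = solve-∀
    e₅ : ∀ k a x → k ℕ.+ (1 ℕ.+ a) ℕ.+ 3 ℕ.+ 2 ℕ.* (1 ℕ.+ x) ≡ 1 ℕ.+ (k ℕ.+ a ℕ.+ 5 ℕ.+ 2 ℕ.* x)
    e₅ = solve-∀
    e₆ : ∀ k a x → k ℕ.+ (2 ℕ.+ a) ℕ.+ 5 ℕ.+ 3 ℕ.* x ≡ k ℕ.+ a ℕ.+ 7 ℕ.+ 3 ℕ.* x
    e₆ = solve-∀
    e₇ : ∀ k a x → k ℕ.+ 2 ℕ.* (2 ℕ.+ a) ℕ.+ 5 ℕ.+ 3 ℕ.* x ≡ k ℕ.+ 2 ℕ.* a ℕ.+ 9 ℕ.+ 3 ℕ.* x
    e₇ = solve-∀
    e₈ : ∀ k a x → k ℕ.+ (2 ℕ.+ a) ℕ.+ 3 ℕ.+ 2 ℕ.* x ≡ k ℕ.+ a ℕ.+ 5 ℕ.+ 2 ℕ.* x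
    e₈ = solve-∀
    e₉ : ∀ k a x → 1 ℕ.+ k ℕ.+ a ℕ.+ 5 ℕ.+ 3 ℕ.* (1 ℕ.+ x) ≡ 2 ℕ.+ (k ℕ.+ a ℕ.+ 7 ℕ.+ 3 ℕ.* x)
    e₉ = solve-∀
    e₁₀ : ∀ k a x → 1 ℕ.+ k ℕ.+ 2 ℕ.* a ℕ.+ 5 ℕ.+ 3 ℕ.* (1 ℕ.+ x) ≡ k ℕ.+ 2 ℕ.* a ℕ.+ 9 ℕ.+ 3 ℕ.* x
    e₁₀ = solve-∀
    e₁₁ : ∀ k a x → 1 ℕ.+ k ℕ.+ a ℕ.+ 3 ℕ.+ 2 ℕ.* (1 ℕ.+ x) ≡ 1 ℕ.+ (k ℕ.+ a ℕ.+ 5 ℕ.+ 2 ℕ.* x)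
    e₁₁ = solve-∀

  -- For a = 0 the recursion would lead to a = -1; transposition turns (-1 , b) into (1 , b - 1).
  BettiLe-b : ∀ k x {N₁ N₂ N₃} → BettiLe k 0 (suc x) N₁ → BettiLe k 1 x N₂ → BettiLe (suc k) 1 x N₃ →
    let m = k ℕ.+ 6 ℕ.+ 3 ℕ.* x ; n = k ℕ.+ 7 ℕ.+ 3 ℕ.* x in
    BettiLe (suc k) 0 (suc x) ((2 ℕ.+ n) ℕ.* N₁ ℕ.+ ((2 ℕ.+ m) ℕ.* ((1 ℕ.+ m) ℕ.* N₂) ℕ.+ N₃))
  BettiLe-b k x h₁ h₂ h₃ = HomLe-cast (e₀ k x) (e₁ k x) (e₂ k x)
    (HomLe-step (HomLe-cast (e₃ k x) (e₄ k x) (e₅ k x) h₁) (HomLe-cast (e₆ k x) (e₇ k x) (e₈ k x) h₂)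
                (HomLe-tr (HomLe-cast (e₉ k x) (e₁₀ k x) (e₁₁ k x) h₃)))
    where
    e₀ : ∀ k x → 3 ℕ.+ (k ℕ.+ 6 ℕ.+ 3 ℕ.* x) ≡ 1 ℕ.+ k ℕ.+ 0 ℕ.+ 5 ℕ.+ 3 ℕ.* (1 ℕ.+ x)
    e₀ = solve-∀
    e₁ : ∀ k x → 2 ℕ.+ (k ℕ.+ 7 ℕ.+ 3 ℕ.* x) ≡ 1 ℕ.+ k ℕ.+ 2 ℕ.* 0 ℕ.+ 5 ℕ.+ 3 ℕ.* (1 ℕ.+ x)
    e₁ = solve-∀
    e₂ : ∀ k x → 2 ℕ.+ (k ℕ.+ 4 ℕ.+ 2 ℕ.* x) ≡ 1 ℕ.+ k ℕ.+ 0 ℕ.+ 3 ℕ.+ 2 ℕ.* (1 ℕ.+ x)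
    e₂ = solve-∀
    e₃ : ∀ k x → k ℕ.+ 0 ℕ.+ 5 ℕ.+ 3 ℕ.* (1 ℕ.+ x) ≡ 2 ℕ.+ (k ℕ.+ 6 ℕ.+ 3 ℕ.* x)
    e₃ = solve-∀
    e₄ : ∀ k x → k ℕ.+ 2 ℕ.* 0 ℕ.+ 5 ℕ.+ 3 ℕ.* (1 ℕ.+ x) ≡ 1 ℕ.+ (k ℕ.+ 7 ℕ.+ 3 ℕ.* x)
    e₄ = solve-∀
    e₅ : ∀ k x → k ℕ.+ 0 ℕ.+ 3 ℕ.+ 2 ℕ.* (1 ℕ.+ x) ≡ 1 ℕ.+ (k ℕ.+ 4 ℕ.+ 2 ℕ.* x)
    e₅ = solve-∀
    e₆ : ∀ k x → k ℕ.+ 1 ℕ.+ 5 ℕ.+ 3 ℕ.* x ≡ k ℕ.+ 6 ℕ.+ 3 ℕ.* x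
    e₆ = solve-∀
    e₇ : ∀ k x → k ℕ.+ 2 ℕ.* 1 ℕ.+ 5 ℕ.+ 3 ℕ.* x ≡ k ℕ.+ 7 ℕ.+ 3 ℕ.* x
    e₇ = solve-∀
    e₈ : ∀ k x → k ℕ.+ 1 ℕ.+ 3 ℕ.+ 2 ℕ.* x ≡ k ℕ.+ 4 ℕ.+ 2 ℕ.* x
    e₈ = solve-∀
    e₉ : ∀ k x → 1 ℕ.+ k ℕ.+ 1 ℕ.+ 5 ℕ.+ 3 ℕ.* x ≡ k ℕ.+ 7 ℕ.+ 3 ℕ.* x
    e₉ = solve-∀
    e₁₀ : ∀ k x → 1 ℕ.+ k ℕ.+ 2 ℕ.* 1 ℕ.+ 5 ℕ.+ 3 ℕ.* x ≡ 2 ℕ.+ (k ℕ.+ 6 ℕ.+ 3 ℕ.* x)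
    e₁₀ = solve-∀
    e₁₁ : ∀ k x → 1 ℕ.+ k ℕ.+ 1 ℕ.+ 3 ℕ.+ 2 ℕ.* x ≡ 1 ℕ.+ (k ℕ.+ 4 ℕ.+ 2 ℕ.* x)
    e₁₁ = solve-∀

  private
    vanish-0 : ∀ m n p → 3 ℕ.* p ℕ.+ 2 ≡ m ℕ.+ n → p ℕ.< m → p ℕ.< n → HomLe m n p 0
    vanish-0 m n p e pm pn = HomLe-0 (λ cR cS → vanishing p cR cS (ℕₚ.≤-reflexive e) pm pn)

    count : ∀ m n → (2 ℕ.+ n) ℕ.* 0 ℕ.+ ((2 ℕ.+ m) ℕ.* ((1 ℕ.+ m) ℕ.* 0) ℕ.+ 1) ≡ 1
    count = solve-∀

    -- In general k = 3p + 1 - m - n, so `vanishing` covers k < 0. On the line k = 0 both lower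
    -- terms of the recursion have k = -1, and only the third term remains.
    HomLe-step-0 : ∀ m n p → 3 ℕ.* p ℕ.+ 2 ≡ m ℕ.+ n → p ℕ.< m → p ℕ.< n → HomLe (2 ℕ.+ m) n (suc p) 1 → HomLe (3 ℕ.+ m) (2 ℕ.+ n) (2 ℕ.+ p) 1
    HomLe-step-0 m n p e pm pn h = ≡.subst (HomLe _ _ _) (count m n)
      (HomLe-step (vanish-0 (2 ℕ.+ m) (suc n) (suc p) (≡.trans (e₁ p) (≡.trans (≡.cong (3 ℕ.+_) e) (e₂ m n))) (s≤s (ℕₚ.m≤n⇒m≤1+n pm)) (s≤s pn))
                  (vanish-0 m n p e pm pn) h)
      where
      e₁ : ∀ p → 3 ℕ.* (1 ℕ.+ p) ℕ.+ 2 ≡ 3 ℕ.+ (3 ℕ.* p ℕ.+ 2)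
      e₁ = solve-∀
      e₂ : ∀ m n → 3 ℕ.+ (m ℕ.+ n) ≡ 2 ℕ.+ m ℕ.+ (1 ℕ.+ n)
      e₂ = solve-∀

  -- The bound is inherited from (a-1 , b), and for a = 0 from (1 , b-1) by transposition, down to
  -- the board of size 5 × 5.
  BettiLe-0 : ∀ a x → BettiLe 0 a x 1
  BettiLe-0 zero zero = HomLe-5-5
  BettiLe-0 (suc a) x = HomLe-cast (e₀ a x) (e₁ a x) (e₂ a x)
    (HomLe-step-0 (a ℕ.+ 3 ℕ.+ 3 ℕ.* x) (2 ℕ.* a ℕ.+ 5 ℕ.+ 3 ℕ.* x) (a ℕ.+ 2 ℕ.+ 2 ℕ.* x) (e₃ a x)
      (≤-by (e₄ a x)) (≤-by (e₅ a x))
      (HomLe-cast (e₆ a x) ≡.refl (e₈ a x) (BettiLe-0 a x)))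
    where
    e₀ : ∀ a x → 3 ℕ.+ (a ℕ.+ 3 ℕ.+ 3 ℕ.* x) ≡ 1 ℕ.+ a ℕ.+ 5 ℕ.+ 3 ℕ.* x
    e₀ = solve-∀
    e₁ : ∀ a x → 2 ℕ.+ (2 ℕ.* a ℕ.+ 5 ℕ.+ 3 ℕ.* x) ≡ 2 ℕ.* (1 ℕ.+ a) ℕ.+ 5 ℕ.+ 3 ℕ.* x
    e₁ = solve-∀
    e₂ : ∀ a x → 2 ℕ.+ (a ℕ.+ 2 ℕ.+ 2 ℕ.* x) ≡ 1 ℕ.+ a ℕ.+ 3 ℕ.+ 2 ℕ.* x
    e₂ = solve-∀
    e₃ : ∀ a x → 3 ℕ.* (a ℕ.+ 2 ℕ.+ 2 ℕ.* x) ℕ.+ 2 ≡ a ℕ.+ 3 ℕ.+ 3 ℕ.* x ℕ.+ (2 ℕ.* a ℕ.+ 5 ℕ.+ 3 ℕ.* x)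
    e₃ = solve-∀
    e₄ : ∀ a x → 1 ℕ.+ (a ℕ.+ 2 ℕ.+ 2 ℕ.* x) ℕ.+ x ≡ a ℕ.+ 3 ℕ.+ 3 ℕ.* x
    e₄ = solve-∀
    e₅ : ∀ a x → 1 ℕ.+ (a ℕ.+ 2 ℕ.+ 2 ℕ.* x) ℕ.+ (a ℕ.+ 2 ℕ.+ x) ≡ 2 ℕ.* a ℕ.+ 5 ℕ.+ 3 ℕ.* x
    e₅ = solve-∀
    e₆ : ∀ a x → a ℕ.+ 5 ℕ.+ 3 ℕ.* x ≡ 2 ℕ.+ (a ℕ.+ 3 ℕ.+ 3 ℕ.* x)
    e₆ = solve-∀
    e₈ : ∀ a x → a ℕ.+ 3 ℕ.+ 2 ℕ.* x ≡ 1 ℕ.+ (a ℕ.+ 2 ℕ.+ 2 ℕ.* x)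
    e₈ = solve-∀
  BettiLe-0 zero (suc x) = HomLe-cast (e₀ x) (e₁ x) (e₂ x)
    (HomLe-step-0 (5 ℕ.+ 3 ℕ.* x) (6 ℕ.+ 3 ℕ.* x) (3 ℕ.+ 2 ℕ.* x) (e₃ x)
      (≤-by (e₄ x)) (≤-by (e₅ x))
      (HomLe-tr (BettiLe-0 1 x)))
    where
    e₀ : ∀ x → 3 ℕ.+ (5 ℕ.+ 3 ℕ.* x) ≡ 5 ℕ.+ 3 ℕ.* (1 ℕ.+ x)
    e₀ = solve-∀
    e₁ : ∀ x → 2 ℕ.+ (6 ℕ.+ 3 ℕ.* x) ≡ 5 ℕ.+ 3 ℕ.* (1 ℕ.+ x)
    e₁ = solve-∀
    e₂ : ∀ x → 2 ℕ.+ (3 ℕ.+ 2 ℕ.* x) ≡ 3 ℕ.+ 2 ℕ.* (1 ℕ.+ x)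
    e₂ = solve-∀
    e₃ : ∀ x → 3 ℕ.* (3 ℕ.+ 2 ℕ.* x) ℕ.+ 2 ≡ 5 ℕ.+ 3 ℕ.* x ℕ.+ (6 ℕ.+ 3 ℕ.* x)
    e₃ = solve-∀
    e₄ : ∀ x → 1 ℕ.+ (3 ℕ.+ 2 ℕ.* x) ℕ.+ (1 ℕ.+ x) ≡ 5 ℕ.+ 3 ℕ.* x
    e₄ = solve-∀
    e₅ : ∀ x → 1 ℕ.+ (3 ℕ.+ 2 ℕ.* x) ℕ.+ (2 ℕ.+ x) ≡ 6 ℕ.+ 3 ℕ.* x
    e₅ = solve-∀

  denom-suc : ∀ k → 3 ℕ.* suc k ℕ.* denom k ≡ denom (suc k)
  denom-suc k = id k (3 ℕ.^ k) (k !)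
    where
    id : ∀ k u v → 3 ℕ.* (1 ℕ.+ k) ℕ.* (u ℕ.* v) ≡ (3 ℕ.* u) ℕ.* ((1 ℕ.+ k) ℕ.* v)
    id = solve-∀

  BettiBounded : ℕ → ℕ → ℕ → ℕ → Set (c ⊔ ℓ)
  BettiBounded k K a x = ∃[ N ] (BettiLe k a x N × N ℕ.* denom k ℕ.≤ growth K a (2 ℕ.+ x) ℕ.^ k)

  -- The constant K is uniform in a and x for fixed k. The outer induction on k treats the two lower
  -- terms, the inner one `go` the third.
  betti-bound : ∀ k → ∃[ K ] (∀ a x → k ℕ.≤ x → BettiBounded k K a x)
  betti-bound zero = 0 , λ a x _ → 1 , BettiLe-0 a x , ℕₚ.≤-refl
  betti-bound (suc k) = step (betti-bound k)
    (HomLe-finite (suc k ℕ.+ 0 ℕ.+ 5 ℕ.+ 3 ℕ.* suc k) (suc k ℕ.+ 2 ℕ.* 0 ℕ.+ 5 ℕ.+ 3 ℕ.* suc k) (suc k ℕ.+ 0 ℕ.+ 3 ℕ.+ 2 ℕ.* suc k))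
    where
    step : ∃[ K ] (∀ a x → k ℕ.≤ x → BettiBounded k K a x) → ∃[ N ] BettiLe (suc k) 0 (suc k) N →
           ∃[ K ] (∀ a x → suc k ℕ.≤ x → BettiBounded (suc k) K a x)
    step (K , IH) (N₀ , h₀) = K₁ , λ { a (suc x) (s≤s le) → go a x le }
      where
      D = N₀ ℕ.* denom (suc k)
      -- 4K + 3 pays for shifting the points of the lower terms, 3 + 3k for the increment of the
      -- polynomial, and D for the base point.
      K₁ = 4 ℕ.* K ℕ.+ 3 ℕ.+ (3 ℕ.* k ℕ.+ D)
      K₁-eq : 3 ℕ.+ 3 ℕ.* k ℕ.+ (4 ℕ.* K ℕ.+ D) ≡ K₁
      K₁-eq = id K k D
        where
        id : ∀ K k D → 3 ℕ.+ 3 ℕ.* k ℕ.+ (4 ℕ.* K ℕ.+ D) ≡ 4 ℕ.* K ℕ.+ 3 ℕ.+ (3 ℕ.* k ℕ.+ D)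
        id = solve-∀

      assemble : ∀ {a x a' x'} n m₁ m₂ {N₁ N₂ N₃} → N₁ ℕ.* denom k ℕ.≤ growth K₁ a' x' ℕ.^ k → N₂ ℕ.* denom k ℕ.≤ growth K₁ a' x' ℕ.^ k →
        N₃ ℕ.* denom (suc k) ℕ.≤ growth K₁ a' x' ℕ.^ suc k → growth K₁ a' x' ℕ.+ 3 ℕ.* (n ℕ.+ m₁ ℕ.* m₂) ℕ.≤ growth K₁ a x →
        (n ℕ.* N₁ ℕ.+ (m₁ ℕ.* (m₂ ℕ.* N₂) ℕ.+ N₃)) ℕ.* denom (suc k) ℕ.≤ growth K₁ a x ℕ.^ suc k
      assemble {a} {x} {a'} {x'} n m₁ m₂ {N₁} {N₂} {N₃} h₁ h₂ h₃ hg =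
        ≡.subst (λ d → (n ℕ.* N₁ ℕ.+ (m₁ ℕ.* (m₂ ℕ.* N₂) ℕ.+ N₃)) ℕ.* d ℕ.≤ growth K₁ a x ℕ.^ suc k) (denom-suc k)
          (combine k (denom k) n m₁ m₂ h₁ h₂ (≡.subst (λ d → N₃ ℕ.* d ℕ.≤ growth K₁ a' x' ℕ.^ suc k) (≡.sym (denom-suc k)) h₃) hg)

      -- D ≤ K₁ ≤ g, and g ≤ g^(k+1) since g is positive.
      base : BettiBounded (suc k) K₁ 0 (suc k)
      base = N₀ , h₀ , ℕₚ.≤-trans D≤ (ℕₚ.m≤m*n g (g ℕ.^ k) {{ℕₚ.m^n≢0 g k {{ℕ.>-nonZero (ℕₚ.≤-trans K₁>0 K₁≤)}}}})
        where
        g = growth K₁ 0 (2 ℕ.+ suc k)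
        K₁>0 : 0 ℕ.< K₁
        K₁>0 = ≡.subst (0 ℕ.<_) K₁-eq (s≤s z≤n)
        K₁≤ : K₁ ℕ.≤ g
        K₁≤ = ≤-by (id K₁ k)
          where
          id : ∀ K k → K ℕ.+ (18 ℕ.* ((3 ℕ.+ k) ℕ.* (3 ℕ.+ k) ℕ.* (3 ℕ.+ k)) ℕ.+ K ℕ.* (107 ℕ.+ 72 ℕ.* k ℕ.+ 12 ℕ.* (k ℕ.* k)))
               ≡ 0 ℕ.* 0 ℕ.* 0 ℕ.+ 9 ℕ.* (0 ℕ.* 0 ℕ.* (3 ℕ.+ k)) ℕ.+ 27 ℕ.* (0 ℕ.* (3 ℕ.+ k) ℕ.* (3 ℕ.+ k)) ℕ.+ 18 ℕ.* ((3 ℕ.+ k) ℕ.* (3 ℕ.+ k) ℕ.* (3 ℕ.+ k))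
                 ℕ.+ 3 ℕ.* K ℕ.* ((0 ℕ.+ 2 ℕ.* (3 ℕ.+ k)) ℕ.* (0 ℕ.+ 2 ℕ.* (3 ℕ.+ k)))
          id = solve-∀
        D≤ : D ℕ.≤ g
        D≤ = ℕₚ.≤-trans (ℕₚ.≤-trans (ℕₚ.m≤n+m D (3 ℕ.* k)) (ℕₚ.m≤n+m (3 ℕ.* k ℕ.+ D) (4 ℕ.* K ℕ.+ 3))) K₁≤

      -- The third term leads from (a , b) to (a-1 , b), and from (0 , b) to (1 , b-1). The only
      -- point of the range without a predecessor is a = 0, b = k + 3.
      go : ∀ a x → k ℕ.≤ x → BettiBounded (suc k) K₁ a (suc x)
      go (suc a) x le = next (go a x le) (IH (suc a) (suc x) (ℕₚ.m≤n⇒m≤1+n le)) (IH (2 ℕ.+ a) x le)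
        where
        next : BettiBounded (suc k) K₁ a (suc x) → BettiBounded k K (suc a) (suc x) → BettiBounded k K (2 ℕ.+ a) x →
               BettiBounded (suc k) K₁ (suc a) (suc x)
        next (N₃ , h₃ , b₃) (N₁ , h₁ , b₁) (N₂ , h₂ , b₂) = _ , BettiLe-a k a x h₁ h₂ h₃ ,
          assemble {suc a} {3 ℕ.+ x} {a} {3 ℕ.+ x} (2 ℕ.+ (k ℕ.+ 2 ℕ.* a ℕ.+ 9 ℕ.+ 3 ℕ.* x)) (2 ℕ.+ m) (1 ℕ.+ m) {N₁} {N₂} {N₃}
            (ℕₚ.≤-trans b₁ (ℕₚ.^-monoˡ-≤ k (growth-a₁ a x K (3 ℕ.* k ℕ.+ D))))
            (ℕₚ.≤-trans b₂ (ℕₚ.^-monoˡ-≤ k (growth-a₂ a x K (3 ℕ.* k ℕ.+ D)))) b₃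
            (≡.subst₂ (λ L y → growth L a (3 ℕ.+ y) ℕ.+ 3 ℕ.* ((2 ℕ.+ (k ℕ.+ 2 ℕ.* a ℕ.+ 9 ℕ.+ 3 ℕ.* y)) ℕ.+ (2 ℕ.+ (k ℕ.+ a ℕ.+ 7 ℕ.+ 3 ℕ.* y)) ℕ.* (1 ℕ.+ (k ℕ.+ a ℕ.+ 7 ℕ.+ 3 ℕ.* y)))
                         ℕ.≤ growth L (suc a) (3 ℕ.+ y)) K₁-eq (ℕₚ.m+[n∸m]≡n le) (growth-a₃ a k (x ℕ.∸ k) (4 ℕ.* K ℕ.+ D)))
          where m = k ℕ.+ a ℕ.+ 7 ℕ.+ 3 ℕ.* x
      go zero x le with ℕₚ.m≤n⇒m<n∨m≡n le
      ... | inj₂ ≡.refl = base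
      go zero (suc x) le | inj₁ (s≤s le') = next (go 1 x le') (IH 0 (2 ℕ.+ x) (ℕₚ.m≤n⇒m≤1+n le)) (IH 1 (suc x) le)
        where
        next : BettiBounded (suc k) K₁ 1 (suc x) → BettiBounded k K 0 (2 ℕ.+ x) → BettiBounded k K 1 (suc x) →
               BettiBounded (suc k) K₁ 0 (2 ℕ.+ x)
        next (N₃ , h₃ , b₃) (N₁ , h₁ , b₁) (N₂ , h₂ , b₂) = _ , BettiLe-b k (suc x) h₁ h₂ h₃ ,
          assemble {0} {4 ℕ.+ x} {1} {3 ℕ.+ x} (2 ℕ.+ (k ℕ.+ 7 ℕ.+ 3 ℕ.* suc x)) (2 ℕ.+ m) (1 ℕ.+ m) {N₁} {N₂} {N₃}
            (ℕₚ.≤-trans b₁ (ℕₚ.^-monoˡ-≤ k (growth-b₁ (suc x) K (3 ℕ.* k ℕ.+ D))))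
            (ℕₚ.≤-trans b₂ (ℕₚ.^-monoˡ-≤ k (growth-b₂ (suc x) K (3 ℕ.* k ℕ.+ D)))) b₃
            (≡.subst₂ (λ L y → growth L 1 (2 ℕ.+ y) ℕ.+ 3 ℕ.* ((2 ℕ.+ (k ℕ.+ 7 ℕ.+ 3 ℕ.* y)) ℕ.+ (2 ℕ.+ (k ℕ.+ 6 ℕ.+ 3 ℕ.* y)) ℕ.* (1 ℕ.+ (k ℕ.+ 6 ℕ.+ 3 ℕ.* y)))
                         ℕ.≤ growth L 0 (3 ℕ.+ y)) K₁-eq (ℕₚ.m+[n∸m]≡n le) (growth-b₃ k (suc x ℕ.∸ k) (4 ℕ.* K ℕ.+ D)))
          where m = k ℕ.+ 6 ℕ.+ 3 ℕ.* suc x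

  -- Ranks of matrices

  lem-Fin : ∀ {a k} (A : Fin k → Set a) → ¬ ¬ ((∀ i → A i) ⊎ (∃[ i ] ¬ A i))
  lem-Fin A = lem (∃[ i ] ¬ A i) >>= λ
    { (inj₁ e) → η (inj₂ e)
    ; (inj₂ ne) → ¬¬-Fin (λ i na → ne (i , na)) >>= λ h → η (inj₁ h) }

  Zero : ∀ {x} {X : Set x} → (X → Carrier) → Set (x ⊔ ℓ)
  Zero f = f ≐ 𝟘

  zero-subspace : ∀ {x} {X : Set x} → Subspace (Zero {X = X})
  zero-subspace = record
    { resp = λ e h → ≐-trans (≐-sym e) h
    ; null = ≐-refl
    ; add = λ h k w → trans (+-cong (h w) (k w)) (+-identityˡ _)
    ; scl = λ a h w → trans (*-congˡ (h w)) (zeroʳ a) }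

  In-within : ∀ {x p q} {X : Set x} {P : (X → Carrier) → Set p} {Q : (X → Carrier) → Set q} → Subspace Q →
              ∀ {L f} → All Q L → Q f → In P L f → In (λ f → Q f × P f) L f
  In-within sQ [] qf (Level.lift h) = Level.lift (qf , h)
  In-within sQ (ql ∷ qL) qf (a , h) = a , In-within sQ qL (Subspace.sub sQ qf (Subspace.scl sQ a ql)) h

  In-append : ∀ {x p q} {X : Set x} {P : (X → Carrier) → Set p} {Q : (X → Carrier) → Set q} L {L' f} →
              (∀ {g} → Q g → ¬ ¬ In P L' g) → In Q L f → ¬ ¬ In P (L List.++ L') f
  In-append [] h (Level.lift q) = h q
  In-append (l ∷ L) h (a , k) = In-append L h k >>= λ k → η (a , k)

  Echelon : ∀ {A C s} (M : Fin A → Fin C → Carrier) → (Fin s → Fin C) → Set (c ⊔ ℓ)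
  Echelon {A} M ι = ∃[ π ] (Linear π × (∀ j → π (col (ι j)) ≐ 𝟘) ×
    (∀ f → In Zero (List.tabulate (λ j → col (ι j))) (f ⊖ π f)) × Independent M ι)
    where
    col : Fin _ → Fin A → Carrier
    col σ τ = M τ σ

  SpanningColumns : ∀ {A C} → (Fin A → Fin C → Carrier) → ℕ → Set (c ⊔ ℓ)
  SpanningColumns {A} {C} M r = Σ ℕ λ s → Σ (Fin s → Fin C) λ ι → s ℕ.≤ r ×
    (∀ σ → In Zero (List.tabulate (λ j τ → M τ (ι j))) (λ τ → M τ σ))

  cons : ∀ {a} {A : Set a} {s} → A → (Fin s → A) → Fin (suc s) → A
  cons x f zero = x
  cons x f (suc i) = f i

  -- Equality in F is not assumed stable, so the independence of pivot columns is witnessed by the projection π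
  -- along them: a new column with a nonzero entry after projection is independent of the old ones.
  module _ {A C} (M : Fin A → Fin C → Carrier) where
    private
      col : Fin C → Fin A → Carrier
      col σ τ = M τ σ

    extend-echelon : ∀ {s} {ι : Fin s → Fin C} (e : Echelon M ι) (σ : Fin C) (τ : Fin A) →
                     ¬ (proj₁ e (col σ) τ ≈ 0#) → Echelon M (cons σ ι)
    extend-echelon {s} {ι} (π , lin , kills , spans , ind) σ τ nz = π' , lin' , kills' , spans' , ind'
      where
      v = π (col σ)
      i = proj₁ (inverse (v τ) nz)
      vi = proj₂ (inverse (v τ) nz)
      π' : (Fin A → Carrier) → Fin A → Carrier
      -- One elimination step with pivot `v τ`: the new projection also kills column σ.
      π' f = π f ⊖ (π f τ * i) ⊙ v
      lin' : Linear π'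
      lin' = record
        { cong = λ e w → +-cong (cong lin e w) (-‿cong (*-congʳ (*-congʳ (cong lin e τ))))
        ; hom+ = λ f g w → trans (+-cong (hom+ lin f g w) (-‿cong (*-congʳ (*-congʳ (hom+ lin f g τ)))))
            (solve 6 (λ x y p q i v → (x :+ y) :- ((p :+ q) :* i) :* v := (x :- (p :* i) :* v) :+ (y :- (q :* i) :* v)) refl
               (π f w) (π g w) (π f τ) (π g τ) i (v w))
        ; hom* = λ a f w → trans (+-cong (hom* lin a f w) (-‿cong (*-congʳ (*-congʳ (hom* lin a f τ)))))
            (solve 5 (λ a x p i v → a :* x :- ((a :* p) :* i) :* v := a :* (x :- (p :* i) :* v)) refl a (π f w) (π f τ) i (v w)) }
      kills' : ∀ j → π' (col (cons σ ι j)) ≐ 𝟘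
      kills' zero w = trans (+-congˡ (-‿cong (trans (*-congʳ vi) (*-identityˡ _)))) (-‿inverseʳ _)
      kills' (suc j) w = trans (+-cong (kills j w) (neg-0 (trans (*-congʳ (trans (*-congʳ (kills j τ)) (zeroˡ i))) (zeroˡ _)))) (+-identityʳ _)
      L = List.tabulate (λ j → col (ι j))
      spans' : ∀ f → In Zero (col σ ∷ L) (f ⊖ π' f)
      spans' f = a , In-resp zero-subspace L
        (λ w → solve 5 (λ f p a c v → (f :- p) :- a :* (c :- v) := (f :- (p :- a :* v)) :- a :* c) refl (f w) (π f w) a (col σ w) (v w))
        (In-add zero-subspace L (spans f) (In-resp zero-subspace L (λ w → solve 2 (λ a x → (:- a) :* x := :- (a :* x)) refl a _) (In-scl zero-subspace L (- a) (spans (col σ)))))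
        where a = π f τ * i
      ind' : Independent M (cons σ ι)
      ind' a h = λ { zero → a₀ ; (suc j) → ind (λ j → a (suc j)) (λ t → trans (sym (trans (+-congʳ (trans (*-congʳ a₀) (zeroˡ _))) (+-identityˡ _))) (h t)) j }
        where
        open ≈-R
        comb : Fin A → Carrier
        comb = a zero ⊙ col σ ⊕ ⨁ (λ j → a (suc j) ⊙ col (ι j))
        πcomb : π comb τ ≈ a zero * v τ
        πcomb = begin
          π comb τ ≈⟨ hom+ lin (a zero ⊙ col σ) (⨁ (λ j → a (suc j) ⊙ col (ι j))) τ ⟩
          π (a zero ⊙ col σ) τ + π (⨁ (λ j → a (suc j) ⊙ col (ι j))) τ
            ≈⟨ +-cong (hom* lin (a zero) (col σ) τ) (trans (homΣ lin (λ j → a (suc j) ⊙ col (ι j)) τ)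
                 (∑-0 (λ j → trans (hom* lin (a (suc j)) (col (ι j)) τ) (trans (*-congˡ (kills j τ)) (zeroʳ _))))) ⟩
          a zero * v τ + 0# ≈⟨ +-identityʳ _ ⟩
          a zero * v τ ∎
        a₀ : a zero ≈ 0#
        a₀ = begin
          a zero ≈⟨ sym (*-identityʳ _) ⟩
          a zero * 1# ≈⟨ *-congˡ (sym vi) ⟩
          a zero * (v τ * i) ≈⟨ sym (*-assoc _ _ _) ⟩
          (a zero * v τ) * i ≈⟨ *-congʳ (trans (sym πcomb) (to0 lin h τ)) ⟩
          0# * i ≈⟨ zeroˡ i ⟩
          0# ∎

    -- Pivot columns are added as long as the projection leaves some column nonzero. By hypothesis
    -- this cannot reach r + 1 columns, so it stops with a spanning set of at most r.
    columns-spanned : ∀ {r} → (∀ (ι : Fin (suc r) → Fin C) → ¬ Independent M ι) →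
      ¬ ¬ SpanningColumns M r
    columns-spanned {r} dep = go (suc r) {ι = λ ()} ≡.refl ((λ f → f) , idL′ , (λ ()) , (λ f → Level.lift (λ w → -‿inverseʳ (f w))) , λ a h ())
      where
      idL′ : Linear (λ (f : Fin A → Carrier) → f)
      idL′ = idL
      go : ∀ n {s} {ι : Fin s → Fin C} → s ℕ.+ n ≡ suc r → Echelon M ι →
           ¬ ¬ SpanningColumns M r
      go zero {s} {ι} eq (π , _ , _ , _ , ind) with ≡.trans (≡.sym (ℕₚ.+-identityʳ s)) eq
      ... | ≡.refl = ⊥-elim (dep ι ind)
      go (suc n) {s} {ι} eq e@(π , lin , kills , spans , ind) =
        lem-Fin (λ σ → π (col σ) ≐ 𝟘) >>= λ
          { (inj₁ all) → η (s , ι , ℕₚ.≤-pred (ℕₚ.≤-trans (ℕₚ.m≤m+n (suc s) n) (ℕₚ.≤-reflexive (≡.trans (≡.sym (ℕₚ.+-suc s n)) eq))) ,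
              λ σ → In-resp zero-subspace (List.tabulate (λ j → col (ι j)))
                      (λ w → trans (+-congˡ (neg-0 (all σ w))) (+-identityʳ _)) (spans (col σ)))
          ; (inj₂ (σ , nz)) → lem-Fin (λ τ → π (col σ) τ ≈ 0#) >>= λ
              { (inj₁ z) → ⊥-elim (nz z)
              ; (inj₂ (τ , nzτ)) → go n (≡.trans (≡.sym (ℕₚ.+-suc s n)) eq) (extend-echelon e σ τ nzτ) } }

  -- Gaussian elimination of the generator l: either no x i involves it, or some x i₀ does and
  -- clears it from the others. The others keep their dual points, because x i₀ vanishes there.
  dual-bound : ∀ {a} {X : Set a} q (x : Fin q → X → Carrier) (w : Fin q → X) →
    (∀ i → x i (w i) ≈ 1#) → (∀ i j → i ≢ j → x i (w j) ≈ 0#) →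
    ∀ L → (∀ i → In Zero L (x i)) → ¬ ¬ (q ℕ.≤ length L)
  dual-bound zero x w one zer L h = η z≤n
  dual-bound (suc q) x w one zer [] h = ⊥-elim (0≉1 (trans (sym (Level.lower (h zero) (w zero))) (one zero)))
  dual-bound (suc q) x w one zer (l ∷ L) h = lem-Fin (λ i → proj₁ (h i) ≈ 0#) >>= λ
    { (inj₁ all) → dual-bound (suc q) x w one zer L (λ i → In-resp zero-subspace L
        (λ v → trans (+-congˡ (neg-0 (trans (*-congʳ (all i)) (zeroˡ _)))) (+-identityʳ _)) (proj₂ (h i))) >>= λ le → η (ℕₚ.m≤n⇒m≤1+n le)
    ; (inj₂ (i₀ , nz)) → let (b , inv) = inverse _ nz in
        dual-bound q (λ j → x (punchIn i₀ j) ⊖ (proj₁ (h (punchIn i₀ j)) * b) ⊙ x i₀) (λ j → w (punchIn i₀ j))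
          (λ j → trans (+-cong (one _) (neg-0 (trans (*-congˡ (zer i₀ (punchIn i₀ j) (λ e → Finₚ.punchInᵢ≢i i₀ j (≡.sym e)))) (zeroʳ _)))) (+-identityʳ _))
          (λ j k ne → trans (+-cong (zer _ _ (λ e → ne (Finₚ.punchIn-injective i₀ j k e)))
                            (neg-0 (trans (*-congˡ (zer i₀ (punchIn i₀ k) (λ e → Finₚ.punchInᵢ≢i i₀ k (≡.sym e)))) (zeroʳ _)))) (+-identityʳ _))
          L (λ j → reduce i₀ (punchIn i₀ j) b inv)
        >>= λ le → η (s≤s le) }
    where
    reduce : ∀ i₀ i b → proj₁ (h i₀) * b ≈ 1# → In Zero L (x i ⊖ (proj₁ (h i) * b) ⊙ x i₀)
    reduce i₀ i b inv = In-resp zero-subspace L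
      (λ v → begin
        (x i v + - (a * l v)) + - (a * b) * (x i₀ v + - (a₀ * l v))
          ≈⟨ solve 6 (λ u a l b y a₀ → (u :- a :* l) :+ (:- (a :* b)) :* (y :- a₀ :* l)
                := (u :- (a :* b) :* y) :+ (:- (a :* l) :+ (a :* l) :* (a₀ :* b))) refl (x i v) a (l v) b (x i₀ v) a₀ ⟩
        (x i v + - (a * b * x i₀ v)) + (- (a * l v) + a * l v * (a₀ * b))
          ≈⟨ +-congˡ (trans (+-congˡ (trans (*-congˡ inv) (*-identityʳ _))) (-‿inverseˡ _)) ⟩
        (x i v + - (a * b * x i₀ v)) + 0# ≈⟨ +-identityʳ _ ⟩
        x i v + - (a * b * x i₀ v) ∎)
      (In-add zero-subspace L (proj₂ (h i)) (In-scl zero-subspace L (- (a * b)) (proj₂ (h i₀))))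
      where
      open ≈-R
      a = proj₁ (h i)
      a₀ = proj₁ (h i₀)

  -- Boundary matrices

  unique-concatMap : ∀ {A B : Set} {f : A → List B} {xs} → Unique xs → (∀ x → Unique (f x)) →
                     (∀ {x y} → x ≢ y → Disjoint (f x) (f y)) → Unique (concatMap f xs)
  unique-concatMap {f = f} {xs} u uf dis =
    Uniqueₚ.concat⁺ (Allₚ.map⁺ (All.universal uf xs)) (AllPairsₚ.map⁺ (AllPairs.map dis u))

  allEdges-∈ : ∀ {m n} (e : Edge m n) → e ∈ allEdges m n
  allEdges-∈ (i , j) = ∈-concatMap⁺ (λ i → map (λ j → (i , j)) (allFin _)) (lose (∈-allFin i) (∈-map⁺ (i ,_) (∈-allFin j)))

  allEdges-unique : ∀ m n → Unique (allEdges m n)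
  allEdges-unique m n = unique-concatMap (Uniqueₚ.allFin⁺ m)
    (λ i → Uniqueₚ.map⁺ (λ { ≡.refl → ≡.refl }) (Uniqueₚ.allFin⁺ n))
    (λ ne (p , q) → let (_ , _ , e) = ∈-map⁻ _ p ; (_ , _ , e') = ∈-map⁻ _ q in
       ne (≡.cong proj₁ (≡.trans (≡.sym e) e')))

  allVecs-∈ : ∀ {A : Set} {xs : List A} → (∀ x → x ∈ xs) → ∀ {p} (v : Vec A p) → v ∈ allVecs xs p
  allVecs-∈ h [] = here ≡.refl
  allVecs-∈ {xs = xs} h {suc p} (x ∷ v) = ∈-concatMap⁺ (λ x → map (x ∷_) (allVecs xs p)) (lose (h x) (∈-map⁺ (x ∷_) (allVecs-∈ h v)))

  allVecs-unique : ∀ {A : Set} {xs : List A} → Unique xs → ∀ p → Unique (allVecs xs p)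
  allVecs-unique u zero = [] ∷ []
  allVecs-unique u (suc p) = unique-concatMap u
    (λ x → Uniqueₚ.map⁺ Vecₚ.∷-injectiveʳ (allVecs-unique u p))
    (λ ne (p , q) → let (_ , _ , e) = ∈-map⁻ _ p ; (_ , _ , e') = ∈-map⁻ _ q in
       ne (Vecₚ.∷-injectiveˡ (≡.trans (≡.sym e) e')))

  lookup-injective : ∀ {A : Set} {xs : List A} → Unique xs → ∀ i j → lookup xs i ≡ lookup xs j → i ≡ j
  lookup-injective (u ∷ us) zero zero e = ≡.refl
  lookup-injective (u ∷ us) zero (suc j) e = ⊥-elim (All.lookup u (∈-lookup j) e)
  lookup-injective (u ∷ us) (suc i) zero e = ⊥-elim (All.lookup u (∈-lookup i) (≡.sym e))
  lookup-injective (u ∷ us) (suc i) (suc j) e = ≡.cong suc (lookup-injective us i j e)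

  isFace? : ∀ {m n p} (v : Vec (Edge m n) p) → Dec (isFace v ≡ true)
  isFace? v = isFace v Boolₚ.≟ true

  face-injective : ∀ m n p i j → face m n p i ≡ face m n p j → i ≡ j
  face-injective m n p = lookup-injective (Uniqueₚ.filter⁺ isFace? (allVecs-unique (allEdges-unique m n) p))

  face-isFace : ∀ m n p i → isFace (face m n p i) ≡ true
  face-isFace m n p i = proj₂ (∈-filter⁻ isFace? {xs = allVecs (allEdges m n) p} (∈-lookup i))

  face-surjective : ∀ m n p v → isFace v ≡ true → ∃[ i ] (face m n p i ≡ v)
  face-surjective m n p v h = Any.index v∈ , ≡.sym (lookup-index v∈)
    where
    v∈ : v ∈ faces m n p
    v∈ = ∈-filter⁺ isFace? (allVecs-∈ allEdges-∈ v) h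

  sumL : ∀ {A : Set} → (A → Carrier) → List A → Carrier
  sumL g [] = 0#
  sumL g (x ∷ xs) = g x + sumL g xs

  sumL-lookup : ∀ {A : Set} (g : A → Carrier) xs → ∑ (λ i → g (lookup xs i)) ≈ sumL g xs
  sumL-lookup g [] = refl
  sumL-lookup g (x ∷ xs) = +-congˡ (sumL-lookup g xs)

  sumL-cong : ∀ {A : Set} {g h : A → Carrier} → (∀ x → g x ≈ h x) → ∀ xs → sumL g xs ≈ sumL h xs
  sumL-cong e [] = refl
  sumL-cong e (x ∷ xs) = +-cong (e x) (sumL-cong e xs)

  sumL-++ : ∀ {A : Set} (g : A → Carrier) xs ys → sumL g (xs List.++ ys) ≈ sumL g xs + sumL g ys
  sumL-++ g [] ys = sym (+-identityˡ _)
  sumL-++ g (x ∷ xs) ys = trans (+-congˡ (sumL-++ g xs ys)) (sym (+-assoc _ _ _))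

  sumL-concatMap : ∀ {A B : Set} (g : B → Carrier) (f : A → List B) xs → sumL g (concatMap f xs) ≈ sumL (λ x → sumL g (f x)) xs
  sumL-concatMap g f [] = refl
  sumL-concatMap g f (x ∷ xs) = trans (sumL-++ g (f x) (concatMap f xs)) (+-congˡ (sumL-concatMap g f xs))

  sumL-map : ∀ {A B : Set} (g : B → Carrier) (f : A → B) xs → sumL g (map f xs) ≈ sumL (λ x → g (f x)) xs
  sumL-map g f [] = refl
  sumL-map g f (x ∷ xs) = +-congˡ (sumL-map g f xs)

  sumL-tabulate : ∀ {A : Set} {k} (g : A → Carrier) (f : Fin k → A) → sumL g (tabulate f) ≈ ∑ (λ i → g (f i))
  sumL-tabulate {k = zero} g f = refl
  sumL-tabulate {k = suc k} g f = +-congˡ (sumL-tabulate g (λ i → f (suc i)))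

  guard : Bool → Carrier → Carrier
  guard b x = if b then x else 0#

  sumL-faces : ∀ {m n p} (g : Vec (Edge m n) p → Carrier) xs →
               sumL g (filter isFace? xs) ≈ sumL (λ w → guard (isFace w) (g w)) xs
  sumL-faces g [] = refl
  sumL-faces g (x ∷ xs) with isFace x
  ... | true = +-congˡ (sumL-faces g xs)
  ... | false = trans (sumL-faces g xs) (sym (+-identityˡ _))

  ∑E : ∀ {m n} → (Edge m n → Carrier) → Carrier
  ∑E g = ∑ λ r → ∑ λ s → g (r , s)

  ∑E-cong : ∀ {m n} {f g : Edge m n → Carrier} → (∀ e → f e ≈ g e) → ∑E f ≈ ∑E g
  ∑E-cong h = ∑-cong (λ r → ∑-cong (λ s → h (r , s)))

  ∑E-single : ∀ {m n} (f : Edge m n → Carrier) e → (∀ e' → e' ≢ e → f e' ≈ 0#) → ∑E f ≈ f e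
  ∑E-single f (r , s) h = trans
    (∑-single (λ r → ∑ (λ s → f (r , s))) r (λ r' ne → ∑-0 (λ s' → h (r' , s') (λ eq → ne (≡.cong proj₁ eq)))))
    (∑-single (λ s → f (r , s)) s (λ s' ne → h (r , s') (λ eq → ne (≡.cong proj₂ eq))))

  ∑E-swap : ∀ {m n k} (f : Edge m n → Fin k → Carrier) → ∑E (λ e → ∑ (f e)) ≈ ∑ (λ t → ∑E (λ e → f e t))
  ∑E-swap f = trans (∑-cong (λ r → ∑-swap (λ s t → f (r , s) t))) (∑-swap (λ r t → ∑ (λ s → f (r , s) t)))

  ∑V : ∀ {m n} p → (Vec (Edge m n) p → Carrier) → Carrier
  ∑V zero g = g []
  ∑V (suc p) g = ∑E (λ e → ∑V p (λ w → g (e ∷ w)))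

  ∑V-cong : ∀ {m n} p {f g : Vec (Edge m n) p → Carrier} → (∀ w → f w ≈ g w) → ∑V p f ≈ ∑V p g
  ∑V-cong zero h = h []
  ∑V-cong (suc p) h = ∑E-cong (λ e → ∑V-cong p (λ w → h (e ∷ w)))

  ∑V-0 : ∀ {m n} p {f : Vec (Edge m n) p → Carrier} → (∀ w → f w ≈ 0#) → ∑V p f ≈ 0#
  ∑V-0 zero h = h []
  ∑V-0 (suc p) h = ∑-0 (λ r → ∑-0 (λ s → ∑V-0 p (λ w → h ((r , s) ∷ w))))

  ∑V-swap : ∀ {m n} p {k} (f : Vec (Edge m n) p → Fin k → Carrier) → ∑V p (λ w → ∑ (f w)) ≈ ∑ (λ t → ∑V p (λ w → f w t))
  ∑V-swap zero f = refl
  ∑V-swap (suc p) f = trans (∑E-cong (λ e → ∑V-swap p (λ w → f (e ∷ w)))) (∑E-swap (λ e t → ∑V p (λ w → f (e ∷ w) t)))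

  sumL-allEdges : ∀ {m n} (g : Edge m n → Carrier) → sumL g (allEdges m n) ≈ ∑E g
  sumL-allEdges {m} {n} g = trans (sumL-concatMap g (λ i → map (λ j → (i , j)) (allFin n)) (allFin m))
    (trans (sumL-tabulate (λ i → sumL g (map (λ j → (i , j)) (allFin n))) (λ i → i))
      (∑-cong (λ i → trans (sumL-map g (i ,_) (allFin n)) (sumL-tabulate (λ j → g (i , j)) (λ j → j)))))

  sumL-allVecs : ∀ {m n} p (g : Vec (Edge m n) p → Carrier) → sumL g (allVecs (allEdges m n) p) ≈ ∑V p g
  sumL-allVecs zero g = +-identityʳ _
  sumL-allVecs {m} {n} (suc p) g = trans (sumL-concatMap g (λ x → map (x ∷_) (allVecs (allEdges m n) p)) (allEdges m n))
    (trans (sumL-cong (λ x → trans (sumL-map g (x ∷_) (allVecs (allEdges m n) p)) (sumL-allVecs p (λ w → g (x ∷ w)))) (allEdges m n))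
      (sumL-allEdges (λ x → ∑V p (λ w → g (x ∷ w)))))

  ∑-faces : ∀ m n p (g : Vec (Edge m n) p → Carrier) → ∑ (λ σ → g (face m n p σ)) ≈ ∑V p (λ w → guard (isFace w) (g w))
  ∑-faces m n p g = trans (sumL-lookup g (faces m n p)) (trans (sumL-faces g (allVecs (allEdges m n) p)) (sumL-allVecs p _))

  _≟V_ : ∀ {m n p} (v w : Vec (Edge m n) p) → Dec (v ≡ w)
  _≟V_ = Vecₚ.≡-dec (Prodₚ.≡-dec Finₚ._≟_ Finₚ._≟_)

  guard-⇔ : ∀ {a b} {P : Set a} {Q : Set b} (d : Dec P) (d' : Dec Q) → (P → Q) → (Q → P) → ∀ x → guard ⌊ d ⌋ x ≈ guard ⌊ d' ⌋ x
  guard-⇔ (yes p) (yes q) f g x = refl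
  guard-⇔ (yes p) (no nq) f g x = ⊥-elim (nq (f p))
  guard-⇔ (no np) (yes q) f g x = ⊥-elim (np (g q))
  guard-⇔ (no np) (no nq) f g x = refl

  guard-no : ∀ {a} {P : Set a} (d : Dec P) → ¬ P → ∀ x → guard ⌊ d ⌋ x ≈ 0#
  guard-no (yes p) n x = ⊥-elim (n p)
  guard-no (no _) n x = refl

  ∑V-single : ∀ {m n} p (τ : Vec (Edge m n) p) (h : Vec (Edge m n) p → Carrier) → ∑V p (λ w → guard ⌊ w ≟V τ ⌋ (h w)) ≈ h τ
  ∑V-single {m} {n} zero [] h = guard-⇔ (_≟V_ {m} {n} [] []) (yes ≡.refl) (λ e → e) (λ e → e) (h [])
  ∑V-single (suc p) (x ∷ τ) h = trans
    (∑E-single _ x (λ y ne → ∑V-0 p (λ w → guard-no ((y ∷ w) ≟V (x ∷ τ)) (λ e → ne (Vecₚ.∷-injectiveˡ e)) _)))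
    (trans (∑V-cong p (λ w → guard-⇔ ((x ∷ w) ≟V (x ∷ τ)) (w ≟V τ) Vecₚ.∷-injectiveʳ (≡.cong (x ∷_)) _))
      (∑V-single p τ (λ w → h (x ∷ w))))

  removeAt-suc : ∀ {A : Set} {p} (y : A) (w : Vec A (suc p)) t → removeAt (y ∷ w) (suc t) ≡ y ∷ removeAt w t
  removeAt-suc y (_ ∷ _) t = ≡.refl

  ∑V-removeAt : ∀ {m n p} (t : Fin (suc p)) (τ : Vec (Edge m n) p) (h : Vec (Edge m n) (suc p) → Carrier) →
                ∑V (suc p) (λ w → guard ⌊ removeAt w t ≟V τ ⌋ (h w)) ≈ ∑E (λ e → h (insertAt τ t e))
  ∑V-removeAt {p = p} zero τ h = ∑E-cong (λ e → ∑V-single p τ (λ w → h (e ∷ w)))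
  ∑V-removeAt {p = suc p} (suc t) (x ∷ τ) h = trans
    (∑E-single _ x (λ y ne → ∑V-0 (suc p) (λ w → guard-no (removeAt (y ∷ w) (suc t) ≟V (x ∷ τ))
       (λ e → ne (Vecₚ.∷-injectiveˡ (≡.trans (≡.sym (removeAt-suc y w t)) e))) (h (y ∷ w)))))
    (trans (∑V-cong (suc p) (λ w → guard-⇔ (removeAt (x ∷ w) (suc t) ≟V (x ∷ τ)) (removeAt w t ≟V τ)
         (λ e → Vecₚ.∷-injectiveʳ (≡.trans (≡.sym (removeAt-suc x w t)) e))
         (λ e → ≡.trans (removeAt-suc x w t) (≡.cong (x ∷_) e)) (h (x ∷ w))))
      (∑V-removeAt t τ (λ w → h (x ∷ w))))

  Before : ∀ {m n} → Edge m n → Edge m n → Set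
  Before (i , j) (i' , j') = toℕ i ℕ.< toℕ i' × j ≢ j'

  headOK⇒ : ∀ {m n p} (e : Edge m n) (w : Vec (Edge m n) p) → headOK e w ≡ true → AllV (Before e) w
  headOK⇒ e [] h = []
  headOK⇒ (i , j) ((i' , j') ∷ w) h with toℕ i ℕₚ.<? toℕ i' | j Finₚ.≟ j'
  headOK⇒ (i , j) ((i' , j') ∷ w) () | yes _ | yes _
  ... | yes lt | no ne = (lt , ne) ∷ headOK⇒ (i , j) w h
  headOK⇒ (i , j) ((i' , j') ∷ w) () | no _ | _

  ⇒headOK : ∀ {m n p} (e : Edge m n) (w : Vec (Edge m n) p) → AllV (Before e) w → headOK e w ≡ true
  ⇒headOK e [] h = ≡.refl
  ⇒headOK (i , j) ((i' , j') ∷ w) ((lt , ne) ∷ h) with toℕ i ℕₚ.<? toℕ i' | j Finₚ.≟ j'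
  ... | yes _ | yes eq = ⊥-elim (ne eq)
  ... | yes _ | no _ = ⇒headOK (i , j) w h
  ... | no nl | _ = ⊥-elim (nl lt)

  isFace-∷⇒ : ∀ {m n p} (e : Edge m n) (w : Vec (Edge m n) p) → isFace (e ∷ w) ≡ true → AllV (Before e) w × isFace w ≡ true
  isFace-∷⇒ e w h with headOK e w in eq
  ... | true = headOK⇒ e w eq , h
  isFace-∷⇒ e w () | false

  isFace-∷ : ∀ {m n p} (e : Edge m n) (w : Vec (Edge m n) p) → AllV (Before e) w → isFace (e ∷ w) ≡ isFace w
  isFace-∷ e w h rewrite ⇒headOK e w h = ≡.refl

  isFace-¬ : ∀ {m n p} (e : Edge m n) (w : Vec (Edge m n) p) → ¬ AllV (Before e) w → isFace (e ∷ w) ≡ false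
  isFace-¬ e w n with headOK e w in eq
  ... | true = ⊥-elim (n (headOK⇒ e w eq))
  ... | false = ≡.refl

  Apart : ∀ {m n} → Edge m n → Edge m n → Set
  Apart (i , j) (i' , j') = toℕ i ≢ toℕ i' × j ≢ j'

  all-insertAt : ∀ {A : Set} {P : A → Set} {p} (w : Vec A p) t {e} → P e → AllV P w → AllV P (insertAt w t e)
  all-insertAt w zero pe pw = pe ∷ pw
  all-insertAt (x ∷ w) (suc t) pe (px ∷ pw) = px ∷ all-insertAt w t pe pw

  all-inserted : ∀ {A : Set} {P : A → Set} {p} (w : Vec A p) t {e} → AllV P (insertAt w t e) → P e
  all-inserted w zero (pe ∷ _) = pe
  all-inserted (x ∷ w) (suc t) (_ ∷ h) = all-inserted w t h

  -- Rows increase strictly along a face, so an edge disjoint from it fits at exactly one position.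
  positions : ∀ {m n p} (e : Edge m n) (τ : Vec (Edge m n) p) → isFace τ ≡ true → AllV (Apart e) τ →
              ∑ (λ t → guard (isFace (insertAt τ t e)) 1#) ≈ 1#
  positions e [] h ap = +-identityʳ _
  positions e@(i , j) (x@(i' , j') ∷ τ) h (a ∷ ap) with ℕₚ.<-cmp (toℕ i) (toℕ i')
  ... | tri≈ _ eq _ = ⊥-elim (proj₁ a eq)
  ... | tri< lt _ _ = trans
    (+-cong (reflexive (≡.cong (λ b → guard b 1#) (≡.trans (isFace-∷ e (x ∷ τ) before) h)))
      (∑-0 (λ t → reflexive (≡.cong (λ b → guard b 1#)
        (isFace-¬ x (insertAt τ t e) (λ all → ℕₚ.<-asym lt (proj₁ (all-inserted τ t all))))))))
    (+-identityʳ _)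
    where
    before : AllV (Before e) (x ∷ τ)
    before = (lt , proj₂ a) ∷ Allᵥ.map (λ { ((l , _) , (_ , n)) → ℕₚ.<-trans lt l , n }) (Allᵥ.zip (proj₁ (isFace-∷⇒ x τ h) , ap))
  ... | tri> _ _ gt = trans
    (+-cong (reflexive (≡.cong (λ b → guard b 1#) (isFace-¬ e (x ∷ τ) (λ { ((l , _) ∷ _) → ℕₚ.<-asym l gt }))))
      (∑-cong (λ t → reflexive (≡.cong (λ b → guard b 1#)
        (isFace-∷ x (insertAt τ t e) (all-insertAt τ t (gt , λ eq → proj₂ a (≡.sym eq)) (proj₁ (isFace-∷⇒ x τ h))))))))
    (trans (+-identityˡ _) (positions e τ (proj₂ (isFace-∷⇒ x τ h)) ap))

  conflict : ∀ {m n p} {R : Sub m} {S : Sub n} {f : Ch m n (suc p)} → Good R S f → ∀ e (τ : Vec (Edge m n) p) →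
             AllV (Apart e) τ ⊎ f (e ∷ τ) ≈ 0#
  conflict gf e [] = inj₁ []
  conflict {R = R} {S} gf e@(i , j) (x@(i' , j') ∷ τ) with i Finₚ.≟ i' | j Finₚ.≟ j'
  ... | yes ≡.refl | _ = inj₂ (good-out (good-ι gf e) x (λ (h , _) → proj₁ (∖-in R h) ≡.refl) τ)
  ... | no _ | yes ≡.refl = inj₂ (good-out (good-ι gf e) x (λ (_ , h) → proj₁ (∖-in S h) ≡.refl) τ)
  ... | no n | no n' with conflict (good-ι gf x) e τ
  ...   | inj₁ ap = inj₁ (((λ eq → n (Finₚ.toℕ-injective eq)) , n') ∷ ap)
  ...   | inj₂ z = inj₂ (trans (good-alt₂ gf e x τ) (neg-0 z))

  sign-suc : ∀ t → sign (suc t) ≈ - sign t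
  sign-suc zero = refl
  sign-suc (suc zero) = solve 1 (λ x → x := :- (:- x)) refl 1#
  sign-suc (suc (suc t)) = sign-suc t

  sign² : ∀ t → sign t * sign t ≈ 1#
  sign² zero = *-identityˡ 1#
  sign² (suc t) = trans (*-cong (sign-suc t) (sign-suc t)) (trans (solve 1 (λ x → (:- x) :* (:- x) := x :* x) refl (sign t)) (sign² t))

  insertAt-sign : ∀ {m n p} {R : Sub m} {S : Sub n} {f : Ch m n (suc p)} → Good R S f → ∀ (τ : Vec (Edge m n) p) t e →
                  f (insertAt τ t e) ≈ sign (toℕ t) * f (e ∷ τ)
  insertAt-sign gf τ zero e = sym (*-identityˡ _)
  insertAt-sign {f = f} gf (x ∷ τ) (suc t) e = begin
    f (x ∷ insertAt τ t e) ≈⟨ insertAt-sign (good-ι gf x) τ t e ⟩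
    sign (toℕ t) * f (x ∷ e ∷ τ) ≈⟨ *-congˡ (good-alt₂ gf x e τ) ⟩
    sign (toℕ t) * - f (e ∷ x ∷ τ) ≈⟨ solve 2 (λ s f → s :* (:- f) := (:- s) :* f) refl _ _ ⟩
    - sign (toℕ t) * f (e ∷ x ∷ τ) ≈⟨ *-congʳ (sym (sign-suc (toℕ t))) ⟩
    sign (toℕ (suc t)) * f (e ∷ x ∷ τ) ∎
    where open ≈-R

  -- Moving the inserted edge back to the front costs the sign of its position, which cancels the
  -- given one, and by `positions` a single insertion is a face. If e meets τ, all terms vanish.
  insert-sum : ∀ {m n p} {R : Sub m} {S : Sub n} {f : Ch m n (suc p)} → Good R S f → ∀ (τ : Vec (Edge m n) p) → isFace τ ≡ true → ∀ e →
               ∑ (λ t → sign (toℕ t) * guard (isFace (insertAt τ t e)) (f (insertAt τ t e))) ≈ f (e ∷ τ)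
  insert-sum {f = f} gf τ hτ e with conflict gf e τ
  ... | inj₂ z = trans (∑-0 (λ t → trans (*-congˡ {x = sign (toℕ t)} (vanish (isFace (insertAt τ t e)) (trans (insertAt-sign gf τ t e) (trans (*-congˡ z) (zeroʳ _))))) (zeroʳ _))) (sym z)
    where
    vanish : ∀ b {x} → x ≈ 0# → guard b x ≈ 0#
    vanish true h = h
    vanish false h = refl
  ... | inj₁ ap = begin
    ∑ (λ t → sign (toℕ t) * guard (isFace (insertAt τ t e)) (f (insertAt τ t e))) ≈⟨ ∑-cong (λ t → term t (isFace (insertAt τ t e))) ⟩
    ∑ (λ t → f (e ∷ τ) * guard (isFace (insertAt τ t e)) 1#) ≈⟨ ∑-* (f (e ∷ τ)) (λ t → guard (isFace (insertAt τ t e)) 1#) ⟩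
    f (e ∷ τ) * ∑ (λ t → guard (isFace (insertAt τ t e)) 1#) ≈⟨ *-congˡ (positions e τ hτ ap) ⟩
    f (e ∷ τ) * 1# ≈⟨ *-identityʳ _ ⟩
    f (e ∷ τ) ∎
    where
    open ≈-R
    term : ∀ t b → sign (toℕ t) * guard b (f (insertAt τ t e)) ≈ f (e ∷ τ) * guard b 1#
    term t false = trans (zeroʳ _) (sym (zeroʳ _))
    term t true = begin
      sign (toℕ t) * f (insertAt τ t e) ≈⟨ *-congˡ (insertAt-sign gf τ t e) ⟩
      sign (toℕ t) * (sign (toℕ t) * f (e ∷ τ)) ≈⟨ sym (*-assoc _ _ _) ⟩
      (sign (toℕ t) * sign (toℕ t)) * f (e ∷ τ) ≈⟨ *-congʳ (sign² (toℕ t)) ⟩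
      1# * f (e ∷ τ) ≈⟨ *-comm _ _ ⟩
      f (e ∷ τ) * 1# ∎

  -- The link between the two descriptions of chains. The sum over faces is extended to all words by
  -- a guard and sorted by the removed position; the words in question are then the insertions of an
  -- edge e into τ, which `insert-sum` evaluates.
  boundary-matrix : ∀ {m n p} {R : Sub m} {S : Sub n} {f : Ch m n (suc p)} → Good R S f → ∀ τ →
                    ∑ (λ σ → LinAlg.∂ F m n p τ σ * f (face m n (suc p) σ)) ≈ ∂ f (face m n p τ)
  boundary-matrix {m} {n} {p} {f = f} gf τ# = begin
    ∑ (λ σ → LinAlg.∂ F m n p τ# σ * f (face m n (suc p) σ))
      ≈⟨ ∑-faces m n (suc p) (λ w → coefficient w * f w) ⟩
    ∑V (suc p) (λ w → guard (isFace w) (coefficient w * f w))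
      ≈⟨ ∑V-cong (suc p) (λ w → trans (move (isFace w) (coefficient w) (f w))
           (trans (*-comm _ _) (trans (sym (∑-* (guard (isFace w) (f w)) (λ t → guard ⌊ removeAt w t ≟V τ ⌋ (sign (toℕ t)))))
              (∑-cong (λ t → push ⌊ removeAt w t ≟V τ ⌋ (guard (isFace w) (f w)) (sign (toℕ t))))))) ⟩
    ∑V (suc p) (λ w → ∑ (λ t → guard ⌊ removeAt w t ≟V τ ⌋ (sign (toℕ t) * guard (isFace w) (f w))))
      ≈⟨ ∑V-swap (suc p) (λ w t → guard ⌊ removeAt w t ≟V τ ⌋ (sign (toℕ t) * guard (isFace w) (f w))) ⟩
    ∑ (λ t → ∑V (suc p) (λ w → guard ⌊ removeAt w t ≟V τ ⌋ (sign (toℕ t) * guard (isFace w) (f w))))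
      ≈⟨ ∑-cong (λ t → ∑V-removeAt t τ (λ w → sign (toℕ t) * guard (isFace w) (f w))) ⟩
    ∑ (λ t → ∑E (λ e → sign (toℕ t) * guard (isFace (insertAt τ t e)) (f (insertAt τ t e))))
      ≈⟨ sym (∑E-swap (λ e t → sign (toℕ t) * guard (isFace (insertAt τ t e)) (f (insertAt τ t e)))) ⟩
    ∑E (λ e → ∑ (λ t → sign (toℕ t) * guard (isFace (insertAt τ t e)) (f (insertAt τ t e))))
      ≈⟨ ∑E-cong (λ e → insert-sum gf τ (face-isFace m n p τ#) e) ⟩
    ∂ f τ ∎
    where
    open ≈-R
    τ = face m n p τ#
    coefficient : Vec (Edge m n) (suc p) → Carrier
    coefficient w = ∑ (λ t → guard ⌊ removeAt w t ≟V τ ⌋ (sign (toℕ t)))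
    move : ∀ b x y → guard b (x * y) ≈ x * guard b y
    move true x y = refl
    move false x y = sym (zeroʳ x)
    push : ∀ b x s → x * guard b s ≈ guard b (s * x)
    push true x s = *-comm x s
    push false x s = zeroʳ x

  -- By `insert-sum` the value at e followed by a face is a signed sum of values at faces, and
  -- induction on the contraction extends this to all words.
  zero-on-faces : ∀ {m n} p {R : Sub m} {S : Sub n} {f : Ch m n p} → Good R S f → (∀ w → isFace w ≡ true → f w ≈ 0#) → f ≐ 𝟘
  zero-on-faces zero gf h [] = h [] ≡.refl
  zero-on-faces (suc p) {f = f} gf h (e ∷ w) = zero-on-faces p (good-ι gf e)
    (λ τ hτ → trans (sym (insert-sum gf τ hτ e)) (∑-0 (λ t → trans (*-congˡ {x = sign (toℕ t)} (vanish {insertAt τ t e} (isFace (insertAt τ t e)) ≡.refl)) (zeroʳ _)))) w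
    where
    vanish : ∀ {v} b → isFace v ≡ b → guard b (f v) ≈ 0#
    vanish true eq = h _ eq
    vanish false eq = refl

  simplex : ∀ {m n p} → Vec (Edge m n) p → Ch m n p
  simplex [] = λ _ → 1#
  simplex (e ∷ w) = wedge e (simplex w)

  simplex-good : ∀ {m n p} {R : Sub m} {S : Sub n} (w : Vec (Edge m n) p) → isFace w ≡ true → AllV (Inside R S) w → Good R S (simplex w)
  simplex-good [] h ins = g0
  simplex-good {R = R} {S} (e@(i , j) ∷ w) h (he ∷ hw) = wedge-good e he
    (simplex-good w (proj₂ (isFace-∷⇒ e w h)) (Allᵥ.map
       (λ { ((lt , ne) , (a , b)) → in-∖ R (λ eq → ℕₚ.<-irrefl (≡.cong toℕ (≡.sym eq)) lt) a , in-∖ S (λ eq → ne (≡.sym eq)) b })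
       (Allᵥ.zip (proj₁ (isFace-∷⇒ e w h) , hw))))

  full : ∀ {m} → Sub m
  full _ = true

  all-full : ∀ {m n p} (w : Vec (Edge m n) p) → AllV (Inside full full) w
  all-full [] = []
  all-full (e ∷ w) = (≡.refl , ≡.refl) ∷ all-full w

  wedge-absent : ∀ {m n p} (e : Edge m n) (y : Ch m n p) (w : Vec (Edge m n) (suc p)) → AllV (e ≢_) w → wedge e y w ≈ 0#
  wedge-absent {p = zero} e y (x ∷ w) (ne ∷ _) = δ*-≢ ne _
  wedge-absent {p = suc p} e y (x ∷ w) (ne ∷ h) = trans (+-cong (δ*-≢ ne _) (neg-0 (wedge-absent e (ι x y) w h))) (+-identityʳ _)

  -- The other term of `wedge` vanishes at τ. If the row of t is at most that of e, then t lies
  -- before all of σ and the contraction is zero; otherwise e lies before all of τ and does not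
  -- occur there.
  simplex-head : ∀ {m n p} (e t : Edge m n) (σ τ : Vec (Edge m n) p) → isFace (e ∷ σ) ≡ true → isFace (t ∷ τ) ≡ true →
                 simplex (e ∷ σ) (t ∷ τ) ≈ δ e t * simplex σ τ
  simplex-head {p = zero} e t [] [] hσ hτ = refl
  simplex-head {p = suc p} e@(i , j) t@(i' , j') σ τ hσ hτ = trans (+-congˡ (neg-0 second)) (+-identityʳ _)
    where
    bσ = proj₁ (isFace-∷⇒ e σ hσ)
    second : wedge e (ι t (simplex σ)) τ ≈ 0#
    second with toℕ i' ℕₚ.≤? toℕ i
    ... | yes le = wedge-to0 e (good-out (simplex-good {R = full ∖ i'} {full} σ (proj₂ (isFace-∷⇒ e σ hσ))
            (Allᵥ.map (λ { (lt , _) → in-∖ full (λ eq → ℕₚ.<-irrefl (≡.cong toℕ (≡.sym eq)) (ℕₚ.≤-<-trans le lt)) ≡.refl , ≡.refl }) bσ))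
          t (λ (h , _) → proj₁ (∖-in full h) ≡.refl)) τ
    ... | no nle = wedge-absent e (ι t (simplex σ)) τ
            (Allᵥ.map (λ { (lt , _) ≡.refl → ℕₚ.<-asym lt (ℕₚ.≰⇒> nle) }) (proj₁ (isFace-∷⇒ t τ hτ)))

  simplex-self : ∀ {m n p} (σ : Vec (Edge m n) p) → isFace σ ≡ true → simplex σ σ ≈ 1#
  simplex-self [] h = refl
  simplex-self (e ∷ σ) h = trans (simplex-head e e σ σ h h) (trans (δ*-refl e _) (simplex-self σ (proj₂ (isFace-∷⇒ e σ h))))

  simplex-other : ∀ {m n p} (σ τ : Vec (Edge m n) p) → isFace σ ≡ true → isFace τ ≡ true → σ ≢ τ → simplex σ τ ≈ 0#
  simplex-other [] [] hσ hτ ne = ⊥-elim (ne ≡.refl)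
  simplex-other (e ∷ σ) (t ∷ τ) hσ hτ ne with e ≟E t
  ... | no n = trans (simplex-head e t σ τ hσ hτ) (δ*-≢ n _)
  ... | yes ≡.refl = trans (simplex-head e t σ τ hσ hτ) (trans (*-congˡ
        (simplex-other σ τ (proj₂ (isFace-∷⇒ e σ hσ)) (proj₂ (isFace-∷⇒ t τ hτ)) (λ eq → ne (≡.cong (e ∷_) eq)))) (zeroʳ _))

  card-full : ∀ m → card (full {m}) ≡ m
  card-full zero = ≡.refl
  card-full (suc m) = ≡.cong suc (card-full m)

  -- A linear relation between images lifts to the sources modulo the kernel of φ, with the same
  -- coefficients.
  In-pullback : ∀ {x y} {X : Set x} {Y : Set y} {φ : (X → Carrier) → Y → Carrier} → Linear φ →
    ∀ {s} (g : Fin s → X → Carrier) (h : Fin s → Y → Carrier) → (∀ j → φ (g j) ≐ h j) →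
    ∀ {z y} → φ z ≐ y → In Zero (List.tabulate h) y → In (λ f → Zero (φ f)) (List.tabulate g) z
  In-pullback lin {zero} g h e ez (Level.lift k) = Level.lift (≐-trans ez k)
  In-pullback lin {suc s} g h e {z} {y} ez (a , k) = a ,
    In-pullback lin (λ j → g (suc j)) (λ j → h (suc j)) (λ j → e (suc j))
      (λ w → trans (hom- lin z (a ⊙ g zero) w) (+-cong (ez w) (-‿cong (trans (hom* lin a (g zero) w) (*-congˡ (e zero w)))))) k

  module _ (m n : ℕ) where
    private
      C : ∀ {p} → Ch m n p → Set (c ⊔ ℓ)
      C = Good full full

      b : ∀ p → Fin (#faces m n p) → Ch m n p
      b p σ = simplex (face m n p σ)

      b-good : ∀ p σ → C (b p σ)
      b-good p σ = simplex-good (face m n p σ) (face-isFace m n p σ) (all-full _)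

      b-self : ∀ p σ → b p σ (face m n p σ) ≈ 1#
      b-self p σ = simplex-self (face m n p σ) (face-isFace m n p σ)

      b-other : ∀ p σ τ → σ ≢ τ → b p σ (face m n p τ) ≈ 0#
      b-other p σ τ ne = simplex-other _ _ (face-isFace m n p σ) (face-isFace m n p τ) (λ e → ne (face-injective m n p σ τ e))

      determined : ∀ p {f : Ch m n p} → C f → (∀ τ → f (face m n p τ) ≈ 0#) → f ≐ 𝟘
      determined p {f} cf h = zero-on-faces p cf (λ w hw → at w (face-surjective m n p w hw))
        where
        at : ∀ w → ∃[ τ ] (face m n p τ ≡ w) → f w ≈ 0#
        at _ (τ , ≡.refl) = h τ

      expansion : ∀ p {f : Ch m n p} → C f → ⨁ (λ σ → f (face m n p σ) ⊙ b p σ) ≐ f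
      expansion p {f} cf w = trans (solve 2 (λ s f → s := (s :- f) :+ f) refl _ (f w)) (trans (+-congʳ (diff w)) (+-identityˡ _))
        where
        s = ⨁ (λ σ → f (face m n p σ) ⊙ b p σ)
        diff : s ⊖ f ≐ 𝟘
        diff = determined p (GoodS.sub (GoodS.sum _ (λ σ → GoodS.scl _ (b-good p σ))) cf)
          (λ τ → trans (+-congʳ (trans (∑-single _ τ (λ σ ne → trans (*-congˡ (b-other p σ τ ne)) (zeroʳ _)))
                                       (trans (*-congˡ (b-self p τ)) (*-identityʳ _)))) (-‿inverseʳ _))

      Φ : ∀ p → Ch m n (suc p) → Fin (#faces m n p) → Carrier
      Φ p f τ = ∂ f (face m n p τ)

      Φ-linear : ∀ p → Linear (Φ p)
      Φ-linear p = record
        { cong = λ e τ → cong ∂-linear e _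
        ; hom+ = λ f g τ → hom+ ∂-linear f g _
        ; hom* = λ a f τ → hom* ∂-linear a f _ }

      Φ-b : ∀ p σ → Φ p (b (suc p) σ) ≐ (λ τ → LinAlg.∂ F m n p τ σ)
      Φ-b p σ τ = trans (sym (boundary-matrix (b-good (suc p) σ) τ))
        (trans (∑-single (λ σ' → LinAlg.∂ F m n p τ σ' * b (suc p) σ (face m n (suc p) σ')) σ
                  (λ σ' ne → trans (*-congˡ (b-other (suc p) σ σ' (λ e → ne (≡.sym e)))) (zeroʳ _)))
          (trans (*-congˡ (b-self (suc p) σ)) (*-identityʳ _)))

    -- The boundary matrix gives ∂ in the basis of faces. Columns spanning its column space
    -- therefore name faces that span all chains modulo the kernel of ∂, that is, modulo cycles.
    chains-mod-cycles : ∀ p {r} → (∀ (ι : Fin (suc r) → Fin (#faces m n (suc p))) → ¬ Independent (LinAlg.∂ F m n p) ι) →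
      ¬ ¬ (Σ (List (Ch m n (suc p))) λ L → length L ℕ.≤ r × (∀ f → Good full full f → In (Cycle full full) L f))
    chains-mod-cycles p dep = columns-spanned (LinAlg.∂ F m n p) dep >>= λ S → η (from S)
      where
      from : SpanningColumns (LinAlg.∂ F m n p) _ → Σ (List (Ch m n (suc p))) λ L → length L ℕ.≤ _ × (∀ f → Good full full f → In (Cycle full full) L f)
      from (s , ι , le , span) = L , ℕₚ.≤-trans (ℕₚ.≤-reflexive (Listₚ.length-tabulate (λ j → b (suc p) (ι j)))) le ,
        λ f cf → In-resp sZ L (expansion (suc p) cf) (Subspace.sum (In-sub sZ L) (λ σ → f (face m n (suc p) σ) ⊙ b (suc p) σ) (λ σ → In-scl sZ L _ (basis σ)))
        where
        L = List.tabulate (λ j → b (suc p) (ι j))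
        sZ = cycle-subspace full full {suc p}
        basis : ∀ σ → In (Cycle full full) L (b (suc p) σ)
        basis σ = In-mono (λ (cf , z) → cycle cf (determined p (∂-good cf) z)) L
          (In-within (good-subspace full full) (Allₚ.tabulate⁺ (λ j → b-good (suc p) (ι j))) (b-good (suc p) σ)
            (In-pullback (Φ-linear p) (λ j → b (suc p) (ι j)) (λ j τ → LinAlg.∂ F m n p τ (ι j)) (λ j → Φ-b p (ι j)) (Φ-b p σ) (span σ)))

    -- Along boundaries ⊆ cycles ⊆ chains, at most r₁ generators are needed modulo cycles, N for
    -- cycles modulo boundaries, and r₂ for boundaries. As the faces have dual points, their number
    -- is at most r₁ + N + r₂, and the two ranks cancel.
    betti≤ : ∀ d {β N} → HomLe m n (suc d) N → IsReducedBetti m n d β → ¬ ¬ (β ℕ.≤ N)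
    betti≤ d {β} {N} hN (r₁ , r₂ , (_ , dep₁) , (_ , dep₂) , eq) =
      chains-mod-cycles d dep₁ >>= λ { (L₁ , le₁ , h₁) →
      hN full full (card-full m) (card-full n) >>= λ { (L , lenL , h) →
      chains-mod-cycles (suc d) dep₂ >>= λ { (L₂ , le₂ , h₂) →
      let L' = L₁ List.++ (L List.++ List.map ∂ L₂)
          boundaries : ∀ {g} → Bd full full g → In Zero (List.map ∂ L₂) g
          boundaries bg = In-resp zero-subspace (List.map ∂ L₂) (≐-sym (feq bg)) (In-map ∂-linear zero-subspace cyc L₂ (h₂ (filling bg) (fgood bg)))
          spanned : ∀ σ → ¬ ¬ In Zero L' (b (suc d) σ)
          spanned σ = In-append L₁ (λ {g} cg → h g cg >>= In-append L (λ bg → η (boundaries bg))) (h₁ _ (b-good (suc d) σ))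
      in ¬¬-Fin spanned >>= λ sp →
         dual-bound (#faces m n (suc d)) (b (suc d)) (face m n (suc d)) (b-self (suc d)) (b-other (suc d)) L' sp >>= λ le →
         η (sizes L₁ L L₂ le₁ lenL le₂ le) } } }
      where
      sizes : ∀ (L₁ L : List (Ch m n (suc d))) (L₂ : List (Ch m n (suc (suc d)))) → length L₁ ℕ.≤ r₁ → length L ≡ N → length L₂ ℕ.≤ r₂ →
              #faces m n (suc d) ℕ.≤ length (L₁ List.++ (L List.++ List.map ∂ L₂)) → β ℕ.≤ N
      sizes L₁ L L₂ le₁ lenL le₂ le = ℕₚ.+-cancelʳ-≤ (r₁ ℕ.+ r₂) β N (begin
        β ℕ.+ (r₁ ℕ.+ r₂) ≡⟨ ≡.sym (ℕₚ.+-assoc β r₁ r₂) ⟩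
        β ℕ.+ r₁ ℕ.+ r₂ ≡⟨ eq ⟩
        #faces m n (suc d) ≤⟨ le ⟩
        length (L₁ List.++ (L List.++ List.map ∂ L₂))
          ≡⟨ ≡.trans (Listₚ.length-++ L₁) (≡.cong (length L₁ ℕ.+_) (≡.trans (Listₚ.length-++ L) (≡.cong₂ ℕ._+_ lenL (Listₚ.length-map ∂ L₂)))) ⟩
        length L₁ ℕ.+ (N ℕ.+ length L₂) ≤⟨ ℕₚ.+-mono-≤ le₁ (ℕₚ.+-monoʳ-≤ N le₂) ⟩
        r₁ ℕ.+ (N ℕ.+ r₂) ≡⟨ rearrange r₁ N r₂ ⟩
        N ℕ.+ (r₁ ℕ.+ r₂) ∎)
        where
        open ℕₚ.≤-Reasoning
        rearrange : ∀ x y z → x ℕ.+ (y ℕ.+ z) ≡ y ℕ.+ (x ℕ.+ z)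
        rearrange = solve-∀

-- From homology bounds to the polynomial inequality

open import Data.Nat using (_+_; _*_; _∸_; _≤_)

private
  betti-at : ∀ {c ℓ} (F : Field c ℓ) k {K} a x β → Homology.BettiBounded F k K a x →
    LinAlg.IsReducedBetti F (k + a + 3 * (2 + x) ∸ 1) (k + 2 * a + 3 * (2 + x) ∸ 1) (k + a + 2 * (2 + x) ∸ 2) β →
    toℚ β ℚ.≤ fPoly k (Polynomials.errorTerm k K) (toℚ a) (toℚ (2 + x))
  betti-at F k {K} a x β (N , hN , bound) hβ = decidable-stable (toℚ β ℚₚ.≤? _) λ no →
    Homology.betti≤ F _ _ _ (Homology.HomLe-cast F ≡.refl ≡.refl (e₀ k a x) hN)
      -- With b = 2 + x the truncated subtractions are exact, and p = d + 1 since p counts vertices.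
      (cast (≡.cong (_∸ 1) (e₁ k a x)) (≡.cong (_∸ 1) (e₂ k a x)) (≡.cong (_∸ 2) (e₃ k a x)) hβ)
      λ β≤N → no (Polynomials.bound-fPoly k K a (2 + x) β (ℕₚ.≤-trans (ℕₚ.*-monoˡ-≤ (denom k) β≤N) bound))
    where
    cast : ∀ {m m' n n' d d'} → m ≡ m' → n ≡ n' → d ≡ d' → LinAlg.IsReducedBetti F m n d β → LinAlg.IsReducedBetti F m' n' d' β
    cast ≡.refl ≡.refl ≡.refl h = h
    e₀ : ∀ k a x → k + a + 3 + 2 * x ≡ 1 + (k + a + 2 + 2 * x)
    e₀ = solve-∀
    e₁ : ∀ k a x → k + a + 3 * (2 + x) ≡ 1 + (k + a + 5 + 3 * x)
    e₁ = solve-∀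
    e₂ : ∀ k a x → k + 2 * a + 3 * (2 + x) ≡ 1 + (k + 2 * a + 5 + 3 * x)
    e₂ = solve-∀
    e₃ : ∀ k a x → k + a + 2 * (2 + x) ≡ 2 + (k + a + 2 + 2 * x)
    e₃ = solve-∀

  conclude : ∀ {c ℓ} (F : Field c ℓ) (k : ℕ) → ∃[ K ] (∀ a x → k ≤ x → Homology.BettiBounded F k K a x) →
    ∃[ ε ] (DegreeBelow (3 * k) ε ×
      (∀ (a b : ℕ) → k + 2 ≤ b → ∀ (β : ℕ) →
        LinAlg.IsReducedBetti F (k + a + 3 * b ∸ 1) (k + 2 * a + 3 * b ∸ 1) (k + a + 2 * b ∸ 2) β →
        toℚ β ℚ.≤ fPoly k ε (toℚ a) (toℚ b)))
  conclude F k (K , bounded) = Polynomials.errorTerm k K , Polynomials.degree-errorTerm k K ,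
    λ a b h β → at a b (≡.subst (_≤ b) (ℕₚ.+-comm k 2) h) β
    where
    at : ∀ a b → 2 + k ≤ b → ∀ β →
      LinAlg.IsReducedBetti F (k + a + 3 * b ∸ 1) (k + 2 * a + 3 * b ∸ 1) (k + a + 2 * b ∸ 2) β →
      toℚ β ℚ.≤ fPoly k (Polynomials.errorTerm k K) (toℚ a) (toℚ b)
    at a (suc (suc x)) (s≤s (s≤s k≤x)) β = betti-at F k {K} a x β (bounded a x k≤x)

theorem4p11 : ∀ {c ℓ} (F : Field c ℓ) (k : ℕ) →
    ∃[ ε ] (DegreeBelow (3 * k) ε ×
    (∀ (a b : ℕ) → k + 2 ≤ b → ∀ (β : ℕ) →
    LinAlg.IsReducedBetti F (k + a + 3 * b ∸ 1) (k + 2 * a + 3 * b ∸ 1) (k + a + 2 * b ∸ 2) β →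
    toℚ β ℚ.≤ fPoly k ε (toℚ a) (toℚ b)))
theorem4p11 F k = conclude F k (Homology.betti-bound F k)
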